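{- Let $\Gamma$ be a cubical set, $\varphi:\Gamma\to\mathbb{F}$ a natural transformation, $A$ a fibrant type over $\Gamma$, $T$ a fibrant type over $\Gamma,\varphi$, and $w$ a term of $T\to A$ over $\Gamma,\varphi$ equipped with an equivalence structure. Then $\mathrm{Glue}(\varphi,T,A,w)$ carries a composition structure. Moreover this can be done so that: if $\varphi$ is the constant $1_\mathbb{F}$ (so that $\mathrm{Glue}(\varphi,T,A,w)=T$) the composition structure is that of $T$; and for any $\sigma:\Delta\to\Gamma$, $\mathrm{Glue}(\varphi,T,A,w)\sigma=\mathrm{Glue}(\varphi\sigma,T\sigma,A\sigma,w\sigma)$ and the substituted composition structure coincides with the one constructed from the substituted data (with the substituted equivalence structure).
   Context: Setting: names, $\mathsf{dM}(J)$ the free de Morgan algebra on $J$, cube category $\mathcal{C}$ (objects finite sets of names, $f:J\to I$ a map $I\to\mathsf{dM}(J)$, composition by substitution), $I,i=I\cup\{i\}$, face maps $(ib):I\to I,i$, $\deg_i:I,i\to I$ the inclusion, $(f,i{=}j):J,j\to I,i$ ($i\mapsto j$, $k\mapsto f(k)$). Cubical sets are presheaves on $\mathcal{C}$. $\mathbb{F}$ is the face lattice (distributive lattice generated by $(k=0),(k=1)$ with $(k=0)\wedge(k=1)=0_\mathbb{F}$), a cubical set via substitution $\varphi f$ ($(k=1)\mapsto(f(k)=1)$, $(k=0)\mapsto(1-f(k)=1)$). A type $A$ over $\Gamma$: sets $A\rho$ ($\rho\in\Gamma(I)$) with functorial restrictions $x\mapsto xf\in A(\rho f)$; a term: compatible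 family $a\rho\in A\rho$; substitution $(A\sigma)\rho=A(\sigma\rho)$. For $\varphi:\Gamma\to\mathbb{F}$, $\Gamma,\varphi$ is the subpresheaf $\{\rho:\varphi\rho=1_\mathbb{F}\}$; types/terms over $\Gamma$ restrict to it. For types $T,A$ over $\Delta$, $(T\to A)\rho$ ($\rho\in\Delta(I)$) is the set of families $(w_f)_{f:J\to I}$, $w_f:T(\rho f)\to A(\rho f)$, with $(w_fx)g=w_{fg}(xg)$, restriction $(wf)_g=w_{fg}$; for a term $w$ write $w\langle\rho\rangle=(w\rho)_{\mathrm{id}}:T\rho\to A\rho$. For $\rho\in\Delta(I)$ and $x,y\in A\rho$, $P_A(\rho;x,y)$ is the set of classes $\langle i\rangle v$, $i\notin I$, $v\in A(\rho\deg_i)$, $v(i0)=x$, $v(i1)=y$, identified up to renaming $i$; restriction $(\langle i\rangle v)f=\langle j\rangle(v(f,i{=}j))\in P_A(\rho f;xf,yf)$. A composition structure on $A$ over $\Gamma$ assigns to each $I$, $i\notin I$, $\rho\in\Gamma(I,i)$, $\psi\in\mathbb{F}(I)$, family $u=(u_f)$ over $f:J\to I,i$ with $\psi f=1_\mathbb{F}$, $u_f\in A(\rho f)$, $u_fg=u_{fg}$, and $a_0\in A(\rho(i0))$ with $a_0f=u_{(i0)f}$ whenever $\psi f=1_\mathbb{F}$, an element $\mathrm{comp}(I,i,\rho,\psi,u,a_0)\in A(\rho(i1))$, natural: $\mathrm{comp}(\dots)f=\mathrm{comp}(J,j,\rho(f,i{=}j),\psi f,u',a_0f)$ with $u'_g=u_{(f,i=j)g}$,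 and equal to $u_{(i1)}$ when $\psi=1_\mathbb{F}$; fibrant = type with composition structure; for $\sigma$, $\mathrm{comp}_{A\sigma}(I,i,\rho,\dots)=\mathrm{comp}_A(I,i,\sigma\rho,\dots)$. An equivalence structure for a term $w$ of $T\to A$ over $\Delta$ assigns to each $\rho\in\Delta(I)$, $\psi\in\mathbb{F}(I)$, $b\in A\rho$, compatible family $t=(t_f)$ over $f:J\to I$ with $\psi f=1_\mathbb{F}$, $t_f\in T(\rho f)$, and compatible family $\omega=(\omega_f)$ with $\omega_f\in P_A(\rho f;w\langle\rho f\rangle(t_f),bf)$, elements $e_0\in T\rho$ and $e_1\in P_A(\rho;w\langle\rho\rangle(e_0),b)$ with $e_0f=t_f$, $e_1f=\omega_f$ whenever $\psi f=1_\mathbb{F}$, and natural: $e_\nu(\rho,\psi,b,t,\omega)g=e_\nu(\rho g,\psi g,bg,tg,\omega g)$ where $(tg)_h=t_{gh}$. Semantic glueing: for $\varphi:\Gamma\to\mathbb{F}$, $T$ over $\Gamma,\varphi$, $A$ over $\Gamma$, $w$ a term of $T\to A$ over $\Gamma,\varphi$, and $\rho\in\Gamma(I)$: if $\varphi\rho=1_\mathbb{F}$, $\mathrm{Glue}(\varphi,T,A,w)\rho=T\rho$ (with $T$'s restrictions); otherwise its elements are formal triples $\mathrm{glue}(\varphi\rho,t,a)$ where $t=(t_f)$ is a compatible family over $f:J\to I$ with $\varphi\rho f=1_\mathbb{F}$, $t_f\in T(\rho f)$, and $a\in A\rho$ with $w\langle\rho f\rangle(t_f)=af$ for all such $f$;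 the restriction along $g:J\to I$ is $t_g$ if $\varphi\rho g=1_\mathbb{F}$ and $\mathrm{glue}(\varphi\rho g,tg,ag)$ otherwise. -}

module Defs where

open import Level using (Level; _⊔_) renaming (suc to lsuc; zero to lzero)
open import Data.Bool.Base using (Bool; true; false) renaming (_∧_ to _and_; _∨_ to _or_)
import Data.Bool.Properties as 𝔹
open import Data.Empty using (⊥-elim; ⊥-elim-irr)
open import Data.List.Base using (List)
open import Data.List.Membership.Propositional using () renaming (_∈_ to _∈ˡ_)
open import Data.List.Relation.Unary.Any using (here; there)
open import Data.List.Relation.Unary.All.Properties using (¬Any⇒All¬)
open import Data.List.Relation.Unary.Unique.Propositional using (Unique)
open import Data.List.Relation.Unary.AllPairs using (_∷_)
open import Data.List.Relation.Binary.Permutation.Propositional using (↭-sym; ↭⇒↭ₛ)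
open import Data.List.Relation.Binary.Permutation.Propositional.Properties using (∈-resp-↭)
import Data.List.Relation.Binary.Permutation.Setoid.Properties as PermSetoid
open import Data.Nat.Base using (ℕ)
open import Data.Product.Base using (_×_; _,_)
open import Data.Nat.Properties using (_≟_; ≤-totalOrder; ≤-decTotalOrder)
open import Data.List.Relation.Unary.Sorted.TotalOrder ≤-totalOrder using (Sorted)
open import Data.List.Sort.InsertionSort.Base ≤-decTotalOrder using (insert)
open import Data.List.Sort.InsertionSort.Properties ≤-decTotalOrder using (insert-↭; insert-↗)
open import Relation.Binary.Bundles using (Setoid)
open import Relation.Binary.PropositionalEquality using (_≡_; _≢_; refl; sym; trans; cong₂)
open import Relation.Binary.PropositionalEquality.Properties using () renaming (setoid to ≡-setoid)
open import Relation.Nullary.Decidable.Core using (Dec; yes; no)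
open import Relation.Nullary.Negation.Core using (¬_)

Name : Set
Name = ℕ

-- Sorted without repetition: each finite set of names has exactly one
-- representation.

record FinSet : Set where
  constructor finSet
  field
    names   : List Name
    .sorted : Sorted names
    .unique : Unique names

infix 4 _∈_ _∉_

_∈_ : Name → FinSet → Set
k ∈ I = k ∈ˡ FinSet.names I

_∉_ : Name → FinSet → Set
k ∉ I = ¬ (k ∈ I)

record Fresh (I : FinSet) : Set where
  constructor fresh
  field
    name   : Name
    .notIn : name ∉ I

open Fresh using (name)

-- I , i  for  i ∉ I

infixl 20 _▹_

_▹_ : (I : FinSet) → Fresh I → FinSet
finSet ns s u ▹ fresh i i∉ =
  finSet (insert i ns) (insert-↗ i s)
    (PermSetoid.Unique-resp-↭ (≡-setoid ℕ) (↭⇒↭ₛ (↭-sym (insert-↭ i ns)))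
      (¬Any⇒All¬ ns i∉ ∷ u))

new∈ : (I : FinSet) (i : Fresh I) → name i ∈ I ▹ i
new∈ (finSet ns _ _) (fresh i _) = ∈-resp-↭ (↭-sym (insert-↭ i ns)) (here refl)

old∈ : (I : FinSet) (i : Fresh I) {k : Name} → k ∈ I → k ∈ I ▹ i
old∈ (finSet ns _ _) (fresh i _) m = ∈-resp-↭ (↭-sym (insert-↭ i ns)) (there m)

old∈⁻ : (I : FinSet) (i : Fresh I) {k : Name} → k ∈ I ▹ i → k ≢ name i → k ∈ I
old∈⁻ (finSet ns _ _) (fresh i _) m k≢i with ∈-resp-↭ (insert-↭ i ns) m
... | here k≡i = ⊥-elim (k≢i k≡i)
... | there m′ = m′

old≢new : (I : FinSet) (i : Fresh I) {k : Name} → k ∈ I → .(name i ∉ I) → k ≢ name i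
old≢new I i m n refl = ⊥-elim-irr (n m)

-- The free de Morgan algebra on J: terms, up to the congruence generated by
-- the axioms.

infixr 7 _∧_
infixr 6 _∨_
infix  8 ∼_

data DM (J : FinSet) : Set where
  gen     : (k : Name) → .(k ∈ J) → DM J
  𝟎 𝟏     : DM J
  _∧_ _∨_ : DM J → DM J → DM J
  ∼_      : DM J → DM J

infix 4 _≈ᵈ_

data _≈ᵈ_ {J : FinSet} : DM J → DM J → Set where
  ≈-refl  : ∀ {r} → r ≈ᵈ r
  ≈-sym   : ∀ {r s} → r ≈ᵈ s → s ≈ᵈ r
  ≈-trans : ∀ {r s t} → r ≈ᵈ s → s ≈ᵈ t → r ≈ᵈ t
  ∧-cong  : ∀ {r r′ s s′} → r ≈ᵈ r′ → s ≈ᵈ s′ → r ∧ s ≈ᵈ r′ ∧ s′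
  ∨-cong  : ∀ {r r′ s s′} → r ≈ᵈ r′ → s ≈ᵈ s′ → r ∨ s ≈ᵈ r′ ∨ s′
  ∼-cong  : ∀ {r r′} → r ≈ᵈ r′ → ∼ r ≈ᵈ ∼ r′
  ∧-assoc : ∀ r s t → (r ∧ s) ∧ t ≈ᵈ r ∧ (s ∧ t)
  ∨-assoc : ∀ r s t → (r ∨ s) ∨ t ≈ᵈ r ∨ (s ∨ t)
  ∧-comm  : ∀ r s → r ∧ s ≈ᵈ s ∧ r
  ∨-comm  : ∀ r s → r ∨ s ≈ᵈ s ∨ r
  ∧-absorbs-∨ : ∀ r s → r ∧ (r ∨ s) ≈ᵈ r
  ∨-absorbs-∧ : ∀ r s → r ∨ (r ∧ s) ≈ᵈ r
  ∧-distrib-∨ : ∀ r s t → r ∧ (s ∨ t) ≈ᵈ (r ∧ s) ∨ (r ∧ t)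
  ∨-distrib-∧ : ∀ r s t → r ∨ (s ∧ t) ≈ᵈ (r ∨ s) ∧ (r ∨ t)
  ∧-identity  : ∀ r → 𝟏 ∧ r ≈ᵈ r
  ∨-identity  : ∀ r → 𝟎 ∨ r ≈ᵈ r
  ∼-invol     : ∀ r → ∼ ∼ r ≈ᵈ r
  ∼-∧         : ∀ r s → ∼ (r ∧ s) ≈ᵈ ∼ r ∨ ∼ s
  ∼-∨         : ∀ r s → ∼ (r ∨ s) ≈ᵈ ∼ r ∧ ∼ s

record Hom (J I : FinSet) : Set where
  constructor hom
  field img : (k : Name) → .(k ∈ I) → DM J

open Hom using (img)

infix 4 _≈ʰ_

record _≈ʰ_ {J I : FinSet} (f f′ : Hom J I) : Set where
  constructor homEq
  field img-≈ : (k : Name) .(m : k ∈ I) → img f k m ≈ᵈ img f′ k m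

open _≈ʰ_ public

infixl 9 _⟨_⟩ᵈ
infixl 9 _∘_

_⟨_⟩ᵈ : {I J : FinSet} → DM I → Hom J I → DM J
gen k m ⟨ f ⟩ᵈ = img f k m
𝟎       ⟨ f ⟩ᵈ = 𝟎
𝟏       ⟨ f ⟩ᵈ = 𝟏
(r ∧ s) ⟨ f ⟩ᵈ = r ⟨ f ⟩ᵈ ∧ s ⟨ f ⟩ᵈ
(r ∨ s) ⟨ f ⟩ᵈ = r ⟨ f ⟩ᵈ ∨ s ⟨ f ⟩ᵈ
(∼ r)   ⟨ f ⟩ᵈ = ∼ (r ⟨ f ⟩ᵈ)

id : {I : FinSet} → Hom I I
id = hom gen

-- Diagrammatic order: f ∘ g is "first f on names, then substitute g",
-- written fg in presheaf notation, so that ρ · (f ∘ g) ≈ (ρ · f) · g.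

_∘_ : {I J K : FinSet} → Hom J I → Hom K J → Hom K I
f ∘ g = hom λ k m → img f k m ⟨ g ⟩ᵈ

endpoint : {I : FinSet} → Bool → DM I
endpoint false = 𝟎
endpoint true  = 𝟏

face : {I : FinSet} (i : Fresh I) → Bool → Hom I (I ▹ i)
face {I} i b = hom λ k m → case k m (k ≟ name i)
  where
  case : (k : Name) → .(k ∈ I ▹ i) → Dec (k ≡ name i) → DM I
  case k m (yes _)  = endpoint b
  case k m (no k≢i) = gen k (old∈⁻ I i m k≢i)

deg : {I : FinSet} (i : Fresh I) → Hom (I ▹ i) I
deg {I} i = hom λ k m → gen k (old∈ I i m)

-- (f , i = j)

lift : {I J : FinSet} → Hom J I → (i : Fresh I) (j : Fresh J) → Hom (J ▹ j) (I ▹ i)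
lift {I} {J} f i j = hom λ k m → case k m (k ≟ name i)
  where
  case : (k : Name) → .(k ∈ I ▹ i) → Dec (k ≡ name i) → DM (J ▹ j)
  case k m (yes _)  = gen (name j) (new∈ J j)
  case k m (no k≢i) = img f k (old∈⁻ I i m k≢i) ⟨ deg j ⟩ᵈ

≈ʰ-refl : ∀ {I J} {f : Hom J I} → f ≈ʰ f
≈ʰ-refl = homEq λ k m → ≈-refl

≈ʰ-sym : ∀ {I J} {f g : Hom J I} → f ≈ʰ g → g ≈ʰ f
≈ʰ-sym p = homEq λ k m → ≈-sym (img-≈ p k m)

≈ʰ-trans : ∀ {I J} {f g h : Hom J I} → f ≈ʰ g → g ≈ʰ h → f ≈ʰ h
≈ʰ-trans p q = homEq λ k m → ≈-trans (img-≈ p k m) (img-≈ q k m)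

sub-cong : ∀ {I J} {r s : DM I} (f : Hom J I) → r ≈ᵈ s → r ⟨ f ⟩ᵈ ≈ᵈ s ⟨ f ⟩ᵈ
sub-cong f ≈-refl = ≈-refl
sub-cong f (≈-sym p) = ≈-sym (sub-cong f p)
sub-cong f (≈-trans p q) = ≈-trans (sub-cong f p) (sub-cong f q)
sub-cong f (∧-cong p q) = ∧-cong (sub-cong f p) (sub-cong f q)
sub-cong f (∨-cong p q) = ∨-cong (sub-cong f p) (sub-cong f q)
sub-cong f (∼-cong p) = ∼-cong (sub-cong f p)
sub-cong f (∧-assoc r s t) = ∧-assoc _ _ _
sub-cong f (∨-assoc r s t) = ∨-assoc _ _ _
sub-cong f (∧-comm r s) = ∧-comm _ _
sub-cong f (∨-comm r s) = ∨-comm _ _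
sub-cong f (∧-absorbs-∨ r s) = ∧-absorbs-∨ _ _
sub-cong f (∨-absorbs-∧ r s) = ∨-absorbs-∧ _ _
sub-cong f (∧-distrib-∨ r s t) = ∧-distrib-∨ _ _ _
sub-cong f (∨-distrib-∧ r s t) = ∨-distrib-∧ _ _ _
sub-cong f (∧-identity r) = ∧-identity _
sub-cong f (∨-identity r) = ∨-identity _
sub-cong f (∼-invol r) = ∼-invol _
sub-cong f (∼-∧ r s) = ∼-∧ _ _
sub-cong f (∼-∨ r s) = ∼-∨ _ _

sub-hom : ∀ {I J} (r : DM I) {f g : Hom J I} → f ≈ʰ g → r ⟨ f ⟩ᵈ ≈ᵈ r ⟨ g ⟩ᵈ
sub-hom (gen k m) p = img-≈ p k m
sub-hom 𝟎 p = ≈-refl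
sub-hom 𝟏 p = ≈-refl
sub-hom (r ∧ s) p = ∧-cong (sub-hom r p) (sub-hom s p)
sub-hom (r ∨ s) p = ∨-cong (sub-hom r p) (sub-hom s p)
sub-hom (∼ r) p = ∼-cong (sub-hom r p)

sub-id : ∀ {I} (r : DM I) → r ⟨ id ⟩ᵈ ≈ᵈ r
sub-id (gen k m) = ≈-refl
sub-id 𝟎 = ≈-refl
sub-id 𝟏 = ≈-refl
sub-id (r ∧ s) = ∧-cong (sub-id r) (sub-id s)
sub-id (r ∨ s) = ∨-cong (sub-id r) (sub-id s)
sub-id (∼ r) = ∼-cong (sub-id r)

sub-∘ : ∀ {I J K} (r : DM I) (f : Hom J I) (g : Hom K J) →
        r ⟨ f ⟩ᵈ ⟨ g ⟩ᵈ ≈ᵈ r ⟨ f ∘ g ⟩ᵈ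
sub-∘ (gen k m) f g = ≈-refl
sub-∘ 𝟎 f g = ≈-refl
sub-∘ 𝟏 f g = ≈-refl
sub-∘ (r ∧ s) f g = ∧-cong (sub-∘ r f g) (sub-∘ s f g)
sub-∘ (r ∨ s) f g = ∨-cong (sub-∘ r f g) (sub-∘ s f g)
sub-∘ (∼ r) f g = ∼-cong (sub-∘ r f g)

∘-cong : ∀ {I J K} {f f′ : Hom J I} {g g′ : Hom K J} →
         f ≈ʰ f′ → g ≈ʰ g′ → f ∘ g ≈ʰ f′ ∘ g′
∘-cong {f′ = f′} {g} p q = homEq λ k m →
  ≈-trans (sub-cong g (img-≈ p k m)) (sub-hom (img f′ k m) q)

∘-assoc : ∀ {I J K L} (f : Hom J I) (g : Hom K J) (h : Hom L K) →
          (f ∘ g) ∘ h ≈ʰ f ∘ (g ∘ h)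
∘-assoc f g h = homEq λ k m → sub-∘ (img f k m) g h

∘-idˡ : ∀ {I J} (f : Hom J I) → id ∘ f ≈ʰ f
∘-idˡ f = ≈ʰ-refl

∘-idʳ : ∀ {I J} (f : Hom J I) → f ∘ id ≈ʰ f
∘-idʳ f = homEq λ k m → sub-id (img f k m)

face-new : ∀ {I} (i : Fresh I) b .(m : name i ∈ I ▹ i) → img (face i b) (name i) m ≈ᵈ endpoint b
face-new i b m with name i ≟ name i
... | yes _  = ≈-refl
... | no i≢i = ⊥-elim (i≢i refl)

face-old : ∀ {I} (i : Fresh I) b k .(m : k ∈ I) .(m′ : k ∈ I ▹ i) → img (face i b) k m′ ≈ᵈ gen k m
face-old {I} i@(fresh _ n) b k m m′ with k ≟ name i
... | yes k≡i = ⊥-elim-irr (old≢new I i m n k≡i)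
... | no  _   = ≈-refl

deg-face : ∀ {I} (i : Fresh I) b → deg i ∘ face i b ≈ʰ id
deg-face {I} i b = homEq λ k m → face-old i b k m (old∈ I i m)

deg-lift : ∀ {I J} (f : Hom J I) (i : Fresh I) (j : Fresh J) → deg i ∘ lift f i j ≈ʰ f ∘ deg j
deg-lift {I} {J} f i@(fresh _ n) j = homEq go
  where
  go : ∀ k .(m : k ∈ I) → img (lift f i j) k (old∈ I i m) ≈ᵈ img f k m ⟨ deg j ⟩ᵈ
  go k m with k ≟ name i
  ... | yes k≡i = ⊥-elim-irr (old≢new I i m n k≡i)
  ... | no  _   = ≈-refl

lift-face : ∀ {I J} (f : Hom J I) (i : Fresh I) (j : Fresh J) b →
            lift f i j ∘ face j b ≈ʰ face i b ∘ f
lift-face {I} {J} f i j b = homEq go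
  where
  endpoint-sub : ∀ b → endpoint {J} b ≈ᵈ endpoint {I} b ⟨ f ⟩ᵈ
  endpoint-sub false = ≈-refl
  endpoint-sub true  = ≈-refl
  go : ∀ k .(m : k ∈ I ▹ i) → img (lift f i j ∘ face j b) k m ≈ᵈ img (face i b ∘ f) k m
  go k m with k ≟ name i
  ... | yes _  = ≈-trans (face-new j b (new∈ J j)) (endpoint-sub b)
  ... | no k≢i = ≈-trans (sub-∘ (img f k _) (deg j) (face j b))
                 (≈-trans (sub-hom (img f k _) (deg-face j b)) (sub-id (img f k _)))

lift-id : ∀ {I} (i : Fresh I) → lift id i i ≈ʰ id
lift-id {I} i = homEq go
  where
  go : ∀ k .(m : k ∈ I ▹ i) → img (lift id i i) k m ≈ᵈ gen k m
  go k m with k ≟ name i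
  ... | yes refl = ≈-refl
  ... | no  _    = ≈-refl

lift-∘ : ∀ {I J K} (f : Hom J I) (g : Hom K J) (h : Hom K I) → h ≈ʰ f ∘ g →
         (i : Fresh I) (j : Fresh J) (k : Fresh K) → lift f i j ∘ lift g j k ≈ʰ lift h i k
lift-∘ {I} {J} f g h e i j k = homEq go
  where
  new : img (lift g j k) (name j) (new∈ J j) ≈ᵈ gen (name k) (new∈ _ k)
  new with name j ≟ name j
  ... | yes _  = ≈-refl
  ... | no j≢j = ⊥-elim (j≢j refl)
  go : ∀ n .(m : n ∈ I ▹ i) → img (lift f i j ∘ lift g j k) n m ≈ᵈ img (lift h i k) n m
  go n m with n ≟ name i
  ... | yes _  = new
  ... | no n≢i =
    ≈-trans (sub-∘ (img f n _) (deg j) (lift g j k))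
    (≈-trans (sub-hom (img f n _) (deg-lift g j k))
    (≈-trans (≈-sym (sub-∘ (img f n _) g (deg k)))
             (sub-cong (deg k) (≈-sym (img-≈ e n _)))))

infixr 7 _⊓_
infixr 6 _⊔ᶠ_

data Face (I : FinSet) : Set where
  is0 is1 : (k : Name) → .(k ∈ I) → Face I
  0F 1F   : Face I
  _⊓_ _⊔ᶠ_ : Face I → Face I → Face I

infix 4 _≈ᶠ_

data _≈ᶠ_ {I : FinSet} : Face I → Face I → Set where
  ≈-refl  : ∀ {φ} → φ ≈ᶠ φ
  ≈-sym   : ∀ {φ ψ} → φ ≈ᶠ ψ → ψ ≈ᶠ φ
  ≈-trans : ∀ {φ ψ χ} → φ ≈ᶠ ψ → ψ ≈ᶠ χ → φ ≈ᶠ χ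
  ⊓-cong  : ∀ {φ φ′ ψ ψ′} → φ ≈ᶠ φ′ → ψ ≈ᶠ ψ′ → φ ⊓ ψ ≈ᶠ φ′ ⊓ ψ′
  ⊔-cong  : ∀ {φ φ′ ψ ψ′} → φ ≈ᶠ φ′ → ψ ≈ᶠ ψ′ → φ ⊔ᶠ ψ ≈ᶠ φ′ ⊔ᶠ ψ′
  ⊓-assoc : ∀ φ ψ χ → (φ ⊓ ψ) ⊓ χ ≈ᶠ φ ⊓ (ψ ⊓ χ)
  ⊔-assoc : ∀ φ ψ χ → (φ ⊔ᶠ ψ) ⊔ᶠ χ ≈ᶠ φ ⊔ᶠ (ψ ⊔ᶠ χ)
  ⊓-comm  : ∀ φ ψ → φ ⊓ ψ ≈ᶠ ψ ⊓ φ
  ⊔-comm  : ∀ φ ψ → φ ⊔ᶠ ψ ≈ᶠ ψ ⊔ᶠ φ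
  ⊓-absorbs-⊔ : ∀ φ ψ → φ ⊓ (φ ⊔ᶠ ψ) ≈ᶠ φ
  ⊔-absorbs-⊓ : ∀ φ ψ → φ ⊔ᶠ (φ ⊓ ψ) ≈ᶠ φ
  ⊓-distrib-⊔ : ∀ φ ψ χ → φ ⊓ (ψ ⊔ᶠ χ) ≈ᶠ (φ ⊓ ψ) ⊔ᶠ (φ ⊓ χ)
  ⊔-distrib-⊓ : ∀ φ ψ χ → φ ⊔ᶠ (ψ ⊓ χ) ≈ᶠ (φ ⊔ᶠ ψ) ⊓ (φ ⊔ᶠ χ)
  ⊓-identity  : ∀ φ → 1F ⊓ φ ≈ᶠ φ
  ⊔-identity  : ∀ φ → 0F ⊔ᶠ φ ≈ᶠ φ
  disjoint    : ∀ k .(m : k ∈ I) → is0 {I} k m ⊓ is1 k m ≈ᶠ 0F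

-- The faces (r = 1) and (r = 0), the latter being (1 - r = 1).

[_=1] [_=0] : {I : FinSet} → DM I → Face I
[ gen k m =1] = is1 k m
[ 𝟎 =1]       = 0F
[ 𝟏 =1]       = 1F
[ r ∧ s =1]   = [ r =1] ⊓ [ s =1]
[ r ∨ s =1]   = [ r =1] ⊔ᶠ [ s =1]
[ ∼ r =1]     = [ r =0]
[ gen k m =0] = is0 k m
[ 𝟎 =0]       = 1F
[ 𝟏 =0]       = 0F
[ r ∧ s =0]   = [ r =0] ⊔ᶠ [ s =0]
[ r ∨ s =0]   = [ r =0] ⊓ [ s =0]
[ ∼ r =0]     = [ r =1]

infixl 9 _⟨_⟩ᶠ

_⟨_⟩ᶠ : {I J : FinSet} → Face I → Hom J I → Face J
is0 k m  ⟨ f ⟩ᶠ = [ ∼ img f k m =1]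
is1 k m  ⟨ f ⟩ᶠ = [ img f k m =1]
0F       ⟨ f ⟩ᶠ = 0F
1F       ⟨ f ⟩ᶠ = 1F
(φ ⊓ ψ)  ⟨ f ⟩ᶠ = φ ⟨ f ⟩ᶠ ⊓ ψ ⟨ f ⟩ᶠ
(φ ⊔ᶠ ψ) ⟨ f ⟩ᶠ = φ ⟨ f ⟩ᶠ ⊔ᶠ ψ ⟨ f ⟩ᶠ

=1-cong : ∀ {I} {r s : DM I} → r ≈ᵈ s → [ r =1] ≈ᶠ [ s =1]
=0-cong : ∀ {I} {r s : DM I} → r ≈ᵈ s → [ r =0] ≈ᶠ [ s =0]
=1-cong ≈-refl = ≈-refl
=1-cong (≈-sym p) = ≈-sym (=1-cong p)
=1-cong (≈-trans p q) = ≈-trans (=1-cong p) (=1-cong q)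
=1-cong (∧-cong p q) = ⊓-cong (=1-cong p) (=1-cong q)
=1-cong (∨-cong p q) = ⊔-cong (=1-cong p) (=1-cong q)
=1-cong (∼-cong p) = =0-cong p
=1-cong (∧-assoc r s t) = ⊓-assoc _ _ _
=1-cong (∨-assoc r s t) = ⊔-assoc _ _ _
=1-cong (∧-comm r s) = ⊓-comm _ _
=1-cong (∨-comm r s) = ⊔-comm _ _
=1-cong (∧-absorbs-∨ r s) = ⊓-absorbs-⊔ _ _
=1-cong (∨-absorbs-∧ r s) = ⊔-absorbs-⊓ _ _
=1-cong (∧-distrib-∨ r s t) = ⊓-distrib-⊔ _ _ _
=1-cong (∨-distrib-∧ r s t) = ⊔-distrib-⊓ _ _ _
=1-cong (∧-identity r) = ⊓-identity _
=1-cong (∨-identity r) = ⊔-identity _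
=1-cong (∼-invol r) = ≈-refl
=1-cong (∼-∧ r s) = ≈-refl
=1-cong (∼-∨ r s) = ≈-refl
=0-cong ≈-refl = ≈-refl
=0-cong (≈-sym p) = ≈-sym (=0-cong p)
=0-cong (≈-trans p q) = ≈-trans (=0-cong p) (=0-cong q)
=0-cong (∧-cong p q) = ⊔-cong (=0-cong p) (=0-cong q)
=0-cong (∨-cong p q) = ⊓-cong (=0-cong p) (=0-cong q)
=0-cong (∼-cong p) = =1-cong p
=0-cong (∧-assoc r s t) = ⊔-assoc _ _ _
=0-cong (∨-assoc r s t) = ⊓-assoc _ _ _
=0-cong (∧-comm r s) = ⊔-comm _ _
=0-cong (∨-comm r s) = ⊓-comm _ _
=0-cong (∧-absorbs-∨ r s) = ⊔-absorbs-⊓ _ _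
=0-cong (∨-absorbs-∧ r s) = ⊓-absorbs-⊔ _ _
=0-cong (∧-distrib-∨ r s t) = ⊔-distrib-⊓ _ _ _
=0-cong (∨-distrib-∧ r s t) = ⊓-distrib-⊔ _ _ _
=0-cong (∧-identity r) = ⊔-identity _
=0-cong (∨-identity r) = ⊓-identity _
=0-cong (∼-invol r) = ≈-refl
=0-cong (∼-∧ r s) = ≈-refl
=0-cong (∼-∨ r s) = ≈-refl

=1-sub : ∀ {I J} (r : DM I) (f : Hom J I) → [ r =1] ⟨ f ⟩ᶠ ≈ᶠ [ r ⟨ f ⟩ᵈ =1]
=0-sub : ∀ {I J} (r : DM I) (f : Hom J I) → [ r =0] ⟨ f ⟩ᶠ ≈ᶠ [ r ⟨ f ⟩ᵈ =0]
=1-sub (gen k m) f = ≈-refl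
=1-sub 𝟎 f = ≈-refl
=1-sub 𝟏 f = ≈-refl
=1-sub (r ∧ s) f = ⊓-cong (=1-sub r f) (=1-sub s f)
=1-sub (r ∨ s) f = ⊔-cong (=1-sub r f) (=1-sub s f)
=1-sub (∼ r) f = =0-sub r f
=0-sub (gen k m) f = ≈-refl
=0-sub 𝟎 f = ≈-refl
=0-sub 𝟏 f = ≈-refl
=0-sub (r ∧ s) f = ⊔-cong (=0-sub r f) (=0-sub s f)
=0-sub (r ∨ s) f = ⊓-cong (=0-sub r f) (=0-sub s f)
=0-sub (∼ r) f = =1-sub r f

⊓-zero : ∀ {I} (φ : Face I) → 0F ⊓ φ ≈ᶠ 0F
⊓-zero φ = ≈-trans (⊓-cong ≈-refl (≈-sym (⊔-identity φ))) (⊓-absorbs-⊔ 0F φ)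

⊓-zeroˡ : ∀ {I} {φ ψ : Face I} χ → φ ⊓ ψ ≈ᶠ 0F → φ ⊓ (ψ ⊓ χ) ≈ᶠ 0F
⊓-zeroˡ χ p = ≈-trans (≈-sym (⊓-assoc _ _ _)) (≈-trans (⊓-cong p ≈-refl) (⊓-zero χ))

⊓-zeroʳ : ∀ {I} {φ ψ : Face I} χ → φ ⊓ ψ ≈ᶠ 0F → φ ⊓ (χ ⊓ ψ) ≈ᶠ 0F
⊓-zeroʳ χ p = ≈-trans (⊓-cong ≈-refl (⊓-comm _ _)) (⊓-zeroˡ χ p)

0⊔0 : ∀ {I} {φ ψ : Face I} → φ ≈ᶠ 0F → ψ ≈ᶠ 0F → φ ⊔ᶠ ψ ≈ᶠ 0F
0⊔0 p q = ≈-trans (⊔-cong p q) (⊔-identity 0F)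

disjoint-DM : ∀ {I} (r : DM I) → [ r =0] ⊓ [ r =1] ≈ᶠ 0F
disjoint-DM (gen k m) = disjoint k m
disjoint-DM 𝟎 = ⊓-identity 0F
disjoint-DM 𝟏 = ⊓-zero 1F
disjoint-DM (r ∧ s) = ≈-trans (⊓-comm _ _) (≈-trans (⊓-distrib-⊔ _ _ _) (0⊔0
  (≈-trans (⊓-comm _ _) (⊓-zeroˡ _ (disjoint-DM r)))
  (≈-trans (⊓-comm _ _) (⊓-zeroʳ _ (disjoint-DM s)))))
disjoint-DM (r ∨ s) = ≈-trans (⊓-distrib-⊔ _ _ _) (0⊔0
  (≈-trans (⊓-comm _ _) (⊓-zeroˡ _ (≈-trans (⊓-comm _ _) (disjoint-DM r))))
  (≈-trans (⊓-comm _ _) (⊓-zeroʳ _ (≈-trans (⊓-comm _ _) (disjoint-DM s)))))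
disjoint-DM (∼ r) = ≈-trans (⊓-comm _ _) (disjoint-DM r)

subᶠ-cong : ∀ {I J} {φ ψ : Face I} (f : Hom J I) → φ ≈ᶠ ψ → φ ⟨ f ⟩ᶠ ≈ᶠ ψ ⟨ f ⟩ᶠ
subᶠ-cong f ≈-refl = ≈-refl
subᶠ-cong f (≈-sym p) = ≈-sym (subᶠ-cong f p)
subᶠ-cong f (≈-trans p q) = ≈-trans (subᶠ-cong f p) (subᶠ-cong f q)
subᶠ-cong f (⊓-cong p q) = ⊓-cong (subᶠ-cong f p) (subᶠ-cong f q)
subᶠ-cong f (⊔-cong p q) = ⊔-cong (subᶠ-cong f p) (subᶠ-cong f q)
subᶠ-cong f (⊓-assoc φ ψ χ) = ⊓-assoc _ _ _
subᶠ-cong f (⊔-assoc φ ψ χ) = ⊔-assoc _ _ _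
subᶠ-cong f (⊓-comm φ ψ) = ⊓-comm _ _
subᶠ-cong f (⊔-comm φ ψ) = ⊔-comm _ _
subᶠ-cong f (⊓-absorbs-⊔ φ ψ) = ⊓-absorbs-⊔ _ _
subᶠ-cong f (⊔-absorbs-⊓ φ ψ) = ⊔-absorbs-⊓ _ _
subᶠ-cong f (⊓-distrib-⊔ φ ψ χ) = ⊓-distrib-⊔ _ _ _
subᶠ-cong f (⊔-distrib-⊓ φ ψ χ) = ⊔-distrib-⊓ _ _ _
subᶠ-cong f (⊓-identity φ) = ⊓-identity _
subᶠ-cong f (⊔-identity φ) = ⊔-identity _
subᶠ-cong f (disjoint k m) = disjoint-DM (img f k m)

subᶠ-hom : ∀ {I J} (φ : Face I) {f g : Hom J I} → f ≈ʰ g → φ ⟨ f ⟩ᶠ ≈ᶠ φ ⟨ g ⟩ᶠ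
subᶠ-hom (is0 k m) p = =0-cong (img-≈ p k m)
subᶠ-hom (is1 k m) p = =1-cong (img-≈ p k m)
subᶠ-hom 0F p = ≈-refl
subᶠ-hom 1F p = ≈-refl
subᶠ-hom (φ ⊓ ψ) p = ⊓-cong (subᶠ-hom φ p) (subᶠ-hom ψ p)
subᶠ-hom (φ ⊔ᶠ ψ) p = ⊔-cong (subᶠ-hom φ p) (subᶠ-hom ψ p)

subᶠ-id : ∀ {I} (φ : Face I) → φ ⟨ id ⟩ᶠ ≈ᶠ φ
subᶠ-id (is0 k m) = ≈-refl
subᶠ-id (is1 k m) = ≈-refl
subᶠ-id 0F = ≈-refl
subᶠ-id 1F = ≈-refl
subᶠ-id (φ ⊓ ψ) = ⊓-cong (subᶠ-id φ) (subᶠ-id ψ)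
subᶠ-id (φ ⊔ᶠ ψ) = ⊔-cong (subᶠ-id φ) (subᶠ-id ψ)

subᶠ-∘ : ∀ {I J K} (φ : Face I) (f : Hom J I) (g : Hom K J) →
         φ ⟨ f ⟩ᶠ ⟨ g ⟩ᶠ ≈ᶠ φ ⟨ f ∘ g ⟩ᶠ
subᶠ-∘ (is0 k m) f g = =0-sub (img f k m) g
subᶠ-∘ (is1 k m) f g = =1-sub (img f k m) g
subᶠ-∘ 0F f g = ≈-refl
subᶠ-∘ 1F f g = ≈-refl
subᶠ-∘ (φ ⊓ ψ) f g = ⊓-cong (subᶠ-∘ φ f g) (subᶠ-∘ ψ f g)
subᶠ-∘ (φ ⊔ᶠ ψ) f g = ⊔-cong (subᶠ-∘ φ f g) (subᶠ-∘ ψ f g)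

-- Deciding φ = 1 by evaluating all generators to false, which is a
-- lattice homomorphism to the Booleans.

eval : ∀ {I} → Face I → Bool
eval (is0 k m) = false
eval (is1 k m) = false
eval 0F = false
eval 1F = true
eval (φ ⊓ ψ) = eval φ and eval ψ
eval (φ ⊔ᶠ ψ) = eval φ or eval ψ

eval-cong : ∀ {I} {φ ψ : Face I} → φ ≈ᶠ ψ → eval φ ≡ eval ψ
eval-cong ≈-refl = refl
eval-cong (≈-sym p) = sym (eval-cong p)
eval-cong (≈-trans p q) = trans (eval-cong p) (eval-cong q)
eval-cong (⊓-cong p q) = cong₂ _and_ (eval-cong p) (eval-cong q)
eval-cong (⊔-cong p q) = cong₂ _or_ (eval-cong p) (eval-cong q)
eval-cong (⊓-assoc φ ψ χ) = 𝔹.∧-assoc (eval φ) (eval ψ) (eval χ)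
eval-cong (⊔-assoc φ ψ χ) = 𝔹.∨-assoc (eval φ) (eval ψ) (eval χ)
eval-cong (⊓-comm φ ψ) = 𝔹.∧-comm (eval φ) (eval ψ)
eval-cong (⊔-comm φ ψ) = 𝔹.∨-comm (eval φ) (eval ψ)
eval-cong (⊓-absorbs-⊔ φ ψ) = 𝔹.∧-abs-∨ (eval φ) (eval ψ)
eval-cong (⊔-absorbs-⊓ φ ψ) = 𝔹.∨-abs-∧ (eval φ) (eval ψ)
eval-cong (⊓-distrib-⊔ φ ψ χ) = 𝔹.∧-distribˡ-∨ (eval φ) (eval ψ) (eval χ)
eval-cong (⊔-distrib-⊓ φ ψ χ) = 𝔹.∨-distribˡ-∧ (eval φ) (eval ψ) (eval χ)
eval-cong (⊓-identity φ) = refl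
eval-cong (⊔-identity φ) = refl
eval-cong (disjoint k m) = refl

⊔-zeroˡ : ∀ {I} (φ : Face I) → 1F ⊔ᶠ φ ≈ᶠ 1F
⊔-zeroˡ φ = ≈-trans (⊔-cong ≈-refl (≈-sym (⊓-identity φ))) (⊔-absorbs-⊓ 1F φ)

eval-sound : ∀ {I} (φ : Face I) → eval φ ≡ true → φ ≈ᶠ 1F
eval-sound 1F e = ≈-refl
eval-sound (φ ⊓ ψ) e with eval φ in p | eval ψ in q
... | true | true =
  ≈-trans (⊓-cong (eval-sound φ p) (eval-sound ψ q)) (⊓-identity 1F)
eval-sound (φ ⊔ᶠ ψ) e with eval φ in p | eval ψ in q
... | true | _ = ≈-trans (⊔-cong (eval-sound φ p) ≈-refl) (⊔-zeroˡ ψ)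
... | false | true =
  ≈-trans (⊔-comm φ ψ) (≈-trans (⊔-cong (eval-sound ψ q) ≈-refl) (⊔-zeroˡ φ))

isOne? : ∀ {I} (φ : Face I) → Dec (φ ≈ᶠ 1F)
isOne? φ with eval φ in e
... | true  = yes (eval-sound φ e)
... | false = no λ p → false≢true (trans (sym e) (eval-cong p))
  where
  false≢true : ¬ (false ≡ true)
  false≢true ()

one-sub : ∀ {I J} {φ : Face I} (f : Hom J I) → φ ≈ᶠ 1F → φ ⟨ f ⟩ᶠ ≈ᶠ 1F
one-sub f p = subᶠ-cong f p

one-∘ : ∀ {I J K} (φ : Face I) (f : Hom J I) (g : Hom K J) →
        φ ⟨ f ⟩ᶠ ≈ᶠ 1F → φ ⟨ f ∘ g ⟩ᶠ ≈ᶠ 1F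
one-∘ φ f g p = ≈-trans (≈-sym (subᶠ-∘ φ f g)) (one-sub g p)

one-resp : ∀ {I} {φ ψ : Face I} → ψ ≈ᶠ φ → φ ≈ᶠ 1F → ψ ≈ᶠ 1F
one-resp e p = ≈-trans e p

deg-face-∘ : ∀ {I J} (i : Fresh I) b (f : Hom J I) → deg i ∘ (face i b ∘ f) ≈ʰ f
deg-face-∘ i b f =
  ≈ʰ-trans (≈ʰ-sym (∘-assoc (deg i) (face i b) f)) (∘-cong (deg-face i b) (≈ʰ-refl {f = f}))

one-deg : ∀ {I J} (ψ : Face I) (i : Fresh I) b (f : Hom J I) →
          ψ ⟨ f ⟩ᶠ ≈ᶠ 1F → ψ ⟨ deg i ⟩ᶠ ⟨ face i b ∘ f ⟩ᶠ ≈ᶠ 1F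
one-deg ψ i b f p =
  ≈-trans (subᶠ-∘ ψ (deg i) (face i b ∘ f)) (≈-trans (subᶠ-hom ψ (deg-face-∘ i b f)) p)

-- Sets are setoids throughout: dM(J), 𝔽(I) and P_A are quotients.

record CSet (ℓ : Level) : Set (lsuc ℓ) where
  field pt : FinSet → Setoid ℓ ℓ

  Pt : FinSet → Set ℓ
  Pt I = Setoid.Carrier (pt I)

  infix 4 _≈_
  _≈_ : ∀ {I} → Pt I → Pt I → Set ℓ
  _≈_ {I} = Setoid._≈_ (pt I)

  infixl 9 _·_
  field
    _·_    : ∀ {I J} → Pt I → Hom J I → Pt J
    ·-cong : ∀ {I J} {ρ ρ′ : Pt I} {f f′ : Hom J I} → ρ ≈ ρ′ → f ≈ʰ f′ → ρ · f ≈ ρ′ · f′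
    ·-id   : ∀ {I} (ρ : Pt I) → ρ · id ≈ ρ
    ·-∘    : ∀ {I J K} (ρ : Pt I) (f : Hom J I) (g : Hom K J) → ρ · f · g ≈ ρ · (f ∘ g)

  rfl : ∀ {I} {ρ : Pt I} → ρ ≈ ρ
  rfl {I} = Setoid.refl (pt I)

  symm : ∀ {I} {ρ ρ′ : Pt I} → ρ ≈ ρ′ → ρ′ ≈ ρ
  symm {I} = Setoid.sym (pt I)

  infixr 5 _⨾_
  _⨾_ : ∀ {I} {ρ ρ′ ρ″ : Pt I} → ρ ≈ ρ′ → ρ′ ≈ ρ″ → ρ ≈ ρ″
  _⨾_ {I} = Setoid.trans (pt I)

  split : ∀ {I J K} (ρ : Pt I) {f : Hom J I} {g : Hom K J} {h : Hom K I} →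
          h ≈ʰ f ∘ g → ρ · h ≈ ρ · f · g
  split ρ {f} {g} e = ·-cong rfl e ⨾ symm (·-∘ ρ f g)

  square : ∀ {I J K L} {ρ : Pt I} {ρ′ : Pt J} {f : Hom J I} {h′ : Hom L J}
           {g : Hom K I} {h : Hom L K} →
           ρ′ ≈ ρ · f → f ∘ h′ ≈ʰ g ∘ h → ρ′ · h′ ≈ ρ · g · h
  square {ρ = ρ} {f = f} {h′} p e = ·-cong p ≈ʰ-refl ⨾ ·-∘ ρ f h′ ⨾ split ρ e

  after : ∀ {I J K} {ρ : Pt I} {ρ′ : Pt J} (f : Hom J I) (g : Hom K J) →
          ρ′ ≈ ρ · f → ρ′ · g ≈ ρ · (f ∘ g)
  after {ρ = ρ} f g p = ·-cong p ≈ʰ-refl ⨾ ·-∘ ρ f g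

  section : ∀ {I J} (ρ : Pt I) {f : Hom J I} {g : Hom I J} → f ∘ g ≈ʰ id → ρ ≈ ρ · f · g
  section ρ e = symm (·-id ρ) ⨾ split ρ (≈ʰ-sym e)

record _⟶_ {ℓ ℓ′} (Δ : CSet ℓ) (Γ : CSet ℓ′) : Set (ℓ ⊔ ℓ′) where
  private
    module Δ = CSet Δ
    module Γ = CSet Γ
  field
    map  : ∀ {I} → Δ.Pt I → Γ.Pt I
    map-cong : ∀ {I} {ρ ρ′ : Δ.Pt I} → ρ Δ.≈ ρ′ → map ρ Γ.≈ map ρ′
    map-nat  : ∀ {I J} (ρ : Δ.Pt I) (f : Hom J I) → map (ρ Δ.· f) Γ.≈ map ρ Γ.· f

  map-res : ∀ {I J} {ρ : Δ.Pt I} {ρ′ : Δ.Pt J} {f : Hom J I} →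
            ρ′ Δ.≈ ρ Δ.· f → map ρ′ Γ.≈ map ρ Γ.· f
  map-res {ρ = ρ} {f = f} p = map-cong p Γ.⨾ map-nat ρ f

open _⟶_ public

infixr 9 _∘ᶜ_

_∘ᶜ_ : ∀ {ℓ₁ ℓ₂ ℓ₃} {Θ : CSet ℓ₁} {Δ : CSet ℓ₂} {Γ : CSet ℓ₃} → Δ ⟶ Γ → Θ ⟶ Δ → Θ ⟶ Γ
_∘ᶜ_ {Γ = Γ} τ σ = record
  { map      = λ ρ → map τ (map σ ρ)
  ; map-cong = λ p → map-cong τ (map-cong σ p)
  ; map-nat  = λ ρ f → map-res τ (map-nat σ ρ f)
  }

𝔽 : CSet lzero
𝔽 = record
  { pt = λ I → record
      { Carrier = Face I
      ; _≈_ = _≈ᶠ_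
      ; isEquivalence = record { refl = ≈-refl ; sym = ≈-sym ; trans = ≈-trans }
      }
  ; _·_    = _⟨_⟩ᶠ
  ; ·-cong = λ {I} {J} {φ} {ψ} {f} p q → ≈-trans (subᶠ-cong f p) (subᶠ-hom ψ q)
  ; ·-id   = subᶠ-id
  ; ·-∘    = subᶠ-∘
  }

-- The subpresheaf Γ , φ.  The proof of φρ = 1 is irrelevant; nothing is
-- lost, since φρ = 1 is decidable (isOne?).

record _∣_Pt {ℓ} (Γ : CSet ℓ) (φ : Γ ⟶ 𝔽) (I : FinSet) : Set ℓ where
  constructor _,,_
  field
    point  : CSet.Pt Γ I
    .holds : map φ point ≈ᶠ 1F

open _∣_Pt public using (point)

infixl 20 _▸_

_▸_ : ∀ {ℓ} (Γ : CSet ℓ) → Γ ⟶ 𝔽 → CSet ℓ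
Γ ▸ φ = record
  { pt = λ I → record
      { Carrier = (Γ ∣ φ Pt) I
      ; _≈_ = λ ρ ρ′ → point ρ Γ.≈ point ρ′
      ; isEquivalence = record { refl = Γ.rfl ; sym = Γ.symm ; trans = Γ._⨾_ }
      }
  ; _·_    = λ { (ρ ,, p) f → (ρ Γ.· f) ,, ≈-trans (map-nat φ ρ f) (one-sub f p) }
  ; ·-cong = Γ.·-cong
  ; ·-id   = λ ρ → Γ.·-id (point ρ)
  ; ·-∘    = λ ρ → Γ.·-∘ (point ρ)
  }
  where module Γ = CSet Γ

_▸▸_ : ∀ {ℓ ℓ′} {Δ : CSet ℓ} {Γ : CSet ℓ′} (σ : Δ ⟶ Γ) (φ : Γ ⟶ 𝔽) →
       (Δ ▸ (φ ∘ᶜ σ)) ⟶ (Γ ▸ φ)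
σ ▸▸ φ = record
  { map      = λ { (ρ ,, p) → map σ ρ ,, p }
  ; map-cong = map-cong σ
  ; map-nat  = λ ρ → map-nat σ (point ρ)
  }

-- If φ is constantly 1 then Γ , φ is Γ.

total : ∀ {ℓ} {Γ : CSet ℓ} (φ : Γ ⟶ 𝔽) → (∀ {I} (ρ : CSet.Pt Γ I) → map φ ρ ≈ᶠ 1F) → Γ ⟶ (Γ ▸ φ)
total {Γ = Γ} φ h = record
  { map      = λ ρ → ρ ,, h ρ
  ; map-cong = λ p → p
  ; map-nat  = λ ρ f → CSet.rfl Γ
  }

-- The argument ρ′ ≈ ρ · f of res says that ρ′ is the restriction ρf, so
-- that res f : A ρ → A (ρf); res id is the identification of A ρ with
-- A ρ′ for equal ρ and ρ′.

record Ty {ℓ} (Γ : CSet ℓ) (ℓ′ : Level) : Set (ℓ ⊔ lsuc ℓ′) where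
  open CSet Γ using (Pt; _·_; rfl; symm; _⨾_; ·-id) renaming (_≈_ to _≈ᵖ_)
  field el : ∀ {I} → Pt I → Setoid ℓ′ ℓ′

  El : ∀ {I} → Pt I → Set ℓ′
  El ρ = Setoid.Carrier (el ρ)

  Eq : ∀ {I} (ρ : Pt I) → El ρ → El ρ → Set ℓ′
  Eq ρ = Setoid._≈_ (el ρ)

  field
    res      : ∀ {I J} {ρ : Pt I} {ρ′ : Pt J} (f : Hom J I) → ρ′ ≈ᵖ ρ · f → El ρ → El ρ′
    res-cong : ∀ {I J} {ρ : Pt I} {ρ′ : Pt J} {f f′ : Hom J I} {p : ρ′ ≈ᵖ ρ · f} {p′ : ρ′ ≈ᵖ ρ · f′}
               {x y : El ρ} → f ≈ʰ f′ → Eq ρ x y → Eq ρ′ (res f p x) (res f′ p′ y)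
    res-id   : ∀ {I} {ρ : Pt I} {p : ρ ≈ᵖ ρ · id} (x : El ρ) → Eq ρ (res id p x) x
    res-∘    : ∀ {I J K} {ρ : Pt I} {ρ′ : Pt J} {ρ″ : Pt K} (f : Hom J I) (g : Hom K J)
               {p : ρ′ ≈ᵖ ρ · f} {q : ρ″ ≈ᵖ ρ′ · g} {r : ρ″ ≈ᵖ ρ · (f ∘ g)} (x : El ρ) →
               Eq ρ″ (res g q (res f p x)) (res (f ∘ g) r x)

  infix 4 _≈_
  _≈_ : ∀ {I} {ρ : Pt I} → El ρ → El ρ → Set ℓ′
  _≈_ {ρ = ρ} = Eq ρ

  infixl 9 _↾_
  _↾_ : ∀ {I J} {ρ : Pt I} → El ρ → (f : Hom J I) → El (ρ · f)
  x ↾ f = res f rfl x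

  cast : ∀ {I} {ρ ρ′ : Pt I} → ρ′ ≈ᵖ ρ → El ρ → El ρ′
  cast {ρ = ρ} p = res id (p ⨾ symm (·-id ρ))

  Eq-refl : ∀ {I} (ρ : Pt I) {x : El ρ} → Eq ρ x x
  Eq-refl ρ = Setoid.refl (el ρ)

  Eq-sym : ∀ {I} (ρ : Pt I) {x y : El ρ} → Eq ρ x y → Eq ρ y x
  Eq-sym ρ = Setoid.sym (el ρ)

  Eq-trans : ∀ {I} (ρ : Pt I) {x y z : El ρ} → Eq ρ x y → Eq ρ y z → Eq ρ x z
  Eq-trans ρ = Setoid.trans (el ρ)

  fuse : ∀ {I J K} {ρ : Pt I} {ρ′ : Pt J} {ρ″ : Pt K} {f : Hom J I} {g : Hom K J} {h : Hom K I}
         {p : ρ′ ≈ᵖ ρ · f} {q : ρ″ ≈ᵖ ρ′ · g} {r : ρ″ ≈ᵖ ρ · h} {x : El ρ} →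
         h ≈ʰ f ∘ g → Eq ρ″ (res g q (res f p x)) (res h r x)
  fuse {ρ = ρ} {ρ″ = ρ″} {f} {g} {h} {p} {q} {r} {x} e =
    Eq-trans ρ″ (res-∘ f g {r = r ⨾ CSet.·-cong Γ rfl e} x) (res-cong (≈ʰ-sym e) (Eq-refl ρ))

  exchange : ∀ {I J J′ K} {ρ : Pt I} {ρ₁ : Pt J} {ρ₂ : Pt J′} {ρ′ : Pt K}
             {f : Hom J I} {g : Hom K J} {f′ : Hom J′ I} {g′ : Hom K J′}
             {p : ρ₁ ≈ᵖ ρ · f} {q : ρ′ ≈ᵖ ρ₁ · g} {p′ : ρ₂ ≈ᵖ ρ · f′} {q′ : ρ′ ≈ᵖ ρ₂ · g′} {x : El ρ} →
             f ∘ g ≈ʰ f′ ∘ g′ → Eq ρ′ (res g q (res f p x)) (res g′ q′ (res f′ p′ x))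
  exchange {ρ′ = ρ′} {f = f} {g} {p = p} {q} e =
    Eq-trans ρ′ (fuse {r = q ⨾ CSet.after Γ f g p} ≈ʰ-refl) (Eq-sym ρ′ (fuse e))

infixl 30 _[_]

_[_] : ∀ {ℓ ℓ₁ ℓ′} {Γ : CSet ℓ} {Δ : CSet ℓ₁} → Ty Γ ℓ′ → Δ ⟶ Γ → Ty Δ ℓ′
A [ σ ] = record
  { el       = λ ρ → A.el (map σ ρ)
  ; res      = λ f p → A.res f (map-res σ p)
  ; res-cong = λ e x≈y → A.res-cong e x≈y
  ; res-id   = λ x → A.res-id x
  ; res-∘    = λ f g x → A.res-∘ f g x
  }
  where module A = Ty A

restrictTo : ∀ {ℓ ℓ′} {Γ : CSet ℓ} (φ : Γ ⟶ 𝔽) → Ty Γ ℓ′ → Ty (Γ ▸ φ) ℓ′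
restrictTo φ A = record
  { el       = λ ρ → A.el (point ρ)
  ; res      = λ f p → A.res f p
  ; res-cong = λ e x≈y → A.res-cong e x≈y
  ; res-id   = λ x → A.res-id x
  ; res-∘    = λ f g x → A.res-∘ f g x
  }
  where module A = Ty A

-- The type T → A.  Like every family indexed by maps f below, w_f is
-- given at each representative ρ′ of the point ρf.

module _ {ℓ ℓ′ ℓ″} {Δ : CSet ℓ} (T : Ty Δ ℓ′) (A : Ty Δ ℓ″) where
  private
    module Δ = CSet Δ
    module T = Ty T
    module A = Ty A

  record Fun {I} (ρ : Δ.Pt I) : Set (ℓ ⊔ ℓ′ ⊔ ℓ″) where
    field
      app      : ∀ {J} (f : Hom J I) {ρ′ : Δ.Pt J} → ρ′ Δ.≈ ρ Δ.· f → T.El ρ′ → A.El ρ′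
      app-cong : ∀ {J} (f : Hom J I) {ρ′ : Δ.Pt J} (p : ρ′ Δ.≈ ρ Δ.· f) {x y : T.El ρ′} →
                 T.Eq ρ′ x y → A.Eq ρ′ (app f p x) (app f p y)
      app-nat  : ∀ {J K} (f : Hom J I) (g : Hom K J) (h : Hom K I) → h ≈ʰ f ∘ g →
                 {ρ′ : Δ.Pt J} {ρ″ : Δ.Pt K} (p : ρ′ Δ.≈ ρ Δ.· f) (q : ρ″ Δ.≈ ρ′ Δ.· g)
                 (r : ρ″ Δ.≈ ρ Δ.· h) (x : T.El ρ′) →
                 A.Eq ρ″ (A.res g q (app f p x)) (app h r (T.res g q x))

    app-hom : ∀ {J} {f f′ : Hom J I} → f ≈ʰ f′ → {ρ′ : Δ.Pt J} (p : ρ′ Δ.≈ ρ Δ.· f)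
              (p′ : ρ′ Δ.≈ ρ Δ.· f′) (x : T.El ρ′) → A.Eq ρ′ (app f p x) (app f′ p′ x)
    app-hom {f = f} {f′} e {ρ′} p p′ x =
      A.Eq-trans ρ′ (A.Eq-sym ρ′ (A.res-id {p = Δ.symm (Δ.·-id ρ′)} (app f p x)))
      (A.Eq-trans ρ′ (app-nat f id f′ (≈ʰ-trans (≈ʰ-sym e) (≈ʰ-sym (∘-idʳ f))) p
                        (Δ.symm (Δ.·-id ρ′)) p′ x)
                     (app-cong f′ p′ (T.res-id x)))

  open Fun public

  funSetoid : ∀ {I} (ρ : Δ.Pt I) → Setoid (ℓ ⊔ ℓ′ ⊔ ℓ″) (ℓ ⊔ ℓ′ ⊔ ℓ″)
  funSetoid {I} ρ = record
    { Carrier = Fun ρ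
    ; _≈_ = λ v w → ∀ {J} (f : Hom J I) {ρ′ : Δ.Pt J} (p : ρ′ Δ.≈ ρ Δ.· f) (x : T.El ρ′) →
                    A.Eq ρ′ (app v f p x) (app w f p x)
    ; isEquivalence = record
        { refl  = λ f {ρ′} p x → A.Eq-refl ρ′
        ; sym   = λ v≈w f {ρ′} p x → A.Eq-sym ρ′ (v≈w f p x)
        ; trans = λ v≈w w≈z f {ρ′} p x → A.Eq-trans ρ′ (v≈w f p x) (w≈z f p x)
        }
    }

  funRes : ∀ {I J} {ρ : Δ.Pt I} {ρ′ : Δ.Pt J} (f : Hom J I) → ρ′ Δ.≈ ρ Δ.· f → Fun ρ → Fun ρ′
  funRes f p w = record
    { app      = λ g q → app w (f ∘ g) (q Δ.⨾ Δ.after f g p)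
    ; app-cong = λ g q → app-cong w (f ∘ g) (q Δ.⨾ Δ.after f g p)
    ; app-nat  = λ g h k e q r s → app-nat w (f ∘ g) h (f ∘ k)
        (≈ʰ-trans (∘-cong (≈ʰ-refl {f = f}) e) (≈ʰ-sym (∘-assoc f g h)))
        (q Δ.⨾ Δ.after f g p) r (s Δ.⨾ Δ.after f k p)
    }

  infixr 20 _⇒_
  _⇒_ : Ty Δ (ℓ ⊔ ℓ′ ⊔ ℓ″)
  _⇒_ = record
    { el       = funSetoid
    ; res      = funRes
    ; res-cong = λ {_} {_} {_} {_} {f} {f′} {p} {p′} {v} {w} e v≈w g {ρ″} q x →
        A.Eq-trans ρ″ (v≈w (f ∘ g) (q Δ.⨾ Δ.after f g p) x)
          (app-hom w (∘-cong e (≈ʰ-refl {f = g})) (q Δ.⨾ Δ.after f g p) (q Δ.⨾ Δ.after f′ g p′) x)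
    ; res-id   = λ {_} {ρ} {p} w f q x →
        app-hom w (∘-idˡ f) (q Δ.⨾ Δ.after id f p) q x
    ; res-∘    = λ f g {p} {q} {r} w h s x →
        app-hom w (≈ʰ-sym (∘-assoc f g h)) ((s Δ.⨾ Δ.after g h q) Δ.⨾ Δ.after f (g ∘ h) p)
          (s Δ.⨾ Δ.after (f ∘ g) h r) x
    }

record Tm {ℓ ℓ′} {Δ : CSet ℓ} (A : Ty Δ ℓ′) : Set (ℓ ⊔ ℓ′) where
  private
    module Δ = CSet Δ
    module A = Ty A
  field
    tm     : ∀ {I} (ρ : Δ.Pt I) → A.El ρ
    tm-nat : ∀ {I J} {ρ : Δ.Pt I} {ρ′ : Δ.Pt J} (f : Hom J I) (p : ρ′ Δ.≈ ρ Δ.· f) →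
             A.Eq ρ′ (A.res f p (tm ρ)) (tm ρ′)

open Tm public

module _ {ℓ ℓ′ ℓ″} {Δ : CSet ℓ} {T : Ty Δ ℓ′} {A : Ty Δ ℓ″} (w : Tm (T ⇒ A)) where
  private
    module Δ = CSet Δ
    module T = Ty T
    module A = Ty A

  infixl 9 _⟪_⟫_
  _⟪_⟫_ : ∀ {I} (ρ : Δ.Pt I) → T.El ρ → A.El ρ
  _⟪_⟫_ ρ = app (tm w ρ) id (Δ.symm (Δ.·-id ρ))

  ⟪⟫-cong : ∀ {I} (ρ : Δ.Pt I) {x y : T.El ρ} → T.Eq ρ x y → A.Eq ρ (_⟪_⟫_ ρ x) (_⟪_⟫_ ρ y)
  ⟪⟫-cong ρ = app-cong (tm w ρ) id (Δ.symm (Δ.·-id ρ))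

  ⟪⟫-nat : ∀ {I J} {ρ : Δ.Pt I} {ρ′ : Δ.Pt J} (f : Hom J I) (p : ρ′ Δ.≈ ρ Δ.· f) (x : T.El ρ) →
           A.Eq ρ′ (A.res f p (_⟪_⟫_ ρ x)) (_⟪_⟫_ ρ′ (T.res f p x))
  ⟪⟫-nat {ρ = ρ} {ρ′} f p x =
    A.Eq-trans ρ′ (app-nat (tm w ρ) id f (f ∘ id) (∘-idʳ f) (Δ.symm (Δ.·-id ρ)) p p′ x)
      (tm-nat w f p id (Δ.symm (Δ.·-id ρ′)) (T.res f p x))
    where
    p′ = Δ.symm (Δ.·-id ρ′) Δ.⨾ Δ.after f id p

-- Compatible families u_f ∈ A(ρf), for f with χf = 1.

record Partial {ℓ ℓ′} {Γ : CSet ℓ} (A : Ty Γ ℓ′) {K} (ρ : CSet.Pt Γ K) (χ : Face K) :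
               Set (ℓ ⊔ ℓ′) where
  private
    module Γ = CSet Γ
    module A = Ty A
  field
    at     : ∀ {J} (f : Hom J K) {ρ′ : Γ.Pt J} → ρ′ Γ.≈ ρ Γ.· f → .(χ ⟨ f ⟩ᶠ ≈ᶠ 1F) → A.El ρ′
    at-nat : ∀ {J L} (f : Hom J K) (g : Hom L J) (h : Hom L K) → h ≈ʰ f ∘ g →
             {ρ′ : Γ.Pt J} {ρ″ : Γ.Pt L} (p : ρ′ Γ.≈ ρ Γ.· f) (q : ρ″ Γ.≈ ρ′ Γ.· g)
             (r : ρ″ Γ.≈ ρ Γ.· h) .(c : χ ⟨ f ⟩ᶠ ≈ᶠ 1F) .(d : χ ⟨ h ⟩ᶠ ≈ᶠ 1F) →
             A.Eq ρ″ (A.res g q (at f p c)) (at h r d)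

open Partial public

-- The data (ψ , u , a₀) of a composition problem over ρ ∈ Γ(I , i).

record Box {ℓ ℓ′} {Γ : CSet ℓ} (A : Ty Γ ℓ′) {I} (i : Fresh I) (ρ : CSet.Pt Γ (I ▹ i)) :
           Set (ℓ ⊔ ℓ′) where
  private
    module Γ = CSet Γ
    module A = Ty A
  field
    ψ        : Face I
    u        : Partial A ρ (ψ ⟨ deg i ⟩ᶠ)
    a₀       : A.El (ρ Γ.· face i false)
    a₀-agree : ∀ {J} (f : Hom J I) {ρ′ : Γ.Pt J} (p : ρ′ Γ.≈ ρ Γ.· face i false Γ.· f)
               (q : ρ′ Γ.≈ ρ Γ.· (face i false ∘ f)) .(c : ψ ⟨ f ⟩ᶠ ≈ᶠ 1F) →
               A.Eq ρ′ (A.res f p a₀) (at u (face i false ∘ f) q (one-deg ψ i false f c))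

open Box public using (u; a₀; a₀-agree)

-- BoxRes A f p B B′ says that ρ′ is ρ(f,i=j) and that B′ is
-- (ψf , u′ , a₀f) with u′_g = u_{(f,i=j)g}.

record BoxRes {ℓ ℓ′} {Γ : CSet ℓ} (A : Ty Γ ℓ′) {I J} {i : Fresh I} {j : Fresh J}
              {ρ : CSet.Pt Γ (I ▹ i)} {ρ′ : CSet.Pt Γ (J ▹ j)} (f : Hom J I)
              (p : CSet._≈_ Γ ρ′ (CSet._·_ Γ ρ (lift f i j))) (B : Box A i ρ) (B′ : Box A j ρ′) :
              Set (ℓ ⊔ ℓ′) where
  private
    module Γ = CSet Γ
    module A = Ty A
  field
    ψ-res  : Box.ψ B′ ≈ᶠ Box.ψ B ⟨ f ⟩ᶠ
    u-res  : ∀ {K} (g : Hom K (J ▹ j)) {ρ″ : Γ.Pt K} (q : ρ″ Γ.≈ ρ′ Γ.· g)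
             (r : ρ″ Γ.≈ ρ Γ.· (lift f i j ∘ g))
             .(c : Box.ψ B ⟨ deg i ⟩ᶠ ⟨ lift f i j ∘ g ⟩ᶠ ≈ᶠ 1F)
             .(d : Box.ψ B′ ⟨ deg j ⟩ᶠ ⟨ g ⟩ᶠ ≈ᶠ 1F) →
             A.Eq ρ″ (at (u B) (lift f i j ∘ g) r c) (at (u B′) g q d)
    a₀-res : A.Eq (ρ′ Γ.· face j false)
               (A.res f (Γ.square p (lift-face f i j false)) (a₀ B)) (a₀ B′)

open BoxRes public

-- comp-nat is naturality together with the requirement, automatic for
-- sets, that comp respect equality of its arguments (f = id).  The same
-- goes for nat₀ and nat₁ of EquivStr.

record Comp {ℓ ℓ′} {Γ : CSet ℓ} (A : Ty Γ ℓ′) : Set (ℓ ⊔ ℓ′) where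
  private
    module Γ = CSet Γ
    module A = Ty A
  field
    comp     : ∀ {I} (i : Fresh I) (ρ : Γ.Pt (I ▹ i)) → Box A i ρ → A.El (ρ Γ.· face i true)
    comp-nat : ∀ {I J} {i : Fresh I} {j : Fresh J} {ρ : Γ.Pt (I ▹ i)} {ρ′ : Γ.Pt (J ▹ j)}
               (f : Hom J I) (p : ρ′ Γ.≈ ρ Γ.· lift f i j) (B : Box A i ρ) (B′ : Box A j ρ′) →
               BoxRes A f p B B′ →
               A.Eq (ρ′ Γ.· face j true)
                 (A.res f (Γ.square p (lift-face f i j true)) (comp i ρ B)) (comp j ρ′ B′)
    comp-one : ∀ {I} (i : Fresh I) (ρ : Γ.Pt (I ▹ i)) (B : Box A i ρ) .(c : Box.ψ B ≈ᶠ 1F) →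
               A.Eq (ρ Γ.· face i true) (comp i ρ B)
                 (at (u B) (face i true) Γ.rfl (one-sub (face i true) (one-sub (deg i) c)))

open Comp public

module _ {ℓ ℓ₁ ℓ′} {Γ : CSet ℓ} {Δ : CSet ℓ₁} (A : Ty Γ ℓ′) (σ : Δ ⟶ Γ) where
  private
    module Γ = CSet Γ
    module Δ = CSet Δ
    module A = Ty A

  -- A partial element of Aσ over ρ is one of A over σρ.
  subPartial : ∀ {K} {ρ : Δ.Pt K} {χ : Face K} → Partial (A [ σ ]) ρ χ → Partial A (map σ ρ) χ
  subPartial {ρ = ρ} v = record
    { at     = λ f p c → A.cast (p Γ.⨾ Γ.symm (map-nat σ ρ f)) (at v f Δ.rfl c)
    ; at-nat = λ f g h e {ρ′} {ρ″} p q r c d →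
        A.Eq-trans ρ″
          (A.exchange {p′ = map-res σ (Δ.split ρ e)} {q′ = q′ f h r} (≈ʰ-trans (∘-idˡ g) (≈ʰ-sym (∘-idʳ g))))
          (A.res-cong ≈ʰ-refl (at-nat v f g h e Δ.rfl (Δ.split ρ e) Δ.rfl c d))
    }
    where
    q′ : ∀ {J L} (f : Hom J _) (h : Hom L _) {ρ″ : Γ.Pt L} → ρ″ Γ.≈ map σ ρ Γ.· h →
         ρ″ Γ.≈ map σ (ρ Δ.· h) Γ.· id
    q′ f h r = (r Γ.⨾ Γ.symm (map-nat σ ρ h)) Γ.⨾ Γ.symm (Γ.·-id _)

  subPartial-at : ∀ {K J} {ρ : Δ.Pt K} {χ : Face K} (v : Partial (A [ σ ]) ρ χ) (f : Hom J K)
                  {ρ′ : Δ.Pt J} (p : ρ′ Δ.≈ ρ Δ.· f) (q : map σ ρ′ Γ.≈ map σ ρ Γ.· f)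
                  .(c : χ ⟨ f ⟩ᶠ ≈ᶠ 1F) →
                  A.Eq (map σ ρ′) (at (subPartial v) f q c) (at v f p c)
  subPartial-at {ρ = ρ} v f {ρ′} p q c =
    A.Eq-trans (map σ ρ′)
      (A.res-cong ≈ʰ-refl (A.Eq-refl (map σ (ρ Δ.· f)) {at v f Δ.rfl c}))
      (at-nat v f id f (≈ʰ-sym (∘-idʳ f)) Δ.rfl (p Δ.⨾ Δ.symm (Δ.·-id _)) p c c)

  subPartial-res : ∀ {K L J} {ρ : Δ.Pt K} {χ : Face K} {ρ₁ : Δ.Pt L} {χ₁ : Face L}
                   (v : Partial (A [ σ ]) ρ χ) (v₁ : Partial (A [ σ ]) ρ₁ χ₁)
                   (f : Hom J K) (g : Hom J L) (s : ρ₁ Δ.· g Δ.≈ ρ Δ.· f)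
                   .(c : χ ⟨ f ⟩ᶠ ≈ᶠ 1F) .(d : χ₁ ⟨ g ⟩ᶠ ≈ᶠ 1F) →
                   A.Eq (map σ (ρ₁ Δ.· g)) (at v f s c) (at v₁ g Δ.rfl d) →
                   {ρ″ : Γ.Pt J} (q : ρ″ Γ.≈ map σ ρ₁ Γ.· g) (r : ρ″ Γ.≈ map σ ρ Γ.· f) →
                   A.Eq ρ″ (at (subPartial v) f r c) (at (subPartial v₁) g q d)
  subPartial-res {ρ₁ = ρ₁} v v₁ f g s c d h {ρ″} q r =
    A.Eq-trans ρ″
      (A.Eq-sym ρ″ (A.fuse {p = map-res σ s′} {q = (q Γ.⨾ Γ.symm (map-nat σ ρ₁ g)) Γ.⨾ Γ.symm (Γ.·-id _)}
        (≈ʰ-sym (∘-idʳ id))))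
      (A.res-cong ≈ʰ-refl (A.Eq-trans (map σ (ρ₁ Δ.· g))
        (at-nat v f id f (≈ʰ-sym (∘-idʳ f)) Δ.rfl s′ s c c) h))
    where
    s′ = s Δ.⨾ Δ.symm (Δ.·-id _)

  subBox : ∀ {I} {i : Fresh I} {ρ : Δ.Pt (I ▹ i)} → Box (A [ σ ]) i ρ → Box A i (map σ ρ)
  subBox {i = i} {ρ} B = record
    { ψ  = Box.ψ B
    ; u  = subPartial (u B)
    ; a₀ = A.cast (Γ.symm (map-nat σ ρ (face i false))) (a₀ B)
    ; a₀-agree = λ f {ρ′} p q c →
        A.Eq-trans ρ′
          (A.exchange {p′ = map-res σ (Δ.split ρ (≈ʰ-refl {f = face i false ∘ f}))}
                      {q′ = (q Γ.⨾ Γ.symm (map-nat σ ρ _)) Γ.⨾ Γ.symm (Γ.·-id _)}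
                      (≈ʰ-trans (∘-idˡ f) (≈ʰ-sym (∘-idʳ f))))
          (A.res-cong ≈ʰ-refl
            (a₀-agree B f (Δ.split ρ (≈ʰ-refl {f = face i false ∘ f})) Δ.rfl c))
    }

  subBoxRes : ∀ {I J} {i : Fresh I} {j : Fresh J} {ρ : Δ.Pt (I ▹ i)} {ρ′ : Δ.Pt (J ▹ j)}
              {f : Hom J I} {p : ρ′ Δ.≈ ρ Δ.· lift f i j}
              {B : Box (A [ σ ]) i ρ} {B′ : Box (A [ σ ]) j ρ′} →
              BoxRes (A [ σ ]) f p B B′ → BoxRes A f (map-res σ p) (subBox B) (subBox B′)
  subBoxRes {i = i} {j} {ρ} {ρ′} {f} {p} {B} {B′} R = record
    { ψ-res  = ψ-res R
    ; u-res  = λ g q r c d →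
        let s = Δ.after (lift f i j) g p in
        subPartial-res (u B) (u B′) (lift f i j ∘ g) g s c d (u-res R g Δ.rfl s c d) q r
    ; a₀-res = A.Eq-trans _
        (A.exchange {q′ = Γ.symm (map-nat σ ρ′ (face j false)) Γ.⨾ Γ.symm (Γ.·-id _)}
                    (≈ʰ-trans (∘-idˡ f) (≈ʰ-sym (∘-idʳ f))))
        (A.res-cong ≈ʰ-refl (a₀-res R))
    }

  subComp : Comp A → Comp (A [ σ ])
  subComp cA = record
    { comp     = λ i ρ B → A.cast (map-nat σ ρ (face i true)) (comp cA i (map σ ρ) (subBox B))
    ; comp-nat = λ {_} {_} {i} {j} {ρ} {ρ′} f p B B′ R →
        A.Eq-trans _ (A.exchange {q′ = map-nat σ ρ′ (face j true) Γ.⨾ Γ.symm (Γ.·-id _)}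
                       (≈ʰ-trans (∘-idˡ f) (≈ʰ-sym (∘-idʳ f))))
          (A.res-cong ≈ʰ-refl (comp-nat cA f (map-res σ p) (subBox B) (subBox B′) (subBoxRes R)))
    ; comp-one = λ i ρ B c →
        A.Eq-trans _ (A.res-cong ≈ʰ-refl (comp-one cA i (map σ ρ) (subBox B) c))
        (A.Eq-trans _ (A.fuse {q = map-nat σ ρ (face i true) Γ.⨾ Γ.symm (Γ.·-id _)} (≈ʰ-sym (∘-idʳ id)))
                      (A.res-id {p = Γ.symm (Γ.·-id _)} _))
    }

record Path {ℓ ℓ′} {Γ : CSet ℓ} (A : Ty Γ ℓ′) {I} (ρ : CSet.Pt Γ I) (x y : Ty.El A ρ) : Set ℓ′ where
  private
    module Γ = CSet Γ
    module A = Ty A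
  field
    dim  : Fresh I
    line : A.El (ρ Γ.· deg dim)
    at0  : A.Eq ρ (A.res (face dim false) (Γ.section ρ (deg-face dim false)) line) x
    at1  : A.Eq ρ (A.res (face dim true) (Γ.section ρ (deg-face dim true)) line) y

open Path public

-- PathRes A f p ω ω′ says that, ρ′ being ρf, ω′ = ⟨ j ⟩ v′ is the
-- restriction of ω = ⟨ i ⟩ v, i.e. v (f,i=j) = v′.  With f = id it says
-- that ω and ω′ are equal: v′ is v with i renamed to j.

PathRes : ∀ {ℓ ℓ′} {Γ : CSet ℓ} (A : Ty Γ ℓ′) {I J} {ρ : CSet.Pt Γ I} {ρ′ : CSet.Pt Γ J}
          (f : Hom J I) → CSet._≈_ Γ ρ′ (CSet._·_ Γ ρ f) →
          {x y : Ty.El A ρ} {x′ y′ : Ty.El A ρ′} → Path A ρ x y → Path A ρ′ x′ y′ → Set ℓ′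
PathRes {Γ = Γ} A {ρ′ = ρ′} f p ω ω′ =
  Ty.Eq A (ρ′ Γ.· deg (dim ω′))
    (Ty.res A (lift f (dim ω) (dim ω′)) (Γ.square p (≈ʰ-sym (deg-lift f (dim ω) (dim ω′)))) (line ω))
    (line ω′)
  where module Γ = CSet Γ

module _ {ℓ ℓ′} {Γ : CSet ℓ} (A : Ty Γ ℓ′) where
  private
    module Γ = CSet Γ
    module A = Ty A

  PathRes-refl : ∀ {I} {ρ : Γ.Pt I} {p : ρ Γ.≈ ρ Γ.· id} {x y : A.El ρ} (ω : Path A ρ x y) →
                 PathRes A id p ω ω
  PathRes-refl ω =
    A.Eq-trans _ (A.res-cong {p′ = Γ.symm (Γ.·-id _)} (lift-id (dim ω)) (A.Eq-refl _))
      (A.res-id (line ω))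

  PathRes-trans : ∀ {I J K} {ρ : Γ.Pt I} {ρ′ : Γ.Pt J} {ρ″ : Γ.Pt K}
                  {f : Hom J I} {g : Hom K J} {h : Hom K I} {p : ρ′ Γ.≈ ρ Γ.· f}
                  {q : ρ″ Γ.≈ ρ′ Γ.· g} {r : ρ″ Γ.≈ ρ Γ.· h} {x y : A.El ρ} {x′ y′ : A.El ρ′}
                  {x″ y″ : A.El ρ″} (ω : Path A ρ x y) (ω′ : Path A ρ′ x′ y′)
                  (ω″ : Path A ρ″ x″ y″) → h ≈ʰ f ∘ g →
                  PathRes A f p ω ω′ → PathRes A g q ω′ ω″ → PathRes A h r ω ω″
  PathRes-trans {f = f} {g} {h} {q = q} ω ω′ ω″ e P Q =
    A.Eq-trans _ (A.Eq-sym _ (A.fuse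
      {q = Γ.square q (≈ʰ-sym (deg-lift g (dim ω′) (dim ω″)))} (≈ʰ-sym (lift-∘ f g h e (dim ω) (dim ω′) (dim ω″)))))
      (A.Eq-trans _ (A.res-cong ≈ʰ-refl P) Q)

  PathRes-sym : ∀ {I} {ρ : Γ.Pt I} {p q : ρ Γ.≈ ρ Γ.· id} {x y x′ y′ : A.El ρ}
                (ω : Path A ρ x y) (ω′ : Path A ρ x′ y′) →
                PathRes A id p ω ω′ → PathRes A id q ω′ ω
  PathRes-sym {p = p} {q} ω ω′ P =
    A.Eq-trans _ (A.res-cong ≈ʰ-refl (A.Eq-sym _ P))
      (A.Eq-trans _
        (A.fuse {q = Γ.square q (≈ʰ-sym (deg-lift id (dim ω′) (dim ω)))}
                {r = Γ.square p (≈ʰ-sym (deg-lift id (dim ω) (dim ω)))}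
          (≈ʰ-sym (lift-∘ id id id (≈ʰ-sym (∘-idˡ id)) (dim ω) (dim ω′) (dim ω))))
        (PathRes-refl {p = p} ω))

  -- The set P_A(ρ; x , y).

  pathSetoid : ∀ {I} (ρ : Γ.Pt I) (x y : A.El ρ) → Setoid ℓ′ ℓ′
  pathSetoid ρ x y = record
    { Carrier = Path A ρ x y
    ; _≈_ = PathRes A id (Γ.symm (Γ.·-id ρ))
    ; isEquivalence = record
        { refl  = λ {ω} → PathRes-refl ω
        ; sym   = λ {ω} {ω′} → PathRes-sym ω ω′
        ; trans = λ {ω} {ω′} {ω″} → PathRes-trans ω ω′ ω″ (≈ʰ-sym (∘-idˡ id))
        }
    }

-- The arguments (ψ , b , t , ω) over ρ.

record Problem {ℓ ℓ′ ℓ″} {Δ : CSet ℓ} {T : Ty Δ ℓ′} {A : Ty Δ ℓ″} (w : Tm (T ⇒ A)) {I}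
               (ρ : CSet.Pt Δ I) : Set (ℓ ⊔ ℓ′ ⊔ ℓ″) where
  private
    module Δ = CSet Δ
    module A = Ty A
  field
    ψ     : Face I
    b     : A.El ρ
    t     : Partial T ρ ψ
    ω     : ∀ {J} (f : Hom J I) {ρ′ : Δ.Pt J} (p : ρ′ Δ.≈ ρ Δ.· f) .(c : ψ ⟨ f ⟩ᶠ ≈ᶠ 1F) →
            Path A ρ′ (w ⟪ ρ′ ⟫ at t f p c) (A.res f p b)
    ω-nat : ∀ {J K} (f : Hom J I) (g : Hom K J) (h : Hom K I) → h ≈ʰ f ∘ g →
            {ρ′ : Δ.Pt J} {ρ″ : Δ.Pt K} (p : ρ′ Δ.≈ ρ Δ.· f) (q : ρ″ Δ.≈ ρ′ Δ.· g)
            (r : ρ″ Δ.≈ ρ Δ.· h) .(c : ψ ⟨ f ⟩ᶠ ≈ᶠ 1F) .(d : ψ ⟨ h ⟩ᶠ ≈ᶠ 1F) →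
            PathRes A g q (ω f p c) (ω h r d)

open Problem public using (b; t; ω; ω-nat)

-- ProblemRes w f p Q Q′ says that ρ′ is ρf and that Q′ is
-- (ψf , bf , tf , ωf).

record ProblemRes {ℓ ℓ′ ℓ″} {Δ : CSet ℓ} {T : Ty Δ ℓ′} {A : Ty Δ ℓ″} (w : Tm (T ⇒ A)) {I J}
                  {ρ : CSet.Pt Δ I} {ρ′ : CSet.Pt Δ J} (f : Hom J I)
                  (p : CSet._≈_ Δ ρ′ (CSet._·_ Δ ρ f)) (Q : Problem w ρ) (Q′ : Problem w ρ′) :
                  Set (ℓ ⊔ ℓ′ ⊔ ℓ″) where
  private
    module Δ = CSet Δ
    module T = Ty T
    module A = Ty A
    module Q = Problem Q
    module Q′ = Problem Q′
  field
    ψ-res : Q′.ψ ≈ᶠ Q.ψ ⟨ f ⟩ᶠ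
    b-res : A.Eq ρ′ (A.res f p Q.b) Q′.b
    t-res : ∀ {K} (g : Hom K J) {ρ″ : Δ.Pt K} (q : ρ″ Δ.≈ ρ′ Δ.· g) (r : ρ″ Δ.≈ ρ Δ.· (f ∘ g))
            .(c : Q.ψ ⟨ f ∘ g ⟩ᶠ ≈ᶠ 1F) .(d : Q′.ψ ⟨ g ⟩ᶠ ≈ᶠ 1F) →
            T.Eq ρ″ (at Q.t (f ∘ g) r c) (at Q′.t g q d)
    ω-res : ∀ {K} (g : Hom K J) {ρ″ : Δ.Pt K} (q : ρ″ Δ.≈ ρ′ Δ.· g) (r : ρ″ Δ.≈ ρ Δ.· (f ∘ g))
            .(c : Q.ψ ⟨ f ∘ g ⟩ᶠ ≈ᶠ 1F) .(d : Q′.ψ ⟨ g ⟩ᶠ ≈ᶠ 1F) →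
            PathRes A id (Δ.symm (Δ.·-id ρ″)) (Q.ω (f ∘ g) r c) (Q′.ω g q d)

open ProblemRes public using (b-res; t-res; ω-res)

record EquivStr {ℓ ℓ′ ℓ″} {Δ : CSet ℓ} {T : Ty Δ ℓ′} {A : Ty Δ ℓ″} (w : Tm (T ⇒ A)) :
                Set (ℓ ⊔ ℓ′ ⊔ ℓ″) where
  private
    module Δ = CSet Δ
    module T = Ty T
    module A = Ty A
  field
    e₀     : ∀ {I} {ρ : Δ.Pt I} → Problem w ρ → T.El ρ
    e₁     : ∀ {I} {ρ : Δ.Pt I} (Q : Problem w ρ) → Path A ρ (w ⟪ ρ ⟫ e₀ Q) (b Q)
    agree₀ : ∀ {I} {ρ : Δ.Pt I} (Q : Problem w ρ) {J} (f : Hom J I) {ρ′ : Δ.Pt J}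
             (p : ρ′ Δ.≈ ρ Δ.· f) .(c : Problem.ψ Q ⟨ f ⟩ᶠ ≈ᶠ 1F) →
             T.Eq ρ′ (T.res f p (e₀ Q)) (at (t Q) f p c)
    agree₁ : ∀ {I} {ρ : Δ.Pt I} (Q : Problem w ρ) {J} (f : Hom J I) {ρ′ : Δ.Pt J}
             (p : ρ′ Δ.≈ ρ Δ.· f) .(c : Problem.ψ Q ⟨ f ⟩ᶠ ≈ᶠ 1F) →
             PathRes A f p (e₁ Q) (ω Q f p c)
    nat₀   : ∀ {I J} {ρ : Δ.Pt I} {ρ′ : Δ.Pt J} (f : Hom J I) (p : ρ′ Δ.≈ ρ Δ.· f)
             (Q : Problem w ρ) (Q′ : Problem w ρ′) → ProblemRes w f p Q Q′ →
             T.Eq ρ′ (T.res f p (e₀ Q)) (e₀ Q′)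
    nat₁   : ∀ {I J} {ρ : Δ.Pt I} {ρ′ : Δ.Pt J} (f : Hom J I) (p : ρ′ Δ.≈ ρ Δ.· f)
             (Q : Problem w ρ) (Q′ : Problem w ρ′) → ProblemRes w f p Q Q′ →
             PathRes A f p (e₁ Q) (e₁ Q′)

open EquivStr public

module _ {ℓ ℓ₁ ℓ′ ℓ″} {Γ : CSet ℓ} {Δ : CSet ℓ₁} (T : Ty Γ ℓ′) (A : Ty Γ ℓ″) (σ : Δ ⟶ Γ) where
  private
    module Γ = CSet Γ
    module Δ = CSet Δ
    module A = Ty A

  subTm : Tm (T ⇒ A) → Tm ((T [ σ ]) ⇒ (A [ σ ]))
  subTm w = record
    { tm     = λ ρ → record
        { app      = λ f p → app (tm w (map σ ρ)) f (map-res σ p)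
        ; app-cong = λ f p → app-cong (tm w (map σ ρ)) f (map-res σ p)
        ; app-nat  = λ f g h e p q r →
            app-nat (tm w (map σ ρ)) f g h e (map-res σ p) (map-res σ q) (map-res σ r)
        }
    ; tm-nat = λ {_} {_} {ρ} {ρ′} f p g {ρ″} q x →
        A.Eq-trans (map σ ρ″)
          (app-hom (tm w (map σ ρ)) (≈ʰ-refl {f = f ∘ g}) (map-res σ (q Δ.⨾ Δ.after f g p))
             (map-res σ q Γ.⨾ Γ.after f g (map-res σ p)) x)
          (tm-nat w f (map-res σ p) g (map-res σ q) x)
    }

  subTm-⟪⟫ : (w : Tm (T ⇒ A)) → ∀ {I} (ρ : Δ.Pt I) (x : Ty.El T (map σ ρ)) →
             A.Eq (map σ ρ) (subTm w ⟪ ρ ⟫ x) (w ⟪ map σ ρ ⟫ x)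
  subTm-⟪⟫ w ρ x = app-hom (tm w (map σ ρ)) (≈ʰ-refl {f = id}) (map-res σ (Δ.symm (Δ.·-id ρ)))
                     (Γ.symm (Γ.·-id (map σ ρ))) x

module _ {ℓ ℓ₁ ℓ′} {Γ : CSet ℓ} {Δ : CSet ℓ₁} (A : Ty Γ ℓ′) (σ : Δ ⟶ Γ) where
  private
    module Γ = CSet Γ
    module Δ = CSet Δ
    module A = Ty A

  pushPath : ∀ {I} {ρ : Δ.Pt I} {ρ″ : Γ.Pt I} (k : ρ″ Γ.≈ map σ ρ) {x y : A.El (map σ ρ)}
             {x′ y′ : A.El ρ″} → A.Eq ρ″ (A.cast k x) x′ → A.Eq ρ″ (A.cast k y) y′ →
             Path (A [ σ ]) ρ x y → Path A ρ″ x′ y′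
  pushPath {I} {ρ} {ρ″} k ex ey π = record
    { dim  = dim π
    ; line = A.cast (Γ.·-cong k ≈ʰ-refl Γ.⨾ Γ.symm (map-nat σ ρ (deg (dim π)))) (line π)
    ; at0  = A.Eq-trans ρ″ (A.exchange {p′ = s false} {q′ = k′} (e false))
               (A.Eq-trans ρ″ (A.res-cong ≈ʰ-refl (at0 π)) ex)
    ; at1  = A.Eq-trans ρ″ (A.exchange {p′ = s true} {q′ = k′} (e true))
               (A.Eq-trans ρ″ (A.res-cong ≈ʰ-refl (at1 π)) ey)
    }
    where
    k′ : ρ″ Γ.≈ map σ ρ Γ.· id
    k′ = k Γ.⨾ Γ.symm (Γ.·-id _)
    s : ∀ c → map σ ρ Γ.≈ map σ (ρ Δ.· deg (dim π)) Γ.· face (dim π) c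
    s c = map-res σ (Δ.section ρ (deg-face (dim π) c))
    e : ∀ c → id ∘ face (dim π) c ≈ʰ face (dim π) c ∘ id
    e c = ≈ʰ-trans (∘-idˡ (face (dim π) c)) (≈ʰ-sym (∘-idʳ (face (dim π) c)))

  pullPath : ∀ {I} {ρ : Δ.Pt I} {x y x′ y′ : A.El (map σ ρ)} →
             A.Eq (map σ ρ) x x′ → A.Eq (map σ ρ) y y′ →
             Path A (map σ ρ) x y → Path (A [ σ ]) ρ x′ y′
  pullPath {I} {ρ} ex ey π = record
    { dim  = dim π
    ; line = A.cast (map-nat σ ρ (deg (dim π))) (line π)
    ; at0  = A.Eq-trans (map σ ρ) (A.fuse (e false)) (A.Eq-trans (map σ ρ) (at0 π) ex)
    ; at1  = A.Eq-trans (map σ ρ) (A.fuse (e true)) (A.Eq-trans (map σ ρ) (at1 π) ey)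
    }
    where
    e : ∀ c → face (dim π) c ≈ʰ id ∘ face (dim π) c
    e c = ≈ʰ-sym (∘-idˡ (face (dim π) c))

  pushPath-res : ∀ {I J} {ρ : Δ.Pt I} {ρ′ : Δ.Pt J} {ρ₁ : Γ.Pt I} {ρ₁′ : Γ.Pt J} (f : Hom J I)
                 (p : ρ′ Δ.≈ ρ Δ.· f) (q : ρ₁′ Γ.≈ ρ₁ Γ.· f) (k : ρ₁ Γ.≈ map σ ρ) (k′ : ρ₁′ Γ.≈ map σ ρ′)
                 {x y : A.El (map σ ρ)} {x′ y′ : A.El ρ₁} {z w : A.El (map σ ρ′)} {z′ w′ : A.El ρ₁′}
                 (ex : A.Eq ρ₁ (A.cast k x) x′) (ey : A.Eq ρ₁ (A.cast k y) y′)
                 (ez : A.Eq ρ₁′ (A.cast k′ z) z′) (ew : A.Eq ρ₁′ (A.cast k′ w) w′)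
                 (π : Path (A [ σ ]) ρ x y) (π′ : Path (A [ σ ]) ρ′ z w) →
                 PathRes (A [ σ ]) f p π π′ →
                 PathRes A f q (pushPath k ex ey π) (pushPath k′ ez ew π′)
  pushPath-res {ρ′ = ρ′} f p q k k′ ex ey ez ew π π′ P =
    A.Eq-trans _
      (A.exchange {q′ = (Γ.·-cong k′ ≈ʰ-refl Γ.⨾ Γ.symm (map-nat σ ρ′ (deg (dim π′)))) Γ.⨾ Γ.symm (Γ.·-id _)}
        (≈ʰ-trans (∘-idˡ l) (≈ʰ-sym (∘-idʳ l))))
      (A.res-cong ≈ʰ-refl P)
    where
    l = lift f (dim π) (dim π′)

  pullPath-res : ∀ {I J} {ρ : Δ.Pt I} {ρ′ : Δ.Pt J} (f : Hom J I) (p : ρ′ Δ.≈ ρ Δ.· f)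
                 (q : map σ ρ′ Γ.≈ map σ ρ Γ.· f)
                 {x y x′ y′ : A.El (map σ ρ)} {z w z′ w′ : A.El (map σ ρ′)}
                 (ex : A.Eq (map σ ρ) x x′) (ey : A.Eq (map σ ρ) y y′)
                 (ez : A.Eq (map σ ρ′) z z′) (ew : A.Eq (map σ ρ′) w w′)
                 (π : Path A (map σ ρ) x y) (π′ : Path A (map σ ρ′) z w) →
                 PathRes A f q π π′ → PathRes (A [ σ ]) f p (pullPath ex ey π) (pullPath ez ew π′)
  pullPath-res {ρ′ = ρ′} f p q ex ey ez ew π π′ P =
    A.Eq-trans _
      (A.exchange {q′ = map-nat σ ρ′ (deg (dim π′)) Γ.⨾ Γ.symm (Γ.·-id _)}
        (≈ʰ-trans (∘-idˡ l) (≈ʰ-sym (∘-idʳ l))))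
      (A.res-cong ≈ʰ-refl P)
    where
    l = lift f (dim π) (dim π′)

  pull-push-res : ∀ {I J} {ρ : Δ.Pt I} {ρ′ : Δ.Pt J} (f : Hom J I) (p : ρ′ Δ.≈ ρ Δ.· f)
                  (q : map σ ρ′ Γ.≈ map σ ρ Γ.· f) (k : map σ ρ′ Γ.≈ map σ ρ′)
                  {x y x′ y′ : A.El (map σ ρ)} {z w z′ w′ : A.El (map σ ρ′)}
                  (ex : A.Eq (map σ ρ) x x′) (ey : A.Eq (map σ ρ) y y′)
                  (ez : A.Eq (map σ ρ′) (A.cast k z) z′) (ew : A.Eq (map σ ρ′) (A.cast k w) w′)
                  (π : Path A (map σ ρ) x y) (π′ : Path (A [ σ ]) ρ′ z w) →
                  PathRes A f q π (pushPath k ez ew π′) → PathRes (A [ σ ]) f p (pullPath ex ey π) π′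
  pull-push-res {ρ = ρ} {ρ′ = ρ′} f p q k ex ey ez ew π π′ P =
    A.Eq-trans _
      (A.exchange {q′ = map-nat σ ρ′ (deg (dim π′)) Γ.⨾ Γ.symm (Γ.·-id _)}
        (≈ʰ-trans (∘-idˡ l) (≈ʰ-sym (∘-idʳ l))))
      (A.Eq-trans _ (A.res-cong {p′ = map-nat σ ρ′ (deg (dim π′)) Γ.⨾ Γ.symm (Γ.·-id _)} ≈ʰ-refl P)
      (A.Eq-trans _ (A.fuse {r = Γ.symm (Γ.·-id _)} (≈ʰ-sym (∘-idˡ id))) (A.res-id (line π′))))
    where
    l = lift f (dim π) (dim π′)

module _ {ℓ ℓ₁ ℓ′ ℓ″} {Γ : CSet ℓ} {Δ : CSet ℓ₁} (T : Ty Γ ℓ′) (A : Ty Γ ℓ″) (σ : Δ ⟶ Γ)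
         (w : Tm (T ⇒ A)) where
  private
    module Γ = CSet Γ
    module Δ = CSet Δ
    module T = Ty T
    module A = Ty A
    wσ = subTm T A σ w

    cast-wσ : ∀ {I} (ρ : Δ.Pt I) {ρ″ : Γ.Pt I} (k : ρ″ Γ.≈ map σ ρ) (x : T.El (map σ ρ)) →
              A.Eq ρ″ (A.cast k (wσ ⟪ ρ ⟫ x)) (w ⟪ ρ″ ⟫ T.cast k x)
    cast-wσ ρ {ρ″} k x = A.Eq-trans ρ″ (A.res-cong ≈ʰ-refl (subTm-⟪⟫ T A σ w ρ x))
                           (⟪⟫-nat w id (k Γ.⨾ Γ.symm (Γ.·-id _)) x)

    rep : ∀ {I J} (ρ : Δ.Pt I) (f : Hom J I) {ρ″ : Γ.Pt J} → ρ″ Γ.≈ map σ ρ Γ.· f →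
          ρ″ Γ.≈ map σ (ρ Δ.· f)
    rep ρ f p = p Γ.⨾ Γ.symm (map-nat σ ρ f)

  private
    pushˡ : ∀ {I J} {ρ : Δ.Pt I} (Q : Problem wσ ρ) (f : Hom J I) {ρ″ : Γ.Pt J}
            (p : ρ″ Γ.≈ map σ ρ Γ.· f) .(c : Problem.ψ Q ⟨ f ⟩ᶠ ≈ᶠ 1F) →
            A.Eq ρ″ (A.cast (rep ρ f p) (wσ ⟪ ρ Δ.· f ⟫ at (t Q) f Δ.rfl c))
                    (w ⟪ ρ″ ⟫ at (subPartial T σ (t Q)) f p c)
    pushˡ {ρ = ρ} Q f p c = cast-wσ (ρ Δ.· f) (rep ρ f p) (at (t Q) f Δ.rfl c)

    pushʳ : ∀ {I J} {ρ : Δ.Pt I} (Q : Problem wσ ρ) (f : Hom J I) {ρ″ : Γ.Pt J}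
            (p : ρ″ Γ.≈ map σ ρ Γ.· f) →
            A.Eq ρ″ (A.cast (rep ρ f p) (A.res f (map-res σ Δ.rfl) (b Q))) (A.res f p (b Q))
    pushʳ Q f p = A.fuse (≈ʰ-sym (∘-idʳ f))

  subProblem : ∀ {I} {ρ : Δ.Pt I} → Problem wσ ρ → Problem w (map σ ρ)
  subProblem {I} {ρ} Q = record
    { ψ     = Problem.ψ Q
    ; b     = b Q
    ; t     = subPartial T σ (t Q)
    ; ω     = λ f p c → pushPath A σ (rep ρ f p) (pushˡ Q f p c) (pushʳ Q f p) (ω Q f Δ.rfl c)
    ; ω-nat = λ f g h e p q r c d →
        pushPath-res A σ g (Δ.split ρ e) q (rep ρ f p) (rep ρ h r) (pushˡ Q f p c) (pushʳ Q f p) (pushˡ Q h r d) (pushʳ Q h r)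
          (ω Q f Δ.rfl c) (ω Q h Δ.rfl d) (ω-nat Q f g h e Δ.rfl (Δ.split ρ e) Δ.rfl c d)
    }

  subProblemRes : ∀ {I J} {ρ : Δ.Pt I} {ρ′ : Δ.Pt J} {f : Hom J I} {p : ρ′ Δ.≈ ρ Δ.· f}
                  {Q : Problem wσ ρ} {Q′ : Problem wσ ρ′} → ProblemRes wσ f p Q Q′ →
                  ProblemRes w f (map-res σ p) (subProblem Q) (subProblem Q′)
  subProblemRes {ρ = ρ} {ρ′} {f} {p} {Q} {Q′} R = record
    { ψ-res = ProblemRes.ψ-res R
    ; b-res = b-res R
    ; t-res = λ g q r c d →
        let s = Δ.after f g p in
        subPartial-res T σ (t Q) (t Q′) (f ∘ g) g s c d (t-res R g Δ.rfl s c d) q r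
    ; ω-res = λ g {ρ″} q r c d →
        let s : ρ′ Δ.· g Δ.≈ ρ Δ.· (f ∘ g)
            s = Δ.after f g p
            s′ = s Δ.⨾ Δ.symm (Δ.·-id _) in
        pushPath-res A σ id s′ (Γ.symm (Γ.·-id ρ″)) (rep ρ (f ∘ g) r) (rep ρ′ g q)
          (pushˡ Q (f ∘ g) r c) (pushʳ Q (f ∘ g) r) (pushˡ Q′ g q d) (pushʳ Q′ g q)
          (ω Q (f ∘ g) Δ.rfl c) (ω Q′ g Δ.rfl d)
          (PathRes-trans (A [ σ ]) {q = Δ.symm (Δ.·-id _)} (ω Q (f ∘ g) Δ.rfl c) (ω Q (f ∘ g) s c) (ω Q′ g Δ.rfl d) (≈ʰ-sym (∘-idˡ id))
            (ω-nat Q (f ∘ g) id (f ∘ g) (≈ʰ-sym (∘-idʳ _)) Δ.rfl s′ s c c)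
            (ω-res R g Δ.rfl s c d))
    }

  module _ (E : EquivStr w) where
    private
      pullˡ : ∀ {I} {ρ : Δ.Pt I} (Q : Problem wσ ρ) →
              A.Eq (map σ ρ) (w ⟪ map σ ρ ⟫ e₀ E (subProblem Q)) (wσ ⟪ ρ ⟫ e₀ E (subProblem Q))
      pullˡ {ρ = ρ} Q = A.Eq-sym (map σ ρ) (subTm-⟪⟫ T A σ w ρ (e₀ E (subProblem Q)))

      pullʳ : ∀ {I} {ρ : Δ.Pt I} (Q : Problem wσ ρ) → A.Eq (map σ ρ) (b Q) (b Q)
      pullʳ {ρ = ρ} Q = A.Eq-refl (map σ ρ)

      sub-e₁ : ∀ {I} {ρ : Δ.Pt I} (Q : Problem wσ ρ) →
               Path (A [ σ ]) ρ (wσ ⟪ ρ ⟫ e₀ E (subProblem Q)) (b Q)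
      sub-e₁ {ρ = ρ} Q =
        pullPath A σ (pullˡ Q) (pullʳ Q) (e₁ E (subProblem Q))

      sub-agree₁ : ∀ {I} {ρ : Δ.Pt I} (Q : Problem wσ ρ) {J} (f : Hom J I) {ρ′ : Δ.Pt J}
                   (p : ρ′ Δ.≈ ρ Δ.· f) .(c : Problem.ψ Q ⟨ f ⟩ᶠ ≈ᶠ 1F) →
                   PathRes (A [ σ ]) f p (sub-e₁ Q) (ω Q f p c)
      sub-agree₁ {ρ = ρ} Q f {ρ′} p c =
        pull-push-res A σ f p (map-res σ p) Γ.rfl (pullˡ Q) (pullʳ Q) ex ey (e₁ E Q′) (ω Q f p c)
          (PathRes-trans A {q = Γ.symm (Γ.·-id _)} (e₁ E Q′) (ω Q′ f (map-res σ p) c) π′ (≈ʰ-sym (∘-idʳ f))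
            (agree₁ E Q′ f (map-res σ p) c)
            (pushPath-res A σ id s (Γ.symm (Γ.·-id _)) (rep ρ f (map-res σ p)) Γ.rfl
              (pushˡ Q f (map-res σ p) c) (pushʳ Q f (map-res σ p)) ex ey
              (ω Q f Δ.rfl c) (ω Q f p c)
              (ω-nat Q f id f (≈ʰ-sym (∘-idʳ f)) Δ.rfl s p c c)))
        where
        Q′ = subProblem Q
        s = p Δ.⨾ Δ.symm (Δ.·-id (ρ Δ.· f))
        ex = cast-wσ ρ′ Γ.rfl (at (t Q) f p c)
        ey = A.Eq-refl (map σ ρ′) {A.cast Γ.rfl (A.res f (map-res σ p) (b Q))}
        π′ = pushPath A σ Γ.rfl ex ey (ω Q f p c)

    private
      sub-agree₀ : ∀ {I} {ρ : Δ.Pt I} (Q : Problem wσ ρ) {J} (f : Hom J I) {ρ′ : Δ.Pt J}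
                   (p : ρ′ Δ.≈ ρ Δ.· f) .(c : Problem.ψ Q ⟨ f ⟩ᶠ ≈ᶠ 1F) →
                   T.Eq (map σ ρ′) (T.res f (map-res σ p) (e₀ E (subProblem Q))) (at (t Q) f p c)
      sub-agree₀ Q f {ρ′} p c =
        T.Eq-trans (map σ ρ′) (agree₀ E (subProblem Q) f (map-res σ p) c)
          (subPartial-at T σ (t Q) f p (map-res σ p) c)

      sub-nat₀ : ∀ {I J} {ρ : Δ.Pt I} {ρ′ : Δ.Pt J} (f : Hom J I) (p : ρ′ Δ.≈ ρ Δ.· f)
                 (Q : Problem wσ ρ) (Q′ : Problem wσ ρ′) → ProblemRes wσ f p Q Q′ →
                 T.Eq (map σ ρ′) (T.res f (map-res σ p) (e₀ E (subProblem Q))) (e₀ E (subProblem Q′))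
      sub-nat₀ f p Q Q′ R = nat₀ E f (map-res σ p) (subProblem Q) (subProblem Q′) (subProblemRes {f = f} {p} {Q} {Q′} R)

      sub-nat₁ : ∀ {I J} {ρ : Δ.Pt I} {ρ′ : Δ.Pt J} (f : Hom J I) (p : ρ′ Δ.≈ ρ Δ.· f)
                 (Q : Problem wσ ρ) (Q′ : Problem wσ ρ′) → ProblemRes wσ f p Q Q′ →
                 PathRes (A [ σ ]) f p (sub-e₁ Q) (sub-e₁ Q′)
      sub-nat₁ f p Q Q′ R =
        pullPath-res A σ f p (map-res σ p) (pullˡ Q) (pullʳ Q) (pullˡ Q′) (pullʳ Q′)
          (e₁ E (subProblem Q)) (e₁ E (subProblem Q′))
          (nat₁ E f (map-res σ p) (subProblem Q) (subProblem Q′) (subProblemRes {f = f} {p} {Q} {Q′} R))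

    subEquiv : EquivStr wσ
    subEquiv = record
      { e₀     = λ Q → e₀ E (subProblem Q)
      ; e₁     = sub-e₁
      ; agree₀ = sub-agree₀
      ; agree₁ = sub-agree₁
      ; nat₀   = sub-nat₀
      ; nat₁   = sub-nat₁
      }

record GlueData {ℓ} (Γ : CSet ℓ) : Set (lsuc ℓ) where
  constructor glueData
  field
    φ : Γ ⟶ 𝔽
    T : Ty (Γ ▸ φ) ℓ
    A : Ty Γ ℓ
    w : Tm (T ⇒ restrictTo φ A)

module _ {ℓ} {Γ : CSet ℓ} (D : GlueData Γ) where
  open GlueData D
  private
    module Γ = CSet Γ
    module T = Ty T
    module A = Ty A

  -- The triples glue(φρ , sys , base).

  record Triple {I} (ρ : Γ.Pt I) : Set ℓ where
    field
      sys     : ∀ {J} (f : Hom J I) {ρ′ : Γ.Pt J} → ρ′ Γ.≈ ρ Γ.· f → .(c : map φ ρ′ ≈ᶠ 1F) →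
                T.El (ρ′ ,, c)
      sys-nat : ∀ {J K} (f : Hom J I) (g : Hom K J) (h : Hom K I) → h ≈ʰ f ∘ g →
                {ρ′ : Γ.Pt J} {ρ″ : Γ.Pt K} (p : ρ′ Γ.≈ ρ Γ.· f) (q : ρ″ Γ.≈ ρ′ Γ.· g)
                (r : ρ″ Γ.≈ ρ Γ.· h) .(c : map φ ρ′ ≈ᶠ 1F) .(d : map φ ρ″ ≈ᶠ 1F) →
                T.Eq (ρ″ ,, d) (T.res g q (sys f p c)) (sys h r d)
      base    : A.El ρ
      agree   : ∀ {J} (f : Hom J I) {ρ′ : Γ.Pt J} (p : ρ′ Γ.≈ ρ Γ.· f) .(c : map φ ρ′ ≈ᶠ 1F) →
                A.Eq ρ′ (w ⟪ ρ′ ,, c ⟫ sys f p c) (A.res f p base)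

    sys-hom : ∀ {J} {f f′ : Hom J I} → f ≈ʰ f′ → {ρ′ : Γ.Pt J} (p : ρ′ Γ.≈ ρ Γ.· f)
            (p′ : ρ′ Γ.≈ ρ Γ.· f′) .(c : map φ ρ′ ≈ᶠ 1F) → T.Eq (ρ′ ,, c) (sys f p c) (sys f′ p′ c)
    sys-hom {f = f} {f′} e {ρ′} p p′ c =
      T.Eq-trans (ρ′ ,, c) (T.Eq-sym (ρ′ ,, c) (T.res-id {p = Γ.symm (Γ.·-id ρ′)} (sys f p c)))
        (sys-nat f id f′ (≈ʰ-trans (≈ʰ-sym e) (≈ʰ-sym (∘-idʳ f))) p (Γ.symm (Γ.·-id ρ′)) p′ c c)

  open Triple public

  tripleSetoid : ∀ {I} (ρ : Γ.Pt I) → Setoid ℓ ℓ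
  tripleSetoid {I} ρ = record
    { Carrier = Triple ρ
    ; _≈_ = λ x y →
        (∀ {J} (f : Hom J I) {ρ′ : Γ.Pt J} (p : ρ′ Γ.≈ ρ Γ.· f) .(c : map φ ρ′ ≈ᶠ 1F) →
          T.Eq (ρ′ ,, c) (sys x f p c) (sys y f p c))
        × A.Eq ρ (base x) (base y)
    ; isEquivalence = record
        { refl  = (λ f {ρ′} p c → T.Eq-refl (ρ′ ,, c)) , A.Eq-refl ρ
        ; sym   = λ (s , e) → (λ f {ρ′} p c → T.Eq-sym (ρ′ ,, c) (s f p c)) , A.Eq-sym ρ e
        ; trans = λ (s , e) (s′ , e′) →
            (λ f {ρ′} p c → T.Eq-trans (ρ′ ,, c) (s f p c) (s′ f p c)) , A.Eq-trans ρ e e′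
        }
    }

  tripleRes : ∀ {I J} {ρ : Γ.Pt I} {ρ′ : Γ.Pt J} (f : Hom J I) → ρ′ Γ.≈ ρ Γ.· f →
              Triple ρ → Triple ρ′
  tripleRes f p x = record
    { sys       = λ g q → sys x (f ∘ g) (q Γ.⨾ Γ.after f g p)
    ; sys-nat = λ g h k e q r s → sys-nat x (f ∘ g) h (f ∘ k)
        (≈ʰ-trans (∘-cong (≈ʰ-refl {f = f}) e) (≈ʰ-sym (∘-assoc f g h)))
        (q Γ.⨾ Γ.after f g p) r (s Γ.⨾ Γ.after f k p)
    ; base    = A.res f p (base x)
    ; agree   = λ g {ρ″} q c →
        A.Eq-trans ρ″ (agree x (f ∘ g) (q Γ.⨾ Γ.after f g p) c)
          (A.Eq-sym ρ″ (A.fuse (≈ʰ-refl {f = f ∘ g})))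
    }

  one-res : ∀ {I J} {ρ : Γ.Pt I} {ρ′ : Γ.Pt J} (f : Hom J I) → ρ′ Γ.≈ ρ Γ.· f →
            map φ ρ ≈ᶠ 1F → map φ ρ′ ≈ᶠ 1F
  one-res f p c = ≈-trans (map-res φ p) (one-sub f c)

  glueEl : ∀ {I} (ρ : Γ.Pt I) → Dec (map φ ρ ≈ᶠ 1F) → Setoid ℓ ℓ
  glueEl ρ (yes c) = T.el (ρ ,, c)
  glueEl ρ (no _)  = tripleSetoid ρ

  private
    El : ∀ {I} (ρ : Γ.Pt I) → Dec (map φ ρ ≈ᶠ 1F) → Set ℓ
    El ρ d = Setoid.Carrier (glueEl ρ d)

    Eq : ∀ {I} (ρ : Γ.Pt I) (d : Dec (map φ ρ ≈ᶠ 1F)) → El ρ d → El ρ d → Set ℓ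
    Eq ρ d = Setoid._≈_ (glueEl ρ d)

  glueRes : ∀ {I J} {ρ : Γ.Pt I} {ρ′ : Γ.Pt J} (d : Dec (map φ ρ ≈ᶠ 1F)) (d′ : Dec (map φ ρ′ ≈ᶠ 1F))
            (f : Hom J I) → ρ′ Γ.≈ ρ Γ.· f → El ρ d → El ρ′ d′
  glueRes (yes _) (yes _)  f p x = T.res f p x
  glueRes (yes c) (no ¬c′) f p x = ⊥-elim (¬c′ (one-res f p c))
  glueRes (no _)  (yes c′) f p x = sys x f p c′
  glueRes (no _)  (no _)   f p x = tripleRes f p x

  glueRes-cong : ∀ {I J} {ρ : Γ.Pt I} {ρ′ : Γ.Pt J} (d : Dec (map φ ρ ≈ᶠ 1F))
                 (d′ : Dec (map φ ρ′ ≈ᶠ 1F)) {f f′ : Hom J I} (p : ρ′ Γ.≈ ρ Γ.· f)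
                 (p′ : ρ′ Γ.≈ ρ Γ.· f′) {x y : El ρ d} → f ≈ʰ f′ → Eq ρ d x y →
                 Eq ρ′ d′ (glueRes d d′ f p x) (glueRes d d′ f′ p′ y)
  glueRes-cong (yes _) (yes _) p p′ e x≈y = T.res-cong e x≈y
  glueRes-cong (yes c) (no ¬c′) {f} p p′ e x≈y = ⊥-elim (¬c′ (one-res f p c))
  glueRes-cong {ρ′ = ρ′} (no _) (yes c′) {f} p p′ {x} {y} e (s , _) =
    T.Eq-trans (ρ′ ,, c′) (s f p c′) (sys-hom y e p p′ c′)
  glueRes-cong (no _) (no _) {f} {f′} p p′ {x} {y} e (s , r) =
    (λ g {ρ″} q c → T.Eq-trans (ρ″ ,, c) (s (f ∘ g) (q Γ.⨾ Γ.after f g p) c)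
      (sys-hom y (∘-cong e (≈ʰ-refl {f = g})) (q Γ.⨾ Γ.after f g p) (q Γ.⨾ Γ.after f′ g p′) c))
    , A.res-cong e r

  glueRes-id : ∀ {I} {ρ : Γ.Pt I} (d : Dec (map φ ρ ≈ᶠ 1F)) (p : ρ Γ.≈ ρ Γ.· id) (x : El ρ d) →
               Eq ρ d (glueRes d d id p x) x
  glueRes-id (yes _) p x = T.res-id x
  glueRes-id (no _)  p x =
    (λ g q c → sys-hom x (∘-idˡ g) (q Γ.⨾ Γ.after id g p) q c) , A.res-id (base x)

  glueRes-∘ : ∀ {I J K} {ρ : Γ.Pt I} {ρ′ : Γ.Pt J} {ρ″ : Γ.Pt K} (d : Dec (map φ ρ ≈ᶠ 1F))
              (d′ : Dec (map φ ρ′ ≈ᶠ 1F)) (d″ : Dec (map φ ρ″ ≈ᶠ 1F)) (f : Hom J I) (g : Hom K J)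
              (p : ρ′ Γ.≈ ρ Γ.· f) (q : ρ″ Γ.≈ ρ′ Γ.· g) (r : ρ″ Γ.≈ ρ Γ.· (f ∘ g)) (x : El ρ d) →
              Eq ρ″ d″ (glueRes d′ d″ g q (glueRes d d′ f p x)) (glueRes d d″ (f ∘ g) r x)
  glueRes-∘ (yes _) (yes _)  (yes _)  f g p q r x = T.res-∘ f g x
  glueRes-∘ (yes _) (yes c′) (no ¬c″) f g p q r x = ⊥-elim (¬c″ (one-res g q c′))
  glueRes-∘ (yes c) (no ¬c′) _        f g p q r x = ⊥-elim (¬c′ (one-res f p c))
  glueRes-∘ (no _)  (yes c′) (yes c″) f g p q r x = sys-nat x f g (f ∘ g) ≈ʰ-refl p q r c′ c″
  glueRes-∘ (no _)  (yes c′) (no ¬c″) f g p q r x = ⊥-elim (¬c″ (one-res g q c′))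
  glueRes-∘ (no _)  (no _)   (yes c″) f g p q r x =
    sys-hom x (≈ʰ-refl {f = f ∘ g}) (q Γ.⨾ Γ.after f g p) r c″
  glueRes-∘ (no _)  (no _)   (no _)   f g p q r x =
    (λ h s c → sys-hom x (≈ʰ-sym (∘-assoc f g h)) ((s Γ.⨾ Γ.after g h q) Γ.⨾ Γ.after f (g ∘ h) p)
                 (s Γ.⨾ Γ.after (f ∘ g) h r) c)
    , A.res-∘ f g (base x)

  Glue : Ty Γ ℓ
  Glue = record
    { el       = λ ρ → glueEl ρ (isOne? (map φ ρ))
    ; res      = λ {_} {_} {ρ} {ρ′} → glueRes (isOne? (map φ ρ)) (isOne? (map φ ρ′))
    ; res-cong = λ {_} {_} {ρ} {ρ′} {_} {_} {p} {p′} →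
        glueRes-cong (isOne? (map φ ρ)) (isOne? (map φ ρ′)) p p′
    ; res-id   = λ {_} {ρ} {p} → glueRes-id (isOne? (map φ ρ)) p
    ; res-∘    = λ {_} {_} {_} {ρ} {ρ′} {ρ″} f g {p} {q} {r} →
        glueRes-∘ (isOne? (map φ ρ)) (isOne? (map φ ρ′)) (isOne? (map φ ρ″)) f g p q r
    }

-- A and T fibrant, w an equivalence.

record FibrantGlueData {ℓ} {Γ : CSet ℓ} (D : GlueData Γ) : Set ℓ where
  constructor fibrantGlueData
  open GlueData D
  field
    compA  : Comp A
    compT  : Comp T
    equivw : EquivStr w

module _ {ℓ} {Γ Δ : CSet ℓ} (σ : Δ ⟶ Γ) where

  -- (φσ , Tσ , Aσ , wσ)
  subGlueData : GlueData Γ → GlueData Δ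
  subGlueData (glueData φ T A w) = record
    { φ = φ ∘ᶜ σ
    ; T = T [ σ ▸▸ φ ]
    ; A = A [ σ ]
    ; w = subTm T (restrictTo φ A) (σ ▸▸ φ) w
    }

  subFibrantGlueData : {D : GlueData Γ} → FibrantGlueData D → FibrantGlueData (subGlueData D)
  subFibrantGlueData {glueData φ T A w} (fibrantGlueData cA cT e) = record
    { compA  = subComp A σ cA
    ; compT  = subComp T (σ ▸▸ φ) cT
    ; equivw = subEquiv T (restrictTo φ A) (σ ▸▸ φ) w e
    }

-- Types being families of setoids, equality of two types is a bijection
-- of their fibres, compatible with restriction.  The two instances used
-- below are the identity on elements, up to change of representatives.

infix 4 _≅_

record _≅_ {ℓ ℓ′} {Γ : CSet ℓ} (A B : Ty Γ ℓ′) : Set (ℓ ⊔ ℓ′) where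
  private
    module Γ = CSet Γ
    module A = Ty A
    module B = Ty B
  field
    to        : ∀ {I} {ρ : Γ.Pt I} → A.El ρ → B.El ρ
    from      : ∀ {I} {ρ : Γ.Pt I} → B.El ρ → A.El ρ
    to-cong   : ∀ {I} (ρ : Γ.Pt I) {x y : A.El ρ} → A.Eq ρ x y → B.Eq ρ (to x) (to y)
    from-cong : ∀ {I} (ρ : Γ.Pt I) {x y : B.El ρ} → B.Eq ρ x y → A.Eq ρ (from x) (from y)
    to-from   : ∀ {I} (ρ : Γ.Pt I) (y : B.El ρ) → B.Eq ρ (to (from y)) y
    from-to   : ∀ {I} (ρ : Γ.Pt I) (x : A.El ρ) → A.Eq ρ (from (to x)) x
    to-nat    : ∀ {I J} {ρ : Γ.Pt I} {ρ′ : Γ.Pt J} (f : Hom J I) (p : ρ′ Γ.≈ ρ Γ.· f) (x : A.El ρ) →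
                B.Eq ρ′ (B.res f p (to x)) (to (A.res f p x))

module _ {ℓ ℓ′} {Γ : CSet ℓ} {A B : Ty Γ ℓ′} (E : A ≅ B) where
  open _≅_ E
  private
    module Γ = CSet Γ
    module B = Ty B

  toPartial : ∀ {K} {ρ : Γ.Pt K} {χ : Face K} → Partial A ρ χ → Partial B ρ χ
  toPartial v = record
    { at     = λ f p c → to (at v f p c)
    ; at-nat = λ f g h e {ρ′} {ρ″} p q r c d →
        B.Eq-trans ρ″ (to-nat g q (at v f p c)) (to-cong ρ″ (at-nat v f g h e p q r c d))
    }

  toBox : ∀ {I} {i : Fresh I} {ρ : Γ.Pt (I ▹ i)} → Box A i ρ → Box B i ρ
  toBox {i = i} B = record
    { ψ        = Box.ψ B
    ; u        = toPartial (u B)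
    ; a₀       = to (a₀ B)
    ; a₀-agree = λ f {ρ′} p q c →
        B.Eq-trans ρ′ (to-nat f p (a₀ B)) (to-cong ρ′ (a₀-agree B f p q c))
    }

  SameComp : Comp A → Comp B → Set (ℓ ⊔ ℓ′)
  SameComp cA cB = ∀ {I} (i : Fresh I) (ρ : Γ.Pt (I ▹ i)) (C : Box A i ρ) →
                   B.Eq (ρ Γ.· face i true) (to (comp cA i ρ C)) (comp cB i ρ (toBox C))

-- If φ is constantly 1 then Glue(φ , T , A , w) = T.

module _ {ℓ} {Γ : CSet ℓ} (D : GlueData Γ)
         (h : ∀ {I} (ρ : CSet.Pt Γ I) → map (GlueData.φ D) ρ ≈ᶠ 1F) where
  open GlueData D
  private
    module T = Ty T

  Glue≅T : Glue D ≅ T [ total φ h ]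
  Glue≅T = record
    { to        = λ {_} {ρ} → to′ ρ (isOne? (map φ ρ))
    ; from      = λ {_} {ρ} → from′ ρ (isOne? (map φ ρ))
    ; to-cong   = λ ρ → to-cong′ ρ (isOne? (map φ ρ))
    ; from-cong = λ ρ → from-cong′ ρ (isOne? (map φ ρ))
    ; to-from   = λ ρ → to-from′ ρ (isOne? (map φ ρ))
    ; from-to   = λ ρ → from-to′ ρ (isOne? (map φ ρ))
    ; to-nat    = λ {_} {_} {ρ} {ρ′} f p → to-nat′ (isOne? (map φ ρ)) (isOne? (map φ ρ′)) f p
    }
    where
    module Γ = CSet Γ

    to′ : ∀ {I} (ρ : Γ.Pt I) (d : Dec (map φ ρ ≈ᶠ 1F)) → Setoid.Carrier (glueEl D ρ d) → T.El (ρ ,, h ρ)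
    to′ ρ (yes _) x = x
    to′ ρ (no ¬c) x = ⊥-elim (¬c (h ρ))

    from′ : ∀ {I} (ρ : Γ.Pt I) (d : Dec (map φ ρ ≈ᶠ 1F)) → T.El (ρ ,, h ρ) → Setoid.Carrier (glueEl D ρ d)
    from′ ρ (yes _) x = x
    from′ ρ (no ¬c) x = ⊥-elim (¬c (h ρ))

    to-cong′ : ∀ {I} (ρ : Γ.Pt I) (d : Dec (map φ ρ ≈ᶠ 1F)) {x y : Setoid.Carrier (glueEl D ρ d)} →
               Setoid._≈_ (glueEl D ρ d) x y → T.Eq (ρ ,, h ρ) (to′ ρ d x) (to′ ρ d y)
    to-cong′ ρ (yes _) e = e
    to-cong′ ρ (no ¬c) e = ⊥-elim (¬c (h ρ))

    from-cong′ : ∀ {I} (ρ : Γ.Pt I) (d : Dec (map φ ρ ≈ᶠ 1F)) {x y : T.El (ρ ,, h ρ)} →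
                 T.Eq (ρ ,, h ρ) x y → Setoid._≈_ (glueEl D ρ d) (from′ ρ d x) (from′ ρ d y)
    from-cong′ ρ (yes _) e = e
    from-cong′ ρ (no ¬c) e = ⊥-elim (¬c (h ρ))

    to-from′ : ∀ {I} (ρ : Γ.Pt I) (d : Dec (map φ ρ ≈ᶠ 1F)) (y : T.El (ρ ,, h ρ)) →
               T.Eq (ρ ,, h ρ) (to′ ρ d (from′ ρ d y)) y
    to-from′ ρ (yes _) y = T.Eq-refl (ρ ,, h ρ)
    to-from′ ρ (no ¬c) y = ⊥-elim (¬c (h ρ))

    from-to′ : ∀ {I} (ρ : Γ.Pt I) (d : Dec (map φ ρ ≈ᶠ 1F)) (x : Setoid.Carrier (glueEl D ρ d)) →
               Setoid._≈_ (glueEl D ρ d) (from′ ρ d (to′ ρ d x)) x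
    from-to′ ρ (yes c) x = T.Eq-refl (ρ ,, c)
    from-to′ ρ (no ¬c) x = ⊥-elim (¬c (h ρ))

    to-nat′ : ∀ {I J} {ρ : Γ.Pt I} {ρ′ : Γ.Pt J} (d : Dec (map φ ρ ≈ᶠ 1F)) (d′ : Dec (map φ ρ′ ≈ᶠ 1F))
              (f : Hom J I) (p : ρ′ Γ.≈ ρ Γ.· f) (x : Setoid.Carrier (glueEl D ρ d)) →
              T.Eq (ρ′ ,, h ρ′) (Ty.res (T [ total φ h ]) f p (to′ ρ d x)) (to′ ρ′ d′ (glueRes D d d′ f p x))
    to-nat′ {ρ′ = ρ′} (yes _) (yes _) f p x = T.res-cong ≈ʰ-refl (T.Eq-refl _)
    to-nat′ {ρ = ρ} (no ¬c) _ f p x = ⊥-elim (¬c (h ρ))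
    to-nat′ {ρ′ = ρ′} (yes _) (no ¬c) f p x = ⊥-elim (¬c (h ρ′))

-- Glue(φ , T , A , w)σ = Glue(φσ , Tσ , Aσ , wσ).

module _ {ℓ} {Γ Δ : CSet ℓ} (σ : Δ ⟶ Γ) (D : GlueData Γ) where
  open GlueData D
  private
    module Γ = CSet Γ
    module Δ = CSet Δ
    module T = Ty T
    module A = Ty A
    Dσ = subGlueData σ D
    A′ = restrictTo φ A

    Elσ : ∀ {I} (ρ : Δ.Pt I) → Dec (map φ (map σ ρ) ≈ᶠ 1F) → Set ℓ
    Elσ ρ d = Setoid.Carrier (glueEl D (map σ ρ) d)

    Eqσ : ∀ {I} (ρ : Δ.Pt I) (d : Dec (map φ (map σ ρ) ≈ᶠ 1F)) → Elσ ρ d → Elσ ρ d → Set ℓ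
    Eqσ ρ d = Setoid._≈_ (glueEl D (map σ ρ) d)

    El′ : ∀ {I} (ρ : Δ.Pt I) → Dec (map φ (map σ ρ) ≈ᶠ 1F) → Set ℓ
    El′ ρ d = Setoid.Carrier (glueEl Dσ ρ d)

    Eq′ : ∀ {I} (ρ : Δ.Pt I) (d : Dec (map φ (map σ ρ) ≈ᶠ 1F)) → El′ ρ d → El′ ρ d → Set ℓ
    Eq′ ρ d = Setoid._≈_ (glueEl Dσ ρ d)

    rep : ∀ {I J} (ρ : Δ.Pt I) (f : Hom J I) {ρ″ : Γ.Pt J} → ρ″ Γ.≈ map σ ρ Γ.· f →
          ρ″ Γ.≈ map σ (ρ Δ.· f)
    rep ρ f p = p Γ.⨾ Γ.symm (map-nat σ ρ f)

    one-rep : ∀ {I} {ρ′ ρ″ : Γ.Pt I} → ρ″ Γ.≈ ρ′ → map φ ρ″ ≈ᶠ 1F → map φ ρ′ ≈ᶠ 1F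
    one-rep k c = ≈-trans (≈-sym (map-cong φ k)) c

    to′ : ∀ {I} (ρ : Δ.Pt I) (d : Dec (map φ (map σ ρ) ≈ᶠ 1F)) → Elσ ρ d → El′ ρ d
    to′ ρ (yes _) x = x
    to′ ρ (no _)  x = record
      { sys     = λ f p c → sys x f (map-res σ p) c
      ; sys-nat = λ f g h e {ρ′} {ρ″} p q r c d →
          T.Eq-trans (map σ ρ″ ,, d) (T.res-cong ≈ʰ-refl (T.Eq-refl (map σ ρ′ ,, c)))
            (sys-nat x f g h e (map-res σ p) (map-res σ q) (map-res σ r) c d)
      ; base    = base x
      ; agree   = λ f {ρ′} p c →
          A.Eq-trans (map σ ρ′) (subTm-⟪⟫ T A′ (σ ▸▸ φ) w (ρ′ ,, c) (sys x f (map-res σ p) c))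
            (agree x f (map-res σ p) c)
      }

    from′ : ∀ {I} (ρ : Δ.Pt I) (d : Dec (map φ (map σ ρ) ≈ᶠ 1F)) → El′ ρ d → Elσ ρ d
    from′ ρ (yes _) y = y
    from′ ρ (no _)  y = record
      { sys     = λ f p c → T.cast (rep ρ f p) (sys y f Δ.rfl (one-rep (rep ρ f p) c))
      ; sys-nat = λ f g h e {ρ′} {ρ″} p q r c d →
          T.Eq-trans (ρ″ ,, d)
            (T.exchange {p′ = map-res σ (Δ.split ρ e)} {q′ = rep ρ h r Γ.⨾ Γ.symm (Γ.·-id _)}
              (≈ʰ-trans (∘-idˡ g) (≈ʰ-sym (∘-idʳ g))))
            (T.res-cong ≈ʰ-refl
              (sys-nat y f g h e Δ.rfl (Δ.split ρ e) Δ.rfl (one-rep (rep ρ f p) c) (one-rep (rep ρ h r) d)))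
      ; base    = base y
      ; agree   = λ f {ρ″} p c →
          let k = rep ρ f p
              z = sys y f Δ.rfl (one-rep k c) in
          A.Eq-trans ρ″
            (A.Eq-sym ρ″ (⟪⟫-nat w {ρ = map σ (ρ Δ.· f) ,, (one-rep k c)} {ρ″ ,, c} id (k Γ.⨾ Γ.symm (Γ.·-id _)) z))
          (A.Eq-trans ρ″
            (A.res-cong {p′ = k Γ.⨾ Γ.symm (Γ.·-id _)} ≈ʰ-refl
              (A.Eq-trans (map σ (ρ Δ.· f))
                (A.Eq-sym (map σ (ρ Δ.· f)) (subTm-⟪⟫ T A′ (σ ▸▸ φ) w ((ρ Δ.· f) ,, (one-rep k c)) z))
                (agree y f Δ.rfl (one-rep k c))))
            (A.fuse (≈ʰ-sym (∘-idʳ f))))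
      }

    to-cong′ : ∀ {I} (ρ : Δ.Pt I) (d : Dec (map φ (map σ ρ) ≈ᶠ 1F)) {x y : Elσ ρ d} →
               Eqσ ρ d x y → Eq′ ρ d (to′ ρ d x) (to′ ρ d y)
    to-cong′ ρ (yes _) e = e
    to-cong′ ρ (no _)  (s , e) = (λ f p c → s f (map-res σ p) c) , e

    from-cong′ : ∀ {I} (ρ : Δ.Pt I) (d : Dec (map φ (map σ ρ) ≈ᶠ 1F)) {x y : El′ ρ d} →
                 Eq′ ρ d x y → Eqσ ρ d (from′ ρ d x) (from′ ρ d y)
    from-cong′ ρ (yes _) e = e
    from-cong′ ρ (no _)  (s , e) =
      (λ f p c → T.res-cong ≈ʰ-refl (s f Δ.rfl (one-rep (rep ρ f p) c))) , e

    to-from′ : ∀ {I} (ρ : Δ.Pt I) (d : Dec (map φ (map σ ρ) ≈ᶠ 1F)) (y : El′ ρ d) →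
               Eq′ ρ d (to′ ρ d (from′ ρ d y)) y
    to-from′ ρ (yes c) y = T.Eq-refl (map σ ρ ,, c)
    to-from′ ρ (no _)  y =
      (λ f {ρ′} p c →
        let s = p Δ.⨾ Δ.symm (Δ.·-id (ρ Δ.· f)) in
        T.Eq-trans (map σ ρ′ ,, c)
          (T.res-cong {p′ = map-res σ s} ≈ʰ-refl (T.Eq-refl (map σ (ρ Δ.· f) ,, (one-rep (rep ρ f (map-res σ p)) c))))
          (sys-nat y f id f (≈ʰ-sym (∘-idʳ f)) Δ.rfl s p (one-rep (rep ρ f (map-res σ p)) c) c))
      , A.Eq-refl (map σ ρ)

    from-to′ : ∀ {I} (ρ : Δ.Pt I) (d : Dec (map φ (map σ ρ) ≈ᶠ 1F)) (x : Elσ ρ d) →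
               Eqσ ρ d (from′ ρ d (to′ ρ d x)) x
    from-to′ ρ (yes c) x = T.Eq-refl (map σ ρ ,, c)
    from-to′ ρ (no _)  x =
      (λ f p c → sys-nat x f id f (≈ʰ-sym (∘-idʳ f)) (map-res σ Δ.rfl)
        (rep ρ f p Γ.⨾ Γ.symm (Γ.·-id _)) p (one-rep (rep ρ f p) c) c)
      , A.Eq-refl (map σ ρ)

    to-nat′ : ∀ {I J} {ρ : Δ.Pt I} {ρ′ : Δ.Pt J} (d : Dec (map φ (map σ ρ) ≈ᶠ 1F))
              (d′ : Dec (map φ (map σ ρ′) ≈ᶠ 1F)) (f : Hom J I) (p : ρ′ Δ.≈ ρ Δ.· f) (x : Elσ ρ d) →
              Eq′ ρ′ d′ (glueRes Dσ {ρ = ρ} {ρ′} d d′ f p (to′ ρ d x))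
                        (to′ ρ′ d′ (glueRes D d d′ f (map-res σ p) x))
    to-nat′ {ρ = ρ} {ρ′} (yes c) (yes c′) f p x = T.res-cong ≈ʰ-refl (T.Eq-refl (map σ ρ ,, c))
    to-nat′ (yes c) (no ¬c′) f p x = ⊥-elim (¬c′ (one-res D f (map-res σ p) c))
    to-nat′ {ρ′ = ρ′} (no _) (yes c′) f p x = T.Eq-refl (map σ ρ′ ,, c′)
    to-nat′ {ρ′ = ρ′} (no _) (no _) f p x =
      (λ g q c → sys-hom x (≈ʰ-refl {f = f ∘ g}) (map-res σ (q Δ.⨾ Δ.after f g p))
                   (map-res σ q Γ.⨾ Γ.after f g (map-res σ p)) c)
      , A.Eq-refl (map σ ρ′)

  GlueSub : Glue D [ σ ] ≅ Glue (subGlueData σ D)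
  GlueSub = record
    { to        = λ {_} {ρ} → to′ ρ (isOne? (map φ (map σ ρ)))
    ; from      = λ {_} {ρ} → from′ ρ (isOne? (map φ (map σ ρ)))
    ; to-cong   = λ ρ → to-cong′ ρ (isOne? (map φ (map σ ρ)))
    ; from-cong = λ ρ → from-cong′ ρ (isOne? (map φ (map σ ρ)))
    ; to-from   = λ ρ → to-from′ ρ (isOne? (map φ (map σ ρ)))
    ; from-to   = λ ρ → from-to′ ρ (isOne? (map φ (map σ ρ)))
    ; to-nat    = λ {_} {_} {ρ} {ρ′} f p →
        to-nat′ {ρ = ρ} {ρ′} (isOne? (map φ (map σ ρ))) (isOne? (map φ (map σ ρ′))) f p
    }

{-# OPTIONS --safe #-}

-- Let (ψ , u , g₀) be a composition problem in Glue over the line i.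
-- Composing the A-components gives a₁′.  Over δ = ∀i.φ one can also compose
-- in T, and composing in A with w of the T-filler as an additional side gives
-- a path from w of the result to a₁′.  Over φ(i1) the equivalence structure
-- extends this path, together with the values prescribed on ψ, to an element
-- t₁ of T and a path from w t₁ to a₁′.  Composing a₁′ with this path yields
-- a₁, equal to w t₁ over φ(i1), and the result is glue(t₁ , a₁).  If φ = 1
-- then δ = 1, and t₁ is the composition in T.
--
-- The construction is carried out for sections over an arbitrary context Θ;
-- a single box is the case of a representable Θ.  Stability under restriction
-- is then part of being a section, and there is one naturality statement to
-- prove, for a simultaneous change of context τ : Θ′ ⟶ Θ and of base
-- σ : Δ ⟶ Γ.  With σ = id it says that the composition is natural, with
-- τ = id that it commutes with substitution.

module Submission where

open import Defs
open import Level using (Lift; _⊔_) renaming (lift to up; lower to down)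
open import Data.Bool.Base using (true; false) renaming (_∧_ to _and_; _∨_ to _or_)
open import Data.Empty using (⊥-elim; ⊥-elim-irr)
open import Data.List.Base using (_∷_)
open import Data.List.Membership.Propositional using () renaming (_∈_ to _∈ˡ_)
open import Data.List.Relation.Unary.Any using (here; there)
open import Data.Nat.Base using (suc; _≤_)
open import Data.Nat.ListAction using (sum)
open import Data.Nat.Properties using (_≟_; m≤m+n; m≤n⇒m≤o+n; 1+n≰n)
open import Data.Product.Base using (_×_; Σ-syntax; _,_; proj₁; proj₂)
open import Data.Sum.Base using (_⊎_; inj₁; inj₂)
open import Data.Unit.Base using (⊤; tt)
open import Relation.Binary.Bundles using (Setoid)
open import Relation.Binary.PropositionalEquality using (_≡_; refl; sym; trans; cong₂)
open import Relation.Nullary.Decidable.Core using (Dec; yes; no)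
open import Relation.Nullary.Negation.Core using (¬_)

open Fresh using (name)
open Hom using (img)

-- Names and homomorphisms

-- The obstacle is that the result must have a T-component on all of φ(i1), whereas a composition in
-- `T` needs φ along the whole line. Over δ the composition in `T` exists, and the case φ = 1
-- demands it; elsewhere on φ(i1) only the equivalence structure can produce a point of `T`. Both
-- are accommodated by making δ one of the prescribed faces of the extension problem. A triple
-- requires w t₁ to equal the A-component, not merely to be joined to it by a path; hence the second
-- composition in A. All paths involved are kept constant on ψ, so that the prescribed values
-- survive every step.
--
-- An interval variable is a factor 𝕀 of the context rather than a fresh name. Filling is then a
-- composition in the context Θ × 𝕀, and names are chosen only where `comp`, path types or the face
-- ∀i.φ call for one. Partial sections on two faces are joined by deciding which face holds; this
-- works because 1 is join-prime in the face lattice. That δ is stable under restriction rests on ∀i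
-- commuting with substitution.

opaque
  -- Every member of a list is at most its sum. The choice is not compatible with maps; naturality
  -- of the constructions below comes from `comp` being natural under any change of name.
  freshFor : (J : FinSet) → Fresh J
  freshFor (finSet ns _ _) = fresh (suc (sum ns)) λ m → 1+n≰n (∈⇒≤sum m)
    where
    ∈⇒≤sum : ∀ {k ns} → k ∈ˡ ns → k ≤ sum ns
    ∈⇒≤sum (here refl) = m≤m+n _ _
    ∈⇒≤sum {ns = n ∷ _} (there m) = m≤n⇒m≤o+n n (∈⇒≤sum m)

coord : ∀ {I J} (i : Fresh I) → Hom J (I ▹ i) → DM J
coord {I} i g = img g (name i) (new∈ I i)

-- (f , i = r)
ext : ∀ {I J} → Hom J I → (i : Fresh I) → DM J → Hom J (I ▹ i)
ext {I} {J} f i r = hom λ k m → case k m (k ≟ name i)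
  where
  case : (k : Name) → .(k ∈ I ▹ i) → Dec (k ≡ name i) → DM J
  case k m (yes _)  = r
  case k m (no k≢i) = img f k (old∈⁻ I i m k≢i)

-- Maps into `I ▹ i` form a product of the maps into `I` with the interval, the projections being
-- `deg i` and `coord i`. The equations between `ext`, `lift` and `face` below are checked on these
-- two components.
hom-▹ : ∀ {I J} (i : Fresh I) {g h : Hom J (I ▹ i)} → deg i ∘ g ≈ʰ deg i ∘ h →
        coord i g ≈ᵈ coord i h → g ≈ʰ h
hom-▹ {I} i {g} {h} old new = homEq go
  where
  go : ∀ k .(m : k ∈ I ▹ i) → img g k m ≈ᵈ img h k m
  go k m with k ≟ name i
  ... | yes refl = new
  ... | no k≢i   = img-≈ old k (old∈⁻ I i m k≢i)

deg-ext : ∀ {I J} (f : Hom J I) (i : Fresh I) (r : DM J) → deg i ∘ ext f i r ≈ʰ f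
deg-ext {I} f i@(fresh _ n) r = homEq go
  where
  go : ∀ k .(m : k ∈ I) → img (ext f i r) k (old∈ I i m) ≈ᵈ img f k m
  go k m with k ≟ name i
  ... | yes k≡i = ⊥-elim-irr (old≢new I i m n k≡i)
  ... | no  _   = ≈-refl

coord-ext : ∀ {I J} (f : Hom J I) (i : Fresh I) (r : DM J) → coord i (ext f i r) ≈ᵈ r
coord-ext f i r with name i ≟ name i
... | yes _  = ≈-refl
... | no i≢i = ⊥-elim (i≢i refl)

coord-lift : ∀ {I J} (f : Hom J I) (i : Fresh I) (j : Fresh J) →
             coord i (lift f i j) ≈ᵈ gen (name j) (new∈ J j)
coord-lift f i j with name i ≟ name i
... | yes _  = ≈-refl
... | no i≢i = ⊥-elim (i≢i refl)

deg-∘ : ∀ {I J K} (i : Fresh I) (g : Hom J (I ▹ i)) (h : Hom K J) {f : Hom J I} →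
        deg i ∘ g ≈ʰ f → deg i ∘ (g ∘ h) ≈ʰ f ∘ h
deg-∘ i g h p = ≈ʰ-trans (≈ʰ-sym (∘-assoc (deg i) g h)) (∘-cong p (≈ʰ-refl {f = h}))

deg-lift-∘ : ∀ {I J K} (f : Hom J I) (i : Fresh I) (j : Fresh J) (g : Hom K (J ▹ j)) →
             deg i ∘ (lift f i j ∘ g) ≈ʰ f ∘ (deg j ∘ g)
deg-lift-∘ f i j g = ≈ʰ-trans (deg-∘ i (lift f i j) g (deg-lift f i j)) (∘-assoc f (deg j) g)

ext-cong : ∀ {I J} {f g : Hom J I} (i : Fresh I) {r s : DM J} → f ≈ʰ g → r ≈ᵈ s →
           ext f i r ≈ʰ ext g i s
ext-cong {f = f} {g} i {r} {s} p q = hom-▹ i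
  (≈ʰ-trans (deg-ext f i r) (≈ʰ-trans p (≈ʰ-sym (deg-ext g i s))))
  (≈-trans (coord-ext f i r) (≈-trans q (≈-sym (coord-ext g i s))))

ext-∘ : ∀ {I J K} (f : Hom J I) (i : Fresh I) (r : DM J) (g : Hom K J) →
        ext f i r ∘ g ≈ʰ ext (f ∘ g) i (r ⟨ g ⟩ᵈ)
ext-∘ f i r g = hom-▹ i
  (≈ʰ-trans (deg-∘ i (ext f i r) g (deg-ext f i r)) (≈ʰ-sym (deg-ext (f ∘ g) i (r ⟨ g ⟩ᵈ))))
  (≈-trans (sub-cong g (coord-ext f i r)) (≈-sym (coord-ext (f ∘ g) i (r ⟨ g ⟩ᵈ))))

ext-coord : ∀ {I J} (i : Fresh I) (g : Hom J (I ▹ i)) → g ≈ʰ ext (deg i ∘ g) i (coord i g)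
ext-coord i g = hom-▹ i (≈ʰ-sym (deg-ext (deg i ∘ g) i (coord i g)))
  (≈-sym (coord-ext (deg i ∘ g) i (coord i g)))

lift-ext : ∀ {I J K} (f : Hom J I) (i : Fresh I) (j : Fresh J) (g : Hom K J) (r : DM K) →
           lift f i j ∘ ext g j r ≈ʰ ext (f ∘ g) i r
lift-ext f i j g r = hom-▹ i
  (≈ʰ-trans (deg-lift-∘ f i j (ext g j r))
    (≈ʰ-trans (∘-cong (≈ʰ-refl {f = f}) (deg-ext g j r)) (≈ʰ-sym (deg-ext (f ∘ g) i r))))
  (≈-trans (sub-cong (ext g j r) (coord-lift f i j))
    (≈-trans (coord-ext g j r) (≈-sym (coord-ext (f ∘ g) i r))))

face-∘ : ∀ {I J} (i : Fresh I) b (f : Hom J I) → face i b ∘ f ≈ʰ ext f i (endpoint b)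
face-∘ i b f = hom-▹ i
  (≈ʰ-trans (deg-face-∘ i b f) (≈ʰ-sym (deg-ext f i (endpoint b))))
  (≈-trans (sub-cong f (face-new i b (new∈ _ i)))
    (≈-trans (endpoint-sub b) (≈-sym (coord-ext f i (endpoint b)))))
  where
  endpoint-sub : ∀ b → endpoint b ⟨ f ⟩ᵈ ≈ᵈ endpoint b
  endpoint-sub false = ≈-refl
  endpoint-sub true  = ≈-refl

face-ext : ∀ {I} (i : Fresh I) b → face i b ≈ʰ ext id i (endpoint b)
face-ext i b = ≈ʰ-trans (≈ʰ-sym (∘-idʳ (face i b))) (face-∘ i b id)

-- Derived from the axioms: 1 is ∼∼1, so 1 ∧ ∼0 is ∼(∼1 ∨ 0), which is ∼∼1 again.
∼𝟎 : ∀ {J} → ∼ 𝟎 ≈ᵈ 𝟏 {J}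
∼𝟎 = ≈-trans (≈-sym (∧-identity _)) (≈-trans (∧-cong (≈-sym (∼-invol 𝟏)) ≈-refl)
       (≈-trans (≈-sym (∼-∨ (∼ 𝟏) 𝟎)) (≈-trans (∼-cong (≈-trans (∨-comm _ _) (∨-identity _))) (∼-invol 𝟏))))

∼𝟏 : ∀ {J} → ∼ 𝟏 ≈ᵈ 𝟎 {J}
∼𝟏 = ≈-trans (∼-cong (≈-sym ∼𝟎)) (∼-invol 𝟎)

∧-𝟏 : ∀ {J} (r : DM J) → r ∧ 𝟏 ≈ᵈ r
∧-𝟏 r = ≈-trans (∧-comm r 𝟏) (∧-identity r)

∧-zeroˡ : ∀ {J} (r : DM J) → 𝟎 ∧ r ≈ᵈ 𝟎
∧-zeroˡ r = ≈-trans (∧-cong ≈-refl (≈-sym (∨-identity r))) (∧-absorbs-∨ 𝟎 r)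

∧-zeroʳ : ∀ {J} (r : DM J) → r ∧ 𝟎 ≈ᵈ 𝟎
∧-zeroʳ r = ≈-trans (∧-comm r 𝟎) (∧-zeroˡ r)

∨-oneˡ : ∀ {J} (r : DM J) → 𝟏 ∨ r ≈ᵈ 𝟏
∨-oneˡ r = ≈-trans (∨-cong ≈-refl (≈-sym (∧-identity r))) (∨-absorbs-∧ 𝟏 r)

-- Faces

⊔-oneˡ : ∀ {I} {χ₁ χ₂ : Face I} → χ₁ ≈ᶠ 1F → χ₁ ⊔ᶠ χ₂ ≈ᶠ 1F
⊔-oneˡ p = ≈-trans (⊔-cong p ≈-refl) (⊔-zeroˡ _)

⊔-oneʳ : ∀ {I} {χ₁ χ₂ : Face I} → χ₂ ≈ᶠ 1F → χ₁ ⊔ᶠ χ₂ ≈ᶠ 1F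
⊔-oneʳ p = ≈-trans (⊔-comm _ _) (⊔-oneˡ p)

-- `eval` is a lattice homomorphism to the Booleans that detects 1, and in the Booleans 1 is
-- join-prime.
⊔-one⁻ : ∀ {I} (χ₁ χ₂ : Face I) → χ₁ ⊔ᶠ χ₂ ≈ᶠ 1F → χ₁ ≈ᶠ 1F ⊎ χ₂ ≈ᶠ 1F
⊔-one⁻ χ₁ χ₂ p with eval χ₁ in e₁ | eval χ₂ in e₂ | eval-cong p
... | true  | _    | _ = inj₁ (eval-sound χ₁ e₁)
... | false | true | _ = inj₂ (eval-sound χ₂ e₂)

⊔-oneʳ⁻ : ∀ {I} (χ₁ χ₂ : Face I) → χ₁ ⊔ᶠ χ₂ ≈ᶠ 1F → ¬ χ₁ ≈ᶠ 1F → χ₂ ≈ᶠ 1F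
⊔-oneʳ⁻ χ₁ χ₂ p n with ⊔-one⁻ χ₁ χ₂ p
... | inj₁ p₁ = ⊥-elim (n p₁)
... | inj₂ p₂ = p₂

⊓-one⁻ : ∀ {I} (χ₁ χ₂ : Face I) → χ₁ ⊓ χ₂ ≈ᶠ 1F → χ₁ ≈ᶠ 1F × χ₂ ≈ᶠ 1F
⊓-one⁻ χ₁ χ₂ p with eval χ₁ in e₁ | eval χ₂ in e₂ | eval-cong p
... | true | true | _ = eval-sound χ₁ e₁ , eval-sound χ₂ e₂

-- Induction on `r`: `eval` refutes the hypothesis on a generator, and join-primeness of 1 handles
-- the connectives that become joins of faces. On the face where a coordinate reaches an endpoint,
-- this allows the coordinate to be replaced by that endpoint.
=1-one⁻ : ∀ {I} (r : DM I) → [ r =1] ≈ᶠ 1F → r ≈ᵈ 𝟏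
=0-one⁻ : ∀ {I} (r : DM I) → [ r =0] ≈ᶠ 1F → r ≈ᵈ 𝟎
=1-one⁻ (gen k m) p with () ← eval-cong p
=1-one⁻ 𝟎 p with () ← eval-cong p
=1-one⁻ 𝟏 p = ≈-refl
=1-one⁻ (r ∧ s) p with ⊓-one⁻ [ r =1] [ s =1] p
... | q , q′ = ≈-trans (∧-cong (=1-one⁻ r q) (=1-one⁻ s q′)) (∧-identity 𝟏)
=1-one⁻ (r ∨ s) p with ⊔-one⁻ [ r =1] [ s =1] p
... | inj₁ q = ≈-trans (∨-cong (=1-one⁻ r q) ≈-refl) (∨-oneˡ s)
... | inj₂ q = ≈-trans (∨-comm r s) (≈-trans (∨-cong (=1-one⁻ s q) ≈-refl) (∨-oneˡ r))
=1-one⁻ (∼ r) p = ≈-trans (∼-cong (=0-one⁻ r p)) ∼𝟎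
=0-one⁻ (gen k m) p with () ← eval-cong p
=0-one⁻ 𝟎 p = ≈-refl
=0-one⁻ 𝟏 p with () ← eval-cong p
=0-one⁻ (r ∧ s) p with ⊔-one⁻ [ r =0] [ s =0] p
... | inj₁ q = ≈-trans (∧-cong (=0-one⁻ r q) ≈-refl) (∧-zeroˡ s)
... | inj₂ q = ≈-trans (∧-cong ≈-refl (=0-one⁻ s q)) (∧-zeroʳ r)
=0-one⁻ (r ∨ s) p with ⊓-one⁻ [ r =0] [ s =0] p
... | q , q′ = ≈-trans (∨-cong (=0-one⁻ r q) (=0-one⁻ s q′)) (∨-identity 𝟎)
=0-one⁻ (∼ r) p = ≈-trans (∼-cong (=1-one⁻ r p)) ∼𝟏

-- The right adjoint of φ ↦ φ ⟨ deg i ⟩ᶠ.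

∀ᶠ-gen : ∀ {I} (i : Fresh I) → ((k : Name) → .(k ∈ I) → Face I) →
         (k : Name) → .(k ∈ I ▹ i) → Dec (k ≡ name i) → Face I
∀ᶠ-gen i is k m (yes _)      = 0F
∀ᶠ-gen {I} i is k m (no k≢i) = is k (old∈⁻ I i m k≢i)

∀ᶠ : ∀ {I} (i : Fresh I) → Face (I ▹ i) → Face I
∀ᶠ i (is0 k m) = ∀ᶠ-gen i is0 k m (k ≟ name i)
∀ᶠ i (is1 k m) = ∀ᶠ-gen i is1 k m (k ≟ name i)
∀ᶠ i 0F        = 0F
∀ᶠ i 1F        = 1F
∀ᶠ i (χ ⊓ χ′)  = ∀ᶠ i χ ⊓ ∀ᶠ i χ′
∀ᶠ i (χ ⊔ᶠ χ′) = ∀ᶠ i χ ⊔ᶠ ∀ᶠ i χ′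

-- A quantifier preserving joins is possible because (i = 0) ∨ (i = 1) is not 1 in the face lattice.
-- The one relation between the two generators of `i`, their disjointness, becomes 0 ⊓ 0 = 0.
∀ᶠ-cong : ∀ {I} (i : Fresh I) {χ χ′ : Face (I ▹ i)} → χ ≈ᶠ χ′ → ∀ᶠ i χ ≈ᶠ ∀ᶠ i χ′
∀ᶠ-cong i ≈-refl = ≈-refl
∀ᶠ-cong i (≈-sym p) = ≈-sym (∀ᶠ-cong i p)
∀ᶠ-cong i (≈-trans p q) = ≈-trans (∀ᶠ-cong i p) (∀ᶠ-cong i q)
∀ᶠ-cong i (⊓-cong p q) = ⊓-cong (∀ᶠ-cong i p) (∀ᶠ-cong i q)
∀ᶠ-cong i (⊔-cong p q) = ⊔-cong (∀ᶠ-cong i p) (∀ᶠ-cong i q)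
∀ᶠ-cong i (⊓-assoc φ ψ χ) = ⊓-assoc _ _ _
∀ᶠ-cong i (⊔-assoc φ ψ χ) = ⊔-assoc _ _ _
∀ᶠ-cong i (⊓-comm φ ψ) = ⊓-comm _ _
∀ᶠ-cong i (⊔-comm φ ψ) = ⊔-comm _ _
∀ᶠ-cong i (⊓-absorbs-⊔ φ ψ) = ⊓-absorbs-⊔ _ _
∀ᶠ-cong i (⊔-absorbs-⊓ φ ψ) = ⊔-absorbs-⊓ _ _
∀ᶠ-cong i (⊓-distrib-⊔ φ ψ χ) = ⊓-distrib-⊔ _ _ _
∀ᶠ-cong i (⊔-distrib-⊓ φ ψ χ) = ⊔-distrib-⊓ _ _ _
∀ᶠ-cong i (⊓-identity φ) = ⊓-identity _
∀ᶠ-cong i (⊔-identity φ) = ⊔-identity _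
∀ᶠ-cong i (disjoint k m) with k ≟ name i
... | yes _  = ⊓-zero 0F
... | no k≢i = disjoint k _

-- The generators that `∀ᶠ` replaces by 0 are sent to false by `eval` in any case. Hence `∀ᶠ i χ` is
-- 1 exactly when `χ` is.
eval-∀ᶠ : ∀ {I} (i : Fresh I) (χ : Face (I ▹ i)) → eval (∀ᶠ i χ) ≡ eval χ
eval-∀ᶠ i (is0 k m) with k ≟ name i
... | yes _ = refl
... | no _  = refl
eval-∀ᶠ i (is1 k m) with k ≟ name i
... | yes _ = refl
... | no _  = refl
eval-∀ᶠ i 0F = refl
eval-∀ᶠ i 1F = refl
eval-∀ᶠ i (χ ⊓ χ′) = cong₂ _and_ (eval-∀ᶠ i χ) (eval-∀ᶠ i χ′)
eval-∀ᶠ i (χ ⊔ᶠ χ′) = cong₂ _or_ (eval-∀ᶠ i χ) (eval-∀ᶠ i χ′)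

∀ᶠ-one⁻ : ∀ {I} (i : Fresh I) (χ : Face (I ▹ i)) → ∀ᶠ i χ ≈ᶠ 1F → χ ≈ᶠ 1F
∀ᶠ-one⁻ i χ p = eval-sound χ (trans (sym (eval-∀ᶠ i χ)) (eval-cong p))

∀ᶠ-=1-deg : ∀ {I} (i : Fresh I) (r : DM I) → ∀ᶠ i [ r ⟨ deg i ⟩ᵈ =1] ≈ᶠ [ r =1]
∀ᶠ-=0-deg : ∀ {I} (i : Fresh I) (r : DM I) → ∀ᶠ i [ r ⟨ deg i ⟩ᵈ =0] ≈ᶠ [ r =0]
∀ᶠ-=1-deg {I} i@(fresh _ n) (gen k m) with k ≟ name i
... | yes k≡i = ⊥-elim-irr (old≢new I i m n k≡i)
... | no _    = ≈-refl
∀ᶠ-=1-deg i 𝟎 = ≈-refl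
∀ᶠ-=1-deg i 𝟏 = ≈-refl
∀ᶠ-=1-deg i (r ∧ s) = ⊓-cong (∀ᶠ-=1-deg i r) (∀ᶠ-=1-deg i s)
∀ᶠ-=1-deg i (r ∨ s) = ⊔-cong (∀ᶠ-=1-deg i r) (∀ᶠ-=1-deg i s)
∀ᶠ-=1-deg i (∼ r) = ∀ᶠ-=0-deg i r
∀ᶠ-=0-deg {I} i@(fresh _ n) (gen k m) with k ≟ name i
... | yes k≡i = ⊥-elim-irr (old≢new I i m n k≡i)
... | no _    = ≈-refl
∀ᶠ-=0-deg i 𝟎 = ≈-refl
∀ᶠ-=0-deg i 𝟏 = ≈-refl
∀ᶠ-=0-deg i (r ∧ s) = ⊔-cong (∀ᶠ-=0-deg i r) (∀ᶠ-=0-deg i s)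
∀ᶠ-=0-deg i (r ∨ s) = ⊓-cong (∀ᶠ-=0-deg i r) (∀ᶠ-=0-deg i s)
∀ᶠ-=0-deg i (∼ r) = ∀ᶠ-=1-deg i r

-- The Beck-Chevalley condition, which makes ∀i.φ stable under restriction. A generator of `i`
-- becomes one of `j`, so both sides are 0; the image of any other name does not mention `j` and is
-- left alone.
∀ᶠ-lift : ∀ {I J} (f : Hom J I) (i : Fresh I) (j : Fresh J) (χ : Face (I ▹ i)) →
          ∀ᶠ j (χ ⟨ lift f i j ⟩ᶠ) ≈ᶠ ∀ᶠ i χ ⟨ f ⟩ᶠ
∀ᶠ-lift f i j (is0 k m) with k ≟ name i
... | no k≢i = ∀ᶠ-=0-deg j (img f k _)
... | yes _ with name j ≟ name j
...   | yes _  = ≈-refl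
...   | no j≢j = ⊥-elim (j≢j refl)
∀ᶠ-lift f i j (is1 k m) with k ≟ name i
... | no k≢i = ∀ᶠ-=1-deg j (img f k _)
... | yes _ with name j ≟ name j
...   | yes _  = ≈-refl
...   | no j≢j = ⊥-elim (j≢j refl)
∀ᶠ-lift f i j 0F = ≈-refl
∀ᶠ-lift f i j 1F = ≈-refl
∀ᶠ-lift f i j (χ ⊓ χ′) = ⊓-cong (∀ᶠ-lift f i j χ) (∀ᶠ-lift f i j χ′)
∀ᶠ-lift f i j (χ ⊔ᶠ χ′) = ⊔-cong (∀ᶠ-lift f i j χ) (∀ᶠ-lift f i j χ′)

-- Elements over different points

-- y is the restriction xf.  Carrying along the proof that ρ′ is ρf makes
-- elements over equal points comparable without mentioning such proofs.
record Rel {ℓ ℓ′} {Γ : CSet ℓ} (A : Ty Γ ℓ′) {I J} {ρ : CSet.Pt Γ I} {ρ′ : CSet.Pt Γ J}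
           (f : Hom J I) (x : Ty.El A ρ) (y : Ty.El A ρ′) : Set (ℓ ⊔ ℓ′) where
  constructor rel
  field
    over  : CSet._≈_ Γ ρ′ (CSet._·_ Γ ρ f)
    equal : Ty.Eq A ρ′ (Ty.res A f over x) y

open Rel public

module _ {ℓ ℓ′} {Γ : CSet ℓ} {A : Ty Γ ℓ′} where
  private
    module Γ = CSet Γ
    module A = Ty A

  res-rel : ∀ {I J} {ρ : Γ.Pt I} {ρ′ : Γ.Pt J} {f : Hom J I} {p : ρ′ Γ.≈ ρ Γ.· f} {x : A.El ρ} →
            Rel A f x (A.res f p x)
  res-rel {ρ′ = ρ′} {p = p} = rel p (A.Eq-refl ρ′)

  cast-rel : ∀ {I} {ρ ρ′ : Γ.Pt I} {k : ρ′ Γ.≈ ρ} {x : A.El ρ} → Rel A id x (A.cast k x)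
  cast-rel = res-rel

  rel-eq : ∀ {I J} {ρ : Γ.Pt I} {ρ′ : Γ.Pt J} {f : Hom J I} {x : A.El ρ} {y : A.El ρ′} →
           Rel A f x y → (p : ρ′ Γ.≈ ρ Γ.· f) → A.Eq ρ′ (A.res f p x) y
  rel-eq {ρ′ = ρ′} r p = A.Eq-trans ρ′ (A.res-cong ≈ʰ-refl (A.Eq-refl _)) (equal r)

  rel-id-eq : ∀ {I} {ρ : Γ.Pt I} {x y : A.El ρ} → Rel A id x y → A.Eq ρ x y
  rel-id-eq {ρ = ρ} {x} r =
    A.Eq-trans ρ (A.Eq-sym ρ (A.res-id {p = Γ.symm (Γ.·-id ρ)} x)) (rel-eq r (Γ.symm (Γ.·-id ρ)))

  eq-rel : ∀ {I} {ρ : Γ.Pt I} {x y : A.El ρ} → A.Eq ρ x y → Rel A id x y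
  eq-rel {ρ = ρ} {x} e = rel (Γ.symm (Γ.·-id ρ)) (A.Eq-trans ρ (A.res-id x) e)

  rel-trans : ∀ {I J K} {ρ : Γ.Pt I} {ρ′ : Γ.Pt J} {ρ″ : Γ.Pt K} {f : Hom J I} {g : Hom K J}
              {h : Hom K I} {x : A.El ρ} {y : A.El ρ′} {z : A.El ρ″} → h ≈ʰ f ∘ g →
              Rel A f x y → Rel A g y z → Rel A h x z
  rel-trans {ρ″ = ρ″} {f} {g} e r s = rel
    (over s Γ.⨾ Γ.after f g (over r) Γ.⨾ Γ.·-cong Γ.rfl (≈ʰ-sym e))
    (A.Eq-trans ρ″ (A.Eq-sym ρ″ (A.fuse {p = over r} {q = over s} e))
      (A.Eq-trans ρ″ (A.res-cong ≈ʰ-refl (equal r)) (equal s)))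

  -- Since `y` is already `x` restricted along `f`, restricting `y` along `g` gives what `x` gives
  -- along `f ∘ g`. Two restrictions of one element are thereby related to each other; symmetry is
  -- the case of identities.
  rel-div : ∀ {I J K} {ρ : Γ.Pt I} {ρ′ : Γ.Pt J} {ρ″ : Γ.Pt K} {f : Hom J I} {g : Hom K J}
            {h : Hom K I} {x : A.El ρ} {y : A.El ρ′} {z : A.El ρ″} → h ≈ʰ f ∘ g →
            Rel A f x y → Rel A h x z → Rel A g y z
  rel-div {ρ = ρ} {ρ″ = ρ″} {f} {g} e r s = rel q
    (A.Eq-trans ρ″ (A.res-cong {p′ = q} ≈ʰ-refl (A.Eq-sym _ (equal r)))
      (A.Eq-trans ρ″ (A.fuse {p = over r} {q = q} {r = over s} e) (equal s)))
    where
    q = over s Γ.⨾ Γ.split ρ e Γ.⨾ Γ.·-cong (Γ.symm (over r)) ≈ʰ-refl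

  rel-sym : ∀ {I} {ρ ρ′ : Γ.Pt I} {x : A.El ρ} {y : A.El ρ′} → Rel A id x y → Rel A id y x
  rel-sym {ρ = ρ} r = rel-div (≈ʰ-sym (∘-idˡ id)) r (eq-rel (A.Eq-refl ρ))

  infixr 5 _◅_ _▻_ _⊙_

  _⊙_ : ∀ {I} {ρ ρ′ ρ″ : Γ.Pt I} {x : A.El ρ} {y : A.El ρ′} {z : A.El ρ″} →
        Rel A id x y → Rel A id y z → Rel A id x z
  _⊙_ = rel-trans (≈ʰ-sym (∘-idˡ id))

  _◅_ : ∀ {I J} {ρ ρ′ : Γ.Pt I} {ρ″ : Γ.Pt J} {f : Hom J I} {x : A.El ρ} {y : A.El ρ′} {z : A.El ρ″} →
        Rel A id x y → Rel A f y z → Rel A f x z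
  _◅_ {f = f} = rel-trans (≈ʰ-sym (∘-idˡ f))

  _▻_ : ∀ {I J} {ρ : Γ.Pt I} {ρ′ ρ″ : Γ.Pt J} {f : Hom J I} {x : A.El ρ} {y : A.El ρ′} {z : A.El ρ″} →
        Rel A f x y → Rel A id y z → Rel A f x z
  _▻_ {f = f} = rel-trans (≈ʰ-sym (∘-idʳ f))

-- Sections

infixl 20 _×𝕀

_×𝕀 : ∀ {ℓ} → CSet ℓ → CSet ℓ
Θ ×𝕀 = record
  { pt = λ I → record
      { Carrier = Θ.Pt I × DM I
      ; _≈_ = λ (θ , r) (θ′ , r′) → (θ Θ.≈ θ′) × (r ≈ᵈ r′)
      ; isEquivalence = record
          { refl  = Θ.rfl , ≈-refl
          ; sym   = λ (p , q) → Θ.symm p , ≈-sym q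
          ; trans = λ (p , q) (p′ , q′) → (p Θ.⨾ p′) , ≈-trans q q′
          }
      }
  ; _·_    = λ (θ , r) f → θ Θ.· f , r ⟨ f ⟩ᵈ
  ; ·-cong = λ {_} {_} {_} {x} {f} (p , q) e → Θ.·-cong p e , ≈-trans (sub-cong f q) (sub-hom (proj₂ x) e)
  ; ·-id   = λ (θ , r) → Θ.·-id θ , sub-id r
  ; ·-∘    = λ (θ , r) f g → Θ.·-∘ θ f g , sub-∘ r f g
  }
  where module Θ = CSet Θ

-- Partial sections: natural families along κ, defined on the sieve Q of Θ.
record Sec {ℓ ℓ′ ℓ″} {Γ : CSet ℓ} (Θ : CSet ℓ″) (Q : ∀ {I} → CSet.Pt Θ I → Set) (A : Ty Γ ℓ′)
           (κ : ∀ {I} (θ : CSet.Pt Θ I) → .(Q θ) → CSet.Pt Γ I) : Set (ℓ ⊔ ℓ′ ⊔ ℓ″) where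
  no-eta-equality
  private
    module Θ = CSet Θ
  field
    val : ∀ {I} (θ : Θ.Pt I) .(c : Q θ) → Ty.El A (κ θ c)
    nat : ∀ {I J} (f : Hom J I) {θ : Θ.Pt I} {θ′ : Θ.Pt J} → θ′ Θ.≈ θ Θ.· f → .(c : Q θ) .(c′ : Q θ′) →
          Rel A f (val θ c) (val θ′ c′)

  val-cong : ∀ {I} {θ θ′ : Θ.Pt I} → θ Θ.≈ θ′ → .(c : Q θ) .(c′ : Q θ′) → Rel A id (val θ c) (val θ′ c′)
  val-cong {θ = θ} p = nat id (Θ.symm (Θ.·-id θ Θ.⨾ p))

open Sec public

module _ {ℓ} {Γ Θ Ξ : CSet ℓ} {A : Ty Γ ℓ} where
  private
    module Γ = CSet Γ
    module Θ = CSet Θ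
    module Ξ = CSet Ξ
    module A = Ty A

  module _ {Q : ∀ {I} → Θ.Pt I → Set} {κ : ∀ {I} (θ : Θ.Pt I) → .(Q θ) → Γ.Pt I}
           {R : ∀ {I} → Ξ.Pt I → Set} {μ : ∀ {I} (x : Ξ.Pt I) → .(R x) → Γ.Pt I}
           (s : Sec Θ Q A κ) (h : ∀ {I} → Ξ.Pt I → Θ.Pt I)
           (h-res : ∀ {I J} (f : Hom J I) {x : Ξ.Pt I} {y : Ξ.Pt J} → y Ξ.≈ x Ξ.· f → h y Θ.≈ h x Θ.· f)
           (hQ : ∀ {I} (x : Ξ.Pt I) → R x → Q (h x))
           (k : ∀ {I} (x : Ξ.Pt I) .(c : R x) → μ x c Γ.≈ κ (h x) (hQ x c)) where
    opaque

      -- The section x ↦ s (h x), up to equality of points of Γ.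
      pull : Sec Ξ R A μ
      pull = record
        { val = λ x c → A.cast (k x c) (val s (h x) (hQ x c))
        ; nat = λ f {x} {y} p c d →
            rel-sym cast-rel ◅ nat s f (h-res f p) (hQ x c) (hQ y d) ▻ cast-rel
        }

      pull-rel : ∀ {I} (x : Ξ.Pt I) .(c : R x) → Rel A id (val s (h x) (hQ x c)) (val pull x c)
      pull-rel x c = cast-rel

module _ {ℓ} {Γ Ξ : CSet ℓ} {A : Ty Γ ℓ} {Q : ∀ {I} → CSet.Pt Ξ I → Set}
         {κ : ∀ {I} (x : CSet.Pt Ξ I) → .(Q x) → CSet.Pt Γ I}
         (χ₁ χ₂ : ∀ {I} → CSet.Pt Ξ I → Face I) where
  private
    module Ξ = CSet Ξ
    module A = Ty A

  Part : (∀ {I} → Ξ.Pt I → Face I) → Set ℓ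
  Part χ = Sec Ξ (λ x → Q x × χ x ≈ᶠ 1F) A (λ x c → κ x (proj₁ c))

  module _ (s₁ : Part χ₁) (s₂ : Part χ₂) where

    -- Where both faces hold the first section is preferred; the hypothesis `agrees` below makes the
    -- preference immaterial.
    joinVal : ∀ {I} (x : Ξ.Pt I) .(c : Q x × χ₁ x ⊔ᶠ χ₂ x ≈ᶠ 1F) → Dec (χ₁ x ≈ᶠ 1F) → A.El (κ x (proj₁ c))
    joinVal x c (yes p) = val s₁ x (proj₁ c , p)
    joinVal x c (no ¬p) = val s₂ x (proj₁ c , ⊔-oneʳ⁻ (χ₁ x) (χ₂ x) (proj₂ c) ¬p)

    joinVal-l : ∀ {I} (x : Ξ.Pt I) .(c : Q x × χ₁ x ⊔ᶠ χ₂ x ≈ᶠ 1F) (d : Dec (χ₁ x ≈ᶠ 1F))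
                .(p : Q x × χ₁ x ≈ᶠ 1F) → Rel A id (joinVal x c d) (val s₁ x p)
    joinVal-l x c (yes _) p = eq-rel (A.Eq-refl _)
    joinVal-l x c (no ¬p) p = ⊥-elim-irr (¬p (proj₂ p))

    module _ (agrees : ∀ {I} (x : Ξ.Pt I) .(c : Q x) .(p : χ₁ x ≈ᶠ 1F) .(q : χ₂ x ≈ᶠ 1F) →
                       Rel A id (val s₁ x (c , p)) (val s₂ x (c , q)))
             (χ₁-res : ∀ {I J} (f : Hom J I) {x : Ξ.Pt I} {y : Ξ.Pt J} → y Ξ.≈ x Ξ.· f → χ₁ y ≈ᶠ χ₁ x ⟨ f ⟩ᶠ)
             (χ₂-res : ∀ {I J} (f : Hom J I) {x : Ξ.Pt I} {y : Ξ.Pt J} → y Ξ.≈ x Ξ.· f → χ₂ y ≈ᶠ χ₂ x ⟨ f ⟩ᶠ) where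

      joinVal-r : ∀ {I} (x : Ξ.Pt I) .(c : Q x × χ₁ x ⊔ᶠ χ₂ x ≈ᶠ 1F) (d : Dec (χ₁ x ≈ᶠ 1F))
                  .(p : Q x × χ₂ x ≈ᶠ 1F) → Rel A id (joinVal x c d) (val s₂ x p)
      joinVal-r x c (yes q) p = agrees x (proj₁ c) q (proj₂ p)
      joinVal-r x c (no _)  p = eq-rel (A.Eq-refl _)

      opaque
        join : Sec Ξ (λ x → Q x × χ₁ x ⊔ᶠ χ₂ x ≈ᶠ 1F) A (λ x c → κ x (proj₁ c))
        join = record
          { val = λ x c → joinVal x c (isOne? (χ₁ x))
          ; nat = λ f {x} {y} p c c′ → go f p c c′ (isOne? (χ₁ x))
          }
          where
          go : ∀ {I J} (f : Hom J I) {x : Ξ.Pt I} {y : Ξ.Pt J} → y Ξ.≈ x Ξ.· f →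
               .(c : Q x × χ₁ x ⊔ᶠ χ₂ x ≈ᶠ 1F) .(c′ : Q y × χ₁ y ⊔ᶠ χ₂ y ≈ᶠ 1F) (d : Dec (χ₁ x ≈ᶠ 1F)) →
               Rel A f (joinVal x c d) (joinVal y c′ (isOne? (χ₁ y)))
          go f {x} {y} e c c′ (yes p) =
            nat s₁ f e (proj₁ c , p) (proj₁ c′ , p′) ▻ rel-sym (joinVal-l y c′ (isOne? (χ₁ y)) (proj₁ c′ , p′))
            where
            p′ : χ₁ y ≈ᶠ 1F
            p′ = ≈-trans (χ₁-res f e) (one-sub f p)
          -- The first face may become 1 under `f` although it is not 1 at `x`. The value at `y`
          -- then comes from the other section, and `joinVal-r` passes between the two by `agrees`.
          go f {x} {y} e c c′ (no ¬p) =
            nat s₂ f e (proj₁ c , p c) (proj₁ c′ , p′ c) ▻ rel-sym (joinVal-r y c′ (isOne? (χ₁ y)) (proj₁ c′ , p′ c))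
            where
            p : Q x × χ₁ x ⊔ᶠ χ₂ x ≈ᶠ 1F → χ₂ x ≈ᶠ 1F
            p c = ⊔-oneʳ⁻ (χ₁ x) (χ₂ x) (proj₂ c) ¬p
            p′ : Q x × χ₁ x ⊔ᶠ χ₂ x ≈ᶠ 1F → χ₂ y ≈ᶠ 1F
            p′ c = ≈-trans (χ₂-res f e) (one-sub f (p c))

        join-l : ∀ {I} (x : Ξ.Pt I) .(c : Q x × χ₁ x ⊔ᶠ χ₂ x ≈ᶠ 1F) .(p : Q x × χ₁ x ≈ᶠ 1F) →
                 Rel A id (val join x c) (val s₁ x p)
        join-l x c = joinVal-l x c (isOne? (χ₁ x))

        join-r : ∀ {I} (x : Ξ.Pt I) .(c : Q x × χ₁ x ⊔ᶠ χ₂ x ≈ᶠ 1F) .(p : Q x × χ₂ x ≈ᶠ 1F) →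
                 Rel A id (val join x c) (val s₂ x p)
        join-r x c = joinVal-r x c (isOne? (χ₁ x))

-- The proof of the join is irrelevant and cannot be inspected, so the case is found by deciding the
-- first face.
⊔-elim : ∀ {ℓ} {I} (χ₁ χ₂ : Face I) {P : Set ℓ} → .(χ₁ ⊔ᶠ χ₂ ≈ᶠ 1F) →
         (.(χ₁ ≈ᶠ 1F) → P) → (.(χ₂ ≈ᶠ 1F) → P) → P
⊔-elim χ₁ χ₂ c f g with isOne? χ₁
... | yes p = f p
... | no ¬p = g (⊔-oneʳ⁻ χ₁ χ₂ c ¬p)

-- Composition problems in context Θ restricted to Q

record Prob {ℓ} {Γ : CSet ℓ} (A : Ty Γ ℓ) (Θ : CSet ℓ) (Q : ∀ {I} → CSet.Pt Θ I → Set) : Set ℓ where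
  no-eta-equality
  private
    module Γ = CSet Γ
    module Θ = CSet Θ
    module Θ𝕀 = CSet (Θ ×𝕀)
  field
    cl     : ∀ {I J} (f : Hom J I) {θ : Θ.Pt I} {θ′ : Θ.Pt J} → θ′ Θ.≈ θ Θ.· f → Q θ → Q θ′
    ln     : ∀ {I} (x : Θ𝕀.Pt I) → .(Q (proj₁ x)) → Γ.Pt I
    ln-res : ∀ {I J} (f : Hom J I) {x : Θ𝕀.Pt I} {x′ : Θ𝕀.Pt J} → x′ Θ𝕀.≈ x Θ𝕀.· f →
             .(c : Q (proj₁ x)) .(c′ : Q (proj₁ x′)) → ln x′ c′ Γ.≈ ln x c Γ.· f
    χ      : ∀ {I} → Θ.Pt I → Face I
    χ-res  : ∀ {I J} (f : Hom J I) {θ : Θ.Pt I} {θ′ : Θ.Pt J} → θ′ Θ.≈ θ Θ.· f → χ θ′ ≈ᶠ χ θ ⟨ f ⟩ᶠ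
    side   : Sec (Θ ×𝕀) (λ x → Q (proj₁ x) × χ (proj₁ x) ≈ᶠ 1F) A (λ x c → ln x (proj₁ c))
    init   : Sec Θ Q A (λ θ → ln (θ , 𝟎))
    agr    : ∀ {I} (θ : Θ.Pt I) .(c : Q θ) .(d : χ θ ≈ᶠ 1F) →
             Rel A id (val init θ c) (val side (θ , 𝟎) (c , d))

  χ-one : ∀ {I J} (f : Hom J I) {θ : Θ.Pt I} {θ′ : Θ.Pt J} → θ′ Θ.≈ θ Θ.· f → χ θ ⟨ f ⟩ᶠ ≈ᶠ 1F → χ θ′ ≈ᶠ 1F
  χ-one f e p = ≈-trans (χ-res f e) p

new : ∀ {I} (i : Fresh I) → DM (I ▹ i)
new {I} i = gen (name i) (new∈ I i)

module _ {ℓ} {Γ : CSet ℓ} {A : Ty Γ ℓ} {Θ : CSet ℓ} {Q : ∀ {I} → CSet.Pt Θ I → Set} (P : Prob A Θ Q) where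
  private
    module Γ = CSet Γ
    module Θ = CSet Θ
    module Θ𝕀 = CSet (Θ ×𝕀)
    module A = Ty A
  open Prob P

  ln-cong : ∀ {I} {x x′ : Θ𝕀.Pt I} → x Θ𝕀.≈ x′ → .(c : Q (proj₁ x)) .(c′ : Q (proj₁ x′)) → ln x c Γ.≈ ln x′ c′
  ln-cong {x′ = x′} e c c′ = ln-res id (e Θ𝕀.⨾ Θ𝕀.symm (Θ𝕀.·-id x′)) c′ c Γ.⨾ Γ.·-id _

  cl-deg : ∀ {I J} (i : Fresh I) (g : Hom J (I ▹ i)) (θ : Θ.Pt I) → Q θ → Q (θ Θ.· (deg i ∘ g))
  cl-deg i g θ = cl (deg i ∘ g) Θ.rfl

  χ-deg : ∀ {I J} (i : Fresh I) (g : Hom J (I ▹ i)) (θ : Θ.Pt I) →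
          χ θ ⟨ deg i ⟩ᶠ ⟨ g ⟩ᶠ ≈ᶠ 1F → χ (θ Θ.· (deg i ∘ g)) ≈ᶠ 1F
  χ-deg i g θ p = χ-one (deg i ∘ g) Θ.rfl (≈-trans (≈-sym (subᶠ-∘ (χ θ) (deg i) g)) p)

  -- The universal point of the line over `θ`: restricting it along `ext id i r` gives `(θ , r)`.
  -- Applying `ln` to it turns the line into a point of `Γ` over `I ▹ i`, the form that `comp`
  -- expects.
  generic : ∀ {I} (i : Fresh I) (θ : Θ.Pt I) → Θ𝕀.Pt (I ▹ i)
  generic i θ = θ Θ.· deg i , new i

  generic-∘ : ∀ {I J} (i : Fresh I) (g : Hom J (I ▹ i)) (θ : Θ.Pt I) →
              (θ Θ.· (deg i ∘ g) , coord i g) Θ𝕀.≈ generic i θ Θ𝕀.· g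
  generic-∘ i g θ = Θ.symm (Θ.·-∘ θ (deg i) g) , ≈-refl

  generic-face : ∀ {I} (i : Fresh I) b (θ : Θ.Pt I) → (θ , endpoint b) Θ𝕀.≈ generic i θ Θ𝕀.· face i b
  generic-face i b θ = Θ.section θ (deg-face i b) , ≈-sym (face-new i b (new∈ _ i))

  -- C is the box that P determines at θ, with fresh name i.
  record Rep {I} (θ : Θ.Pt I) .(c : Q θ) (i : Fresh I) (ρ : Γ.Pt (I ▹ i)) (C : Box A i ρ) : Set ℓ where
    field
      point≈ : ρ Γ.≈ ln (generic i θ) (cl (deg i) Θ.rfl c)
      face≈  : Box.ψ C ≈ᶠ χ θ
      side≈  : ∀ {J} (g : Hom J (I ▹ i)) {ρ′ : Γ.Pt J} (q : ρ′ Γ.≈ ρ Γ.· g) .(d : Box.ψ C ⟨ deg i ⟩ᶠ ⟨ g ⟩ᶠ ≈ᶠ 1F)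
               .(e : χ (θ Θ.· (deg i ∘ g)) ≈ᶠ 1F) →
               Rel A id (at (u C) g q d) (val side (θ Θ.· (deg i ∘ g) , coord i g) (cl-deg i g θ c , e))
      init≈  : Rel A id (a₀ C) (val init θ c)

  -- Both boxes are read off the same sections, so the equations of `BoxRes` are the naturality of
  -- `χ`, `side` and `init`. The names `i` and `j` are arbitrary.
  rep-res : ∀ {I J} {f : Hom J I} {θ : Θ.Pt I} {θ′ : Θ.Pt J} → θ′ Θ.≈ θ Θ.· f → .(c : Q θ) .(c′ : Q θ′) →
            {i : Fresh I} {j : Fresh J} {ρ : Γ.Pt (I ▹ i)} {ρ′ : Γ.Pt (J ▹ j)} {C : Box A i ρ} {C′ : Box A j ρ′} →
            Rep θ c i ρ C → Rep θ′ c′ j ρ′ C′ → (p : ρ′ Γ.≈ ρ Γ.· lift f i j) → BoxRes A f p C C′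
  rep-res {f = f} {θ} {θ′} e c c′ {i} {j} {ρ} {ρ′} {C} {C′} R R′ p = record
    { ψ-res  = ≈-trans (Rep.face≈ R′) (≈-trans (χ-res f e) (subᶠ-cong f (≈-sym (Rep.face≈ R))))
    ; u-res  = λ g q r d d′ → rel-id-eq
        ( Rep.side≈ R (lift f i j ∘ g) r d (χ-deg i (lift f i j ∘ g) θ (≈-trans (subᶠ-cong (lift f i j ∘ g) (subᶠ-cong (deg i) (≈-sym (Rep.face≈ R)))) d))
        ⊙ val-cong side (points g)
            (cl-deg i (lift f i j ∘ g) θ c , χ-deg i (lift f i j ∘ g) θ (≈-trans (subᶠ-cong (lift f i j ∘ g) (subᶠ-cong (deg i) (≈-sym (Rep.face≈ R)))) d))
            (cl-deg j g θ′ c′ , χ-deg j g θ′ (≈-trans (subᶠ-cong g (subᶠ-cong (deg j) (≈-sym (Rep.face≈ R′)))) d′))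
        ⊙ rel-sym (Rep.side≈ R′ g q d′ (χ-deg j g θ′ (≈-trans (subᶠ-cong g (subᶠ-cong (deg j) (≈-sym (Rep.face≈ R′)))) d′))))
    ; a₀-res = rel-eq (Rep.init≈ R ◅ nat init f e c c′ ▻ rel-sym (Rep.init≈ R′)) _
    }
    where
    points : ∀ {K} (g : Hom K _) → (θ Θ.· (deg i ∘ (lift f i j ∘ g)) , coord i (lift f i j ∘ g)) Θ𝕀.≈
                                   (θ′ Θ.· (deg j ∘ g) , coord j g)
    points g = (Θ.·-cong Θ.rfl (deg-lift-∘ f i j g) Θ.⨾ Θ.symm (Θ.after f (deg j ∘ g) e))
             , sub-cong g (coord-lift f i j)

  opaque
    rep-box : ∀ {I} (i : Fresh I) (θ : Θ.Pt I) .(c : Q θ) → Box A i (ln (generic i θ) (cl (deg i) Θ.rfl c))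
    rep-box i θ c = record
      { ψ        = χ θ
      ; u        = record
          { at     = λ g p d → A.cast (k g p) (val side (θ Θ.· (deg i ∘ g) , coord i g) (cl-deg i g θ c , χ-deg i g θ d))
          ; at-nat = λ f g h e p q r d d′ → rel-eq
              ( rel-sym cast-rel
              ◅ nat side g (Θ.split θ (≈ʰ-trans (∘-cong (≈ʰ-refl {f = deg i}) e) (≈ʰ-sym (∘-assoc (deg i) f g)))
                           , img-≈ e (name i) (new∈ _ i))
                  (cl-deg i f θ c , χ-deg i f θ d) (cl-deg i h θ c , χ-deg i h θ d′)
              ▻ cast-rel) q
          }
      ; a₀       = A.cast k₀ (val init θ c)
      ; a₀-agree = λ f {ρ′} p q d → rel-eq
          ( rel-sym cast-rel
          ◅ nat init f Θ.rfl c (cl f Θ.rfl c)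
          ▻ agr (θ Θ.· f) (cl f Θ.rfl c) (χ-one f Θ.rfl d)
          ⊙ val-cong side (Θ.·-cong Θ.rfl (≈ʰ-sym (deg-face-∘ i false f)) , ≈-sym (sub-cong f (face-new i false (new∈ _ i))))
              (cl f Θ.rfl c , χ-one f Θ.rfl d)
              (cl-deg i (face i false ∘ f) θ c , χ-deg i (face i false ∘ f) θ (one-deg (χ θ) i false f d))
          ⊙ cast-rel) p
      }
      where
      k : ∀ {J} (g : Hom J _) {ρ′ : Γ.Pt J} → ρ′ Γ.≈ ln (generic i θ) (cl (deg i) Θ.rfl c) Γ.· g →
          ρ′ Γ.≈ ln (θ Θ.· (deg i ∘ g) , coord i g) (cl-deg i g θ c)
      k g p = p Γ.⨾ Γ.symm (ln-res g (generic-∘ i g θ) (cl (deg i) Θ.rfl c) (cl-deg i g θ c))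

      k₀ : ln (generic i θ) (cl (deg i) Θ.rfl c) Γ.· face i false Γ.≈ ln (θ , 𝟎) c
      k₀ = Γ.symm (ln-res (face i false) (generic-face i false θ) (cl (deg i) Θ.rfl c) c)

    rep-box-rep : ∀ {I} (i : Fresh I) (θ : Θ.Pt I) .(c : Q θ) → Rep θ c i _ (rep-box i θ c)
    rep-box-rep i θ c = record
      { point≈ = Γ.rfl
      ; face≈  = ≈-refl
      ; side≈  = λ g q d e → rel-sym cast-rel
      ; init≈  = rel-sym cast-rel
      }

  module _ (cA : Comp A) where

    rep-comp : ∀ {I J} (f : Hom J I) {θ : Θ.Pt I} {θ′ : Θ.Pt J} → θ′ Θ.≈ θ Θ.· f → .(c : Q θ) .(c′ : Q θ′) →
               {i : Fresh I} {j : Fresh J} {ρ : Γ.Pt (I ▹ i)} {ρ′ : Γ.Pt (J ▹ j)} {C : Box A i ρ} {C′ : Box A j ρ′} →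
               Rep θ c i ρ C → Rep θ′ c′ j ρ′ C′ → Rel A f (comp cA i ρ C) (comp cA j ρ′ C′)
    rep-comp f {θ} {θ′} e c c′ {i} {j} {C = C} {C′} R R′ =
      rel _ (comp-nat cA f p C C′ (rep-res e c c′ R R′ p))
      where
      p = Rep.point≈ R′
        Γ.⨾ ln-res (lift f i j) (Θ.square e (≈ʰ-sym (deg-lift f i j)) , ≈-sym (coord-lift f i j))
              (cl (deg i) Θ.rfl c) (cl (deg j) Θ.rfl c′)
        Γ.⨾ Γ.·-cong (Γ.symm (Rep.point≈ R)) ≈ʰ-refl

    opaque
      -- The names chosen at the two ends of a map are unrelated, but `rep-comp` relates the
      -- composites for any two names, and this is the naturality of the section.
      gcomp : Sec Θ Q A (λ θ → ln (θ , 𝟏))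
      gcomp = record
        { val = λ {I} θ c →
            A.cast (ln-res (face (freshFor I) true) (generic-face (freshFor I) true θ) (cl (deg (freshFor I)) Θ.rfl c) c)
              (comp cA (freshFor I) _ (rep-box (freshFor I) θ c))
        ; nat = λ f {θ} {θ′} e c c′ →
            rel-sym cast-rel ◅ rep-comp f e c c′ (rep-box-rep (freshFor _) θ c) (rep-box-rep (freshFor _) θ′ c′) ▻ cast-rel
        }

      gcomp-comp : ∀ {I} (θ : Θ.Pt I) .(c : Q θ) →
                   Rel A id (comp cA (freshFor I) _ (rep-box (freshFor I) θ c)) (val gcomp θ c)
      gcomp-comp θ c = cast-rel

    -- Any box that represents the problem computes `gcomp`, whatever its name and its point over
    -- `I ▹ i`. This is the way in for boxes that arise by substitution or are given from outside.
    gcomp-rep : ∀ {I} {θ : Θ.Pt I} .(c : Q θ) {i : Fresh I} {ρ : Γ.Pt (I ▹ i)} {C : Box A i ρ} →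
                Rep θ c i ρ C → Rel A id (comp cA i ρ C) (val gcomp θ c)
    gcomp-rep {θ = θ} c R =
      rep-comp id (Θ.symm (Θ.·-id θ)) c c R (rep-box-rep (freshFor _) θ c) ⊙ gcomp-comp θ c

    gcomp-side : ∀ {I} (θ : Θ.Pt I) .(c : Q θ) .(d : χ θ ≈ᶠ 1F) →
                 Rel A id (val gcomp θ c) (val side (θ , 𝟏) (c , d))
    gcomp-side {I} θ c d =
      rel-sym (gcomp-comp θ c)
      ⊙ eq-rel (comp-one cA i _ (rep-box i θ c) (≈-trans (Rep.face≈ R) d))
      ⊙ Rep.side≈ R (face i true) Γ.rfl
          (one-sub (face i true) (one-sub (deg i) (≈-trans (Rep.face≈ R) d)))
          (χ-deg i (face i true) θ (one-sub (face i true) (one-sub (deg i) d)))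
      ⊙ val-cong side
          ((Θ.·-cong Θ.rfl (deg-face i true) Θ.⨾ Θ.·-id θ) , face-new i true (new∈ _ i))
          (cl-deg i (face i true) θ c , χ-deg i (face i true) θ (one-sub (face i true) (one-sub (deg i) d)))
          (c , d)
      where
      i = freshFor I
      R = rep-box-rep i θ c

-- Change of context and base for compositions.

idᶜ : ∀ {ℓ} {Γ : CSet ℓ} → Γ ⟶ Γ
idᶜ {Γ = Γ} = record { map = λ ρ → ρ ; map-cong = λ p → p ; map-nat = λ ρ f → CSet.rfl Γ }

rel-sub : ∀ {ℓ ℓ₁ ℓ′} {Γ : CSet ℓ} {Δ : CSet ℓ₁} (A : Ty Γ ℓ′) (σ : Δ ⟶ Γ) {I J} {ρ : CSet.Pt Δ I} {ρ′ : CSet.Pt Δ J}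
          {f : Hom J I} {x : Ty.El A (map σ ρ)} {y : Ty.El A (map σ ρ′)} →
          Rel (A [ σ ]) {ρ = ρ} {ρ′} f x y → Rel A f x y
rel-sub A σ r = rel (map-res σ (over r)) (equal r)

subComp-rel : ∀ {ℓ ℓ₁ ℓ′} {Γ : CSet ℓ} {Δ : CSet ℓ₁} (A : Ty Γ ℓ′) (σ : Δ ⟶ Γ) (cA : Comp A) {I} {i : Fresh I}
              {ρ : CSet.Pt Δ (I ▹ i)} (B : Box (A [ σ ]) i ρ) →
              Rel A id (comp cA i (map σ ρ) (subBox A σ B)) (comp (subComp A σ cA) i ρ B)
subComp-rel A σ cA B = cast-rel

rel-unsub : ∀ {ℓ ℓ₁ ℓ′} {Γ : CSet ℓ} {Δ : CSet ℓ₁} (A : Ty Γ ℓ′) (σ : Δ ⟶ Γ) {I J} {ρ : CSet.Pt Δ I} {ρ′ : CSet.Pt Δ J}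
            {f : Hom J I} {x : Ty.El A (map σ ρ)} {y : Ty.El A (map σ ρ′)} → CSet._≈_ Δ ρ′ (CSet._·_ Δ ρ f) →
            Rel A f x y → Rel (A [ σ ]) {ρ = ρ} {ρ′} f x y
rel-unsub A σ p r = rel p (rel-eq r (map-res σ p))

-- `A [ idᶜ ]` has the elements of `A`, but its restrictions carry a different proof of the same
-- equation between points, so the two types are not definitionally equal.
rel-sub-idᶜ : ∀ {ℓ ℓ′} {Γ : CSet ℓ} {A : Ty Γ ℓ′} {I J} {ρ : CSet.Pt Γ I} {ρ′ : CSet.Pt Γ J}
          {f : Hom J I} {x : Ty.El A ρ} {y : Ty.El A ρ′} →
          Rel A f x y → Rel (A [ idᶜ ]) {ρ = ρ} {ρ′} f x y
rel-sub-idᶜ r = rel (over r) (rel-eq r _)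

sec-idᶜ : ∀ {ℓ} {Γ Θ : CSet ℓ} {A : Ty Γ ℓ} {Q : ∀ {I} → CSet.Pt Θ I → Set}
         {κ : ∀ {I} (θ : CSet.Pt Θ I) → .(Q θ) → CSet.Pt Γ I} → Sec Θ Q A κ → Sec Θ Q (A [ idᶜ ]) κ
sec-idᶜ s .val = val s
sec-idᶜ s .nat f e c c′ = rel-sub-idᶜ (nat s f e c c′)

prob-idᶜ : ∀ {ℓ} {Γ Θ : CSet ℓ} {A : Ty Γ ℓ} {Q : ∀ {I} → CSet.Pt Θ I → Set} → Prob A Θ Q → Prob (A [ idᶜ ]) Θ Q
prob-idᶜ P .Prob.cl     = Prob.cl P
prob-idᶜ P .Prob.ln     = Prob.ln P
prob-idᶜ P .Prob.ln-res = Prob.ln-res P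
prob-idᶜ P .Prob.χ      = Prob.χ P
prob-idᶜ P .Prob.χ-res  = Prob.χ-res P
prob-idᶜ P .Prob.side   = sec-idᶜ (Prob.side P)
prob-idᶜ P .Prob.init   = sec-idᶜ (Prob.init P)
prob-idᶜ P .Prob.agr θ c d = rel-sub-idᶜ (Prob.agr P θ c d)

module _ {ℓ} {Γ : CSet ℓ} {A : Ty Γ ℓ} {Θ : CSet ℓ} {Q : ∀ {I} → CSet.Pt Θ I → Set} (P : Prob A Θ Q)
         {Θ′ : CSet ℓ} (τ : Θ′ ⟶ Θ) {Δ : CSet ℓ} (σ : Δ ⟶ Γ) {Q′ : ∀ {I} → CSet.Pt Θ′ I → Set}
         (P′ : Prob (A [ σ ]) Θ′ Q′) where
  private
    module Γ = CSet Γ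
    module Δ = CSet Δ
    module Θ = CSet Θ
    module Θ′ = CSet Θ′
    module P = Prob P
    module P′ = Prob P′

  -- P′ is the pullback of P along τ.
  record Match : Set ℓ where
    field
      ln-match   : ∀ {I} (θ : Θ′.Pt I) (r : DM I) .(c : Q (map τ θ)) .(c′ : Q′ θ) →
                   map σ (P′.ln (θ , r) c′) Γ.≈ P.ln (map τ θ , r) c
      χ-match    : ∀ {I} (θ : Θ′.Pt I) → P′.χ θ ≈ᶠ P.χ (map τ θ)
      side-match : ∀ {I} (θ : Θ′.Pt I) (r : DM I) .(c : Q (map τ θ)) .(c′ : Q′ θ)
                   .(d : P.χ (map τ θ) ≈ᶠ 1F) .(d′ : P′.χ θ ≈ᶠ 1F) →
                   Rel A id (val P.side (map τ θ , r) (c , d)) (val P′.side (θ , r) (c′ , d′))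
      init-match : ∀ {I} (θ : Θ′.Pt I) .(c : Q (map τ θ)) .(c′ : Q′ θ) →
                   Rel A id (val P.init (map τ θ) c) (val P′.init θ c′)

  module _ (M : Match) where
    open Match M

    match-rep : ∀ {I} (i : Fresh I) (θ : Θ′.Pt I) .(c : Q (map τ θ)) .(c′ : Q′ θ) →
                Rep P (map τ θ) c i _ (subBox A σ (rep-box P′ i θ c′))
    match-rep {I} i θ c c′ = record
      { point≈ = ln-match (θ Θ′.· deg i) (new i) (cτ (deg i) c) (P′.cl (deg i) Θ′.rfl c′)
                 Γ.⨾ P.ln-res id (Θ.symm (Θ.·-id _ Θ.⨾ Θ.symm (map-nat τ θ (deg i))) , ≈-sym (sub-id (new i)))
                       (P.cl (deg i) Θ.rfl c) (cτ (deg i) c)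
                 Γ.⨾ Γ.·-id _
      ; face≈  = ≈-trans (Rep.face≈ (rep-box-rep P′ i θ c′)) (χ-match θ)
      ; side≈  = λ g q d e →
          let d′ : Box.ψ (rep-box P′ i θ c′) ⟨ deg i ⟩ᶠ ⟨ g ⟩ᶠ ≈ᶠ 1F → P′.χ (θ Θ′.· (deg i ∘ g)) ≈ᶠ 1F
              d′ d = χ-deg P′ i g θ (≈-trans (subᶠ-cong g (subᶠ-cong (deg i) (≈-sym (Rep.face≈ (rep-box-rep P′ i θ c′))))) d)
              e′ : Box.ψ (rep-box P′ i θ c′) ⟨ deg i ⟩ᶠ ⟨ g ⟩ᶠ ≈ᶠ 1F → P.χ (map τ (θ Θ′.· (deg i ∘ g))) ≈ᶠ 1F
              e′ d = ≈-trans (≈-sym (χ-match (θ Θ′.· (deg i ∘ g)))) (d′ d)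
          in rel-sym cast-rel
             ⊙ rel-sub A σ (Rep.side≈ (rep-box-rep P′ i θ c′) g Δ.rfl d (d′ d))
             ⊙ rel-sym (side-match (θ Θ′.· (deg i ∘ g)) (coord i g) (cτ (deg i ∘ g) c) (cl-deg P′ i g θ c′) (e′ d) (d′ d))
             ⊙ val-cong P.side (map-nat τ θ (deg i ∘ g) , ≈-refl) (cτ (deg i ∘ g) c , e′ d) (cl-deg P i g (map τ θ) c , e)
      ; init≈  = rel-sym cast-rel ⊙ rel-sub A σ (Rep.init≈ (rep-box-rep P′ i θ c′)) ⊙ rel-sym (init-match θ c c′)
      }
      where
      cτ : ∀ {J} (f : Hom J I) → Q (map τ θ) → Q (map τ (θ Θ′.· f))
      cτ f = P.cl f (map-nat τ θ f)

    -- `subComp` composes the substituted box in `A`. By `match-rep` that box represents `P` at the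
    -- image of `θ`, and boxes representing the same problem have the same composite.
    gcomp-match : (cA : Comp A) → ∀ {I} (θ : Θ′.Pt I) .(c : Q (map τ θ)) .(c′ : Q′ θ) →
                  Rel A id (val (gcomp P cA) (map τ θ) c) (val (gcomp P′ (subComp A σ cA)) θ c′)
    gcomp-match cA θ c c′ =
      rel-sym (gcomp-rep P cA c (match-rep (freshFor _) θ c c′))
      ⊙ subComp-rel A σ cA (rep-box P′ (freshFor _) θ c′)
      ⊙ rel-sub A σ (gcomp-comp P′ (subComp A σ cA) θ c′)

module _ {ℓ} {Γ : CSet ℓ} {A : Ty Γ ℓ} {Θ : CSet ℓ} {Q : ∀ {I} → CSet.Pt Θ I → Set} (P : Prob A Θ Q) where
  private
    module Γ = CSet Γ

  match-idᶜ : Match P idᶜ idᶜ (prob-idᶜ P)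
  match-idᶜ = record
    { ln-match   = λ θ r c c′ → Γ.rfl
    ; χ-match    = λ θ → ≈-refl
    ; side-match = λ θ r c c′ d d′ → eq-rel (Ty.Eq-refl A _)
    ; init-match = λ θ c c′ → eq-rel (Ty.Eq-refl A _)
    }

module _ {ℓ} {Γ : CSet ℓ} {A : Ty Γ ℓ} (cA : Comp A) {Θ : CSet ℓ} {Q : ∀ {I} → CSet.Pt Θ I → Set} (P : Prob A Θ Q)
         {Θ′ : CSet ℓ} (τ : Θ′ ⟶ Θ) {Q′ : ∀ {I} → CSet.Pt Θ′ I → Set} (P′ : Prob A Θ′ Q′)
         (M : Match P τ idᶜ (prob-idᶜ P′)) where

  -- Both sides are compared with the pullback of P′ along the identity.
  gcomp-sub : ∀ {I} (θ : CSet.Pt Θ′ I) .(c : Q (map τ θ)) .(c′ : Q′ θ) →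
              Rel A id (val (gcomp P cA) (map τ θ) c) (val (gcomp P′ cA) θ c′)
  gcomp-sub θ c c′ =
    gcomp-match P τ idᶜ (prob-idᶜ P′) M cA θ c c′
    ⊙ rel-sym (gcomp-match P′ idᶜ idᶜ (prob-idᶜ P′) (match-idᶜ P′) cA θ c′ c′)

-- Filling, and the comparison of a filler with the composition.

one-recompute : ∀ {I} (χ : Face I) → .(χ ≈ᶠ 1F) → χ ≈ᶠ 1F
one-recompute χ c with isOne? χ
... | yes p = p
... | no ¬p = ⊥-elim-irr (¬p c)

_×𝕀ᶜ : ∀ {ℓ} {Θ′ Θ : CSet ℓ} → Θ′ ⟶ Θ → (Θ′ ×𝕀) ⟶ (Θ ×𝕀)
τ ×𝕀ᶜ = record
  { map      = λ (θ , r) → map τ θ , r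
  ; map-cong = λ (p , q) → map-cong τ p , q
  ; map-nat  = λ (θ , r) f → map-nat τ θ f , ≈-refl
  }

at𝟏 : ∀ {ℓ} {Θ : CSet ℓ} → Θ ⟶ (Θ ×𝕀)
at𝟏 {Θ = Θ} = record
  { map      = λ θ → θ , 𝟏
  ; map-cong = λ p → p , ≈-refl
  ; map-nat  = λ θ f → CSet.rfl Θ , ≈-refl
  }

-- A family of maps ι r : 𝕀 → 𝕀 fixing 0, with ι 1 the identity.
record Contraction : Set where
  field
    ι     : ∀ {I} → DM I → DM I → DM I
    ι-res : ∀ {I J} (f : Hom J I) {r s : DM I} {r′ s′ : DM J} → r′ ≈ᵈ r ⟨ f ⟩ᵈ → s′ ≈ᵈ s ⟨ f ⟩ᵈ →
            ι r′ s′ ≈ᵈ ι r s ⟨ f ⟩ᵈ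
    ι-𝟎   : ∀ {I} (r : DM I) → ι r 𝟎 ≈ᵈ 𝟎
    ι-𝟏   : ∀ {I} (s : DM I) → ι 𝟏 s ≈ᵈ s

module _ (κ : Contraction) {ℓ} {Γ : CSet ℓ} {A : Ty Γ ℓ} {Θ : CSet ℓ} {Q : ∀ {I} → CSet.Pt Θ I → Set} (P : Prob A Θ Q) where
  open Contraction κ
  private
    module Γ = CSet Γ
    module Θ = CSet Θ
    module Θ𝕀 = CSet (Θ ×𝕀)
    module Θ𝕀𝕀 = CSet (Θ ×𝕀 ×𝕀)
  open Prob P

  contract : ∀ {I} → Θ𝕀𝕀.Pt I → Θ𝕀.Pt I
  contract ((θ , r) , s) = θ , ι r s

  End : Set ℓ
  End = Sec (Θ ×𝕀 ×𝕀) (λ x → Q (proj₁ (proj₁ x)) × [ proj₂ (proj₁ x) =0] ≈ᶠ 1F) A (λ x c → ln (contract x) (proj₁ c))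

  Extends : End → Set ℓ
  Extends e =
    (∀ {I} (θ : Θ.Pt I) (r s : DM I) .(c : Q θ) .(d : χ θ ≈ᶠ 1F) .(d′ : [ r =0] ≈ᶠ 1F) →
      Rel A id (val side (θ , ι r s) (c , d)) (val e ((θ , r) , s) (c , d′)))
    × (∀ {I} (θ : Θ.Pt I) (r : DM I) .(c : Q θ) .(d′ : [ r =0] ≈ᶠ 1F) →
      Rel A id (val init θ c) (val e ((θ , r) , 𝟎) (c , d′)))

  module _ (e : End) (ext-e : Extends e) where

    private
      χ₁ χ₂ : ∀ {I} → Θ𝕀𝕀.Pt I → Face I
      χ₁ x = χ (proj₁ (proj₁ x))
      χ₂ x = [ proj₂ (proj₁ x) =0]

      r=0-res : ∀ {I J} (f : Hom J I) (r : DM I) {r′ : DM J} → r′ ≈ᵈ r ⟨ f ⟩ᵈ → [ r′ =0] ≈ᶠ [ r =0] ⟨ f ⟩ᶠ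
      r=0-res f r q = ≈-trans (=0-cong q) (≈-sym (=0-sub r f))

      s₁ : Sec (Θ ×𝕀 ×𝕀) (λ x → Q (proj₁ (proj₁ x)) × χ₁ x ≈ᶠ 1F) A (λ x c → ln (contract x) (proj₁ c))
      s₁ = pull side contract (λ f ((p , q) , q′) → p , ι-res f q q′) (λ x c → c) (λ x c → Γ.rfl)

      sides : ∀ {I} (x : Θ𝕀𝕀.Pt I) .(c : Q (proj₁ (proj₁ x))) .(p : χ₁ x ≈ᶠ 1F) .(q : χ₂ x ≈ᶠ 1F) →
              Rel A id (val s₁ x (c , p)) (val e x (c , q))
      sides x@((θ , r) , s) c p q = rel-sym (pull-rel _ _ _ _ _ x (c , p)) ⊙ proj₁ ext-e θ r s c p q

    opaque
      sideᶜ : Sec (Θ ×𝕀 ×𝕀) (λ x → Q (proj₁ (proj₁ x)) × χ₁ x ⊔ᶠ χ₂ x ≈ᶠ 1F) A (λ x c → ln (contract x) (proj₁ c))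
      sideᶜ = join χ₁ χ₂ s₁ e sides (λ f ((p , _) , _) → χ-res f p) (λ f {x} ((_ , q) , _) → r=0-res f (proj₂ (proj₁ x)) q)

      initᶜ : Sec (Θ ×𝕀) (λ x → Q (proj₁ x)) A (λ x → ln (contract (x , 𝟎)))
      initᶜ = pull init proj₁ (λ f p → proj₁ p) (λ x c → c) (λ (θ , r) c → ln-cong P (Θ.rfl , ι-𝟎 r) c c)

      init-contract : ∀ {I} (θ : Θ.Pt I) (r : DM I) .(c : Q θ) → Rel A id (val init θ c) (val initᶜ (θ , r) c)
      init-contract θ r c = pull-rel _ _ _ _ _ (θ , r) c

      contract-l : ∀ {I} (θ : Θ.Pt I) (r s : DM I) .(c : Q θ) .(d : χ θ ⊔ᶠ [ r =0] ≈ᶠ 1F) .(p : χ θ ≈ᶠ 1F) →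
                   Rel A id (val sideᶜ ((θ , r) , s) (c , d)) (val side (θ , ι r s) (c , p))
      contract-l θ r s c d p = join-l χ₁ χ₂ s₁ e sides _ _ ((θ , r) , s) (c , d) (c , p) ⊙ rel-sym (pull-rel _ _ _ _ _ ((θ , r) , s) (c , p))

      contract-r : ∀ {I} (θ : Θ.Pt I) (r s : DM I) .(c : Q θ) .(d : χ θ ⊔ᶠ [ r =0] ≈ᶠ 1F) .(p : [ r =0] ≈ᶠ 1F) →
                   Rel A id (val sideᶜ ((θ , r) , s) (c , d)) (val e ((θ , r) , s) (c , p))
      contract-r θ r s c d p = join-r χ₁ χ₂ s₁ e sides _ _ ((θ , r) , s) (c , d) (c , p)

    -- At r = 1 the face (r = 0) is empty and `ι` is the identity, so this is `P`; at r = 0 the side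
    -- `e` is defined everywhere. Composing in the context Θ × 𝕀 therefore joins the end of `e` to
    -- the composite of `P`. Filling and the comparison of fillers are the instances `minC` and
    -- `constC`.
    contractProb : Prob A (Θ ×𝕀) (λ x → Q (proj₁ x))
    contractProb .Prob.cl f (p , _) = cl f p
    contractProb .Prob.ln x = ln (contract x)
    contractProb .Prob.ln-res f ((p , q) , q′) = ln-res f (p , ι-res f q q′)
    contractProb .Prob.χ (θ , r) = χ θ ⊔ᶠ [ r =0]
    contractProb .Prob.χ-res f {_ , r} (p , q) = ⊔-cong (χ-res f p) (r=0-res f r q)
    contractProb .Prob.side = sideᶜ
    contractProb .Prob.init = initᶜ
    contractProb .Prob.agr (θ , r) c d = rel-sym (init-contract θ r c) ⊙ ⊔-elim (χ θ) [ r =0] d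
      (λ p → agr θ c p ⊙ val-cong side (Θ.rfl , ≈-sym (ι-𝟎 r)) (c , p) (c , p) ⊙ rel-sym (contract-l θ r 𝟎 c d p))
      (λ p → proj₂ ext-e θ r c p ⊙ rel-sym (contract-r θ r 𝟎 c d p))

    module _ (cA : Comp A) where

      contraction : Sec (Θ ×𝕀) (λ x → Q (proj₁ x)) A (λ (θ , r) → ln (θ , ι r 𝟏))
      contraction = gcomp contractProb cA

      contraction-𝟎 : ∀ {I} (θ : Θ.Pt I) .(c : Q θ) →
                      Rel A id (val contraction (θ , 𝟎) c) (val e ((θ , 𝟎) , 𝟏) (c , ≈-refl))
      contraction-𝟎 θ c = gcomp-side contractProb cA (θ , 𝟎) c (⊔-oneʳ ≈-refl) ⊙ contract-r θ 𝟎 𝟏 c (⊔-oneʳ ≈-refl) ≈-refl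

      contraction-side : ∀ {I} (θ : Θ.Pt I) (r : DM I) .(c : Q θ) .(d : χ θ ≈ᶠ 1F) →
                         Rel A id (val contraction (θ , r) c) (val side (θ , ι r 𝟏) (c , d))
      contraction-side θ r c d = gcomp-side contractProb cA (θ , r) c (⊔-oneˡ d) ⊙ contract-l θ r 𝟏 c (⊔-oneˡ d) d

      contraction-𝟏 : ∀ {I} (θ : Θ.Pt I) .(c : Q θ) →
                      Rel A id (val contraction (θ , 𝟏) c) (val (gcomp P cA) θ c)
      contraction-𝟏 θ c = gcomp-sub cA contractProb at𝟏 P M θ c c
        where
        M : Match contractProb at𝟏 idᶜ (prob-idᶜ P)
        M = record
          { ln-match   = λ θ r c c′ → ln-cong P (Θ.rfl , ≈-sym (ι-𝟏 r)) c′ c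
          ; χ-match    = λ θ → ≈-sym (≈-trans (⊔-comm _ _) (⊔-identity _))
          ; side-match = λ θ r c c′ d d′ →
              contract-l θ 𝟏 r c d d′ ⊙ val-cong side (Θ.rfl , ι-𝟏 r) (c , d′) (c′ , d′)
          ; init-match = λ θ c c′ → rel-sym (init-contract θ 𝟏 c)
          }

module _ (κ : Contraction) {ℓ} {Γ : CSet ℓ} {A : Ty Γ ℓ} (cA : Comp A) {Θ : CSet ℓ} {Q : ∀ {I} → CSet.Pt Θ I → Set}
         (P : Prob A Θ Q) {Θ′ : CSet ℓ} (τ : Θ′ ⟶ Θ) {Δ : CSet ℓ} (σ : Δ ⟶ Γ) {Q′ : ∀ {I} → CSet.Pt Θ′ I → Set}
         (P′ : Prob (A [ σ ]) Θ′ Q′) (M : Match P τ σ P′)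
         (e : End κ P) (E : Extends κ P e) (e′ : End κ P′) (E′ : Extends κ P′ e′) where
  open Contraction κ
  private
    module Θ′ = CSet Θ′
    module P′ = Prob P′
  open Match M

  contraction-match :
    (∀ {I} (θ : Θ′.Pt I) (r s : DM I) .(c : Q (map τ θ)) .(c′ : Q′ θ) .(d : [ r =0] ≈ᶠ 1F) →
      Rel A id (val e ((map τ θ , r) , s) (c , d)) (val e′ ((θ , r) , s) (c′ , d))) →
    ∀ {I} (θ : Θ′.Pt I) (r : DM I) .(c : Q (map τ θ)) .(c′ : Q′ θ) →
    Rel A id (val (contraction κ P e E cA) (map τ θ , r) c) (val (contraction κ P′ e′ E′ (subComp A σ cA)) (θ , r) c′)
  contraction-match m θ r c c′ = gcomp-match (contractProb κ P e E) (τ ×𝕀ᶜ) σ (contractProb κ P′ e′ E′) N cA (θ , r) c c′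
    where
    N : Match (contractProb κ P e E) (τ ×𝕀ᶜ) σ (contractProb κ P′ e′ E′)
    N = record
      { ln-match   = λ (θ , r) s → ln-match θ (ι r s)
      ; χ-match    = λ (θ , r) → ⊔-cong (χ-match θ) ≈-refl
      ; side-match = λ (θ , r) s c c′ d d′ → ⊔-elim (P′.χ θ) [ r =0] d′
          (λ p → contract-l κ P e E (map τ θ) r s c d (≈-trans (≈-sym (χ-match θ)) p)
                 ⊙ side-match θ (ι r s) c c′ (≈-trans (≈-sym (χ-match θ)) p) p
                 ⊙ rel-sub A σ (rel-sym (contract-l κ P′ e′ E′ θ r s c′ d′ p)))
          (λ p → contract-r κ P e E (map τ θ) r s c d p
                 ⊙ m θ r s c c′ p
                 ⊙ rel-sub A σ (rel-sym (contract-r κ P′ e′ E′ θ r s c′ d′ p)))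
      ; init-match = λ (θ , r) c c′ →
          rel-sym (init-contract κ P e E (map τ θ) r c) ⊙ init-match θ c c′ ⊙ rel-sub A σ (init-contract κ P′ e′ E′ θ r c′)
      }

-- The connection: the line s ↦ r ∧ s stops at r, so composing along it yields the Kan filler.
minC : Contraction
minC = record
  { ι     = _∧_
  ; ι-res = λ f p q → ∧-cong p q
  ; ι-𝟎   = ∧-zeroʳ
  ; ι-𝟏   = ∧-identity
  }

-- The line is not shortened, so that composing yields a path inside the fibre over 1.
constC : Contraction
constC = record
  { ι     = λ r s → s
  ; ι-res = λ f p q → q
  ; ι-𝟎   = λ r → ≈-refl
  ; ι-𝟏   = λ s → ≈-refl
  }

module _ {ℓ} {Γ : CSet ℓ} {A : Ty Γ ℓ} {Θ : CSet ℓ} {Q : ∀ {I} → CSet.Pt Θ I → Set} (P : Prob A Θ Q) where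
  private
    module Γ = CSet Γ
    module Θ = CSet Θ
  open Prob P

  opaque
    -- Over (r = 0) the line s ↦ r ∧ s is constant at 0, so `init` itself can serve as a constant
    -- side.
    fillEnd : End minC P
    fillEnd = pull init (λ x → proj₁ (proj₁ x)) (λ f p → proj₁ (proj₁ p)) (λ x c → proj₁ c)
      (λ ((θ , r) , s) c → ln-cong P
        (Θ.rfl , ≈-trans (∧-cong (=0-one⁻ r (one-recompute [ r =0] (proj₂ c))) ≈-refl) (∧-zeroˡ s)) (proj₁ c) (proj₁ c))

    fillEnd-init : ∀ {I} (θ : Θ.Pt I) (r s : DM I) .(c : Q θ) .(d : [ r =0] ≈ᶠ 1F) →
                   Rel A id (val init θ c) (val fillEnd ((θ , r) , s) (c , d))
    fillEnd-init θ r s c d = pull-rel _ _ _ _ _ ((θ , r) , s) (c , d)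

    fillExt : Extends minC P fillEnd
    fillExt =
      (λ θ r s c d d′ →
        val-cong side (Θ.rfl , ≈-trans (∧-cong (=0-one⁻ r (one-recompute [ r =0] d′)) ≈-refl) (∧-zeroˡ s)) (c , d) (c , d)
        ⊙ rel-sym (agr θ c d) ⊙ fillEnd-init θ r s c d′)
      , (λ θ r c d′ → fillEnd-init θ r 𝟎 c d′)

  module _ (cA : Comp A) where
    opaque
      fill : Sec (Θ ×𝕀) (λ x → Q (proj₁ x)) A ln
      fill = pull (contraction minC P fillEnd fillExt cA) (λ x → x) (λ f p → p) (λ x c → c)
        (λ (θ , r) c → ln-cong P (Θ.rfl , ≈-sym (∧-𝟏 r)) c c)

      fill-rel : ∀ {I} (θ : Θ.Pt I) (r : DM I) .(c : Q θ) →
                 Rel A id (val (contraction minC P fillEnd fillExt cA) (θ , r) c) (val fill (θ , r) c)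
      fill-rel θ r c = pull-rel _ _ _ _ _ (θ , r) c

    fill-𝟎 : ∀ {I} (θ : Θ.Pt I) .(c : Q θ) → Rel A id (val init θ c) (val fill (θ , 𝟎) c)
    fill-𝟎 θ c = fillEnd-init θ 𝟎 𝟏 c ≈-refl ⊙ rel-sym (contraction-𝟎 minC P fillEnd fillExt cA θ c) ⊙ fill-rel θ 𝟎 c

    fill-side : ∀ {I} (θ : Θ.Pt I) (r : DM I) .(c : Q θ) .(d : χ θ ≈ᶠ 1F) →
                Rel A id (val side (θ , r) (c , d)) (val fill (θ , r) c)
    fill-side θ r c d = val-cong side (Θ.rfl , ≈-sym (∧-𝟏 r)) (c , d) (c , d)
      ⊙ rel-sym (contraction-side minC P fillEnd fillExt cA θ r c d) ⊙ fill-rel θ r c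

    fill-𝟏 : ∀ {I} (θ : Θ.Pt I) .(c : Q θ) → Rel A id (val fill (θ , 𝟏) c) (val (gcomp P cA) θ c)
    fill-𝟏 θ c = rel-sym (fill-rel θ 𝟏 c) ⊙ contraction-𝟏 minC P fillEnd fillExt cA θ c

  record Filler : Set ℓ where
    no-eta-equality
    field
      filler : Sec (Θ ×𝕀) (λ x → Q (proj₁ x)) A ln
      at-𝟎   : ∀ {I} (θ : Θ.Pt I) .(c : Q θ) → Rel A id (val init θ c) (val filler (θ , 𝟎) c)
      at-side : ∀ {I} (θ : Θ.Pt I) (r : DM I) .(c : Q θ) .(d : χ θ ≈ᶠ 1F) →
                Rel A id (val side (θ , r) (c , d)) (val filler (θ , r) c)

  -- Any filler v gives a path from v 1 to the composition.
  module _ (V : Filler) where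
    open Filler V renaming (filler to v; at-𝟎 to v-𝟎; at-side to v-side)

    opaque
      uniqEnd : End constC P
      uniqEnd = pull v (contract constC P) (λ f ((p , _) , q) → p , q) (λ x c → proj₁ c) (λ x c → Γ.rfl)

      uniqEnd-rel : ∀ {I} (θ : Θ.Pt I) (r s : DM I) .(c : Q θ) .(d : [ r =0] ≈ᶠ 1F) →
                    Rel A id (val v (θ , s) c) (val uniqEnd ((θ , r) , s) (c , d))
      uniqEnd-rel θ r s c d = pull-rel _ _ _ _ _ ((θ , r) , s) (c , d)

      uniqExt : Extends constC P uniqEnd
      uniqExt = (λ θ r s c d d′ → v-side θ s c d ⊙ uniqEnd-rel θ r s c d′)
              , (λ θ r c d′ → v-𝟎 θ c ⊙ uniqEnd-rel θ r 𝟎 c d′)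

    module _ (cA : Comp A) where

      uniq : Sec (Θ ×𝕀) (λ x → Q (proj₁ x)) A (λ x → ln (proj₁ x , 𝟏))
      uniq = contraction constC P uniqEnd uniqExt cA

      uniq-𝟎 : ∀ {I} (θ : Θ.Pt I) .(c : Q θ) → Rel A id (val uniq (θ , 𝟎) c) (val v (θ , 𝟏) c)
      uniq-𝟎 θ c = contraction-𝟎 constC P uniqEnd uniqExt cA θ c ⊙ rel-sym (uniqEnd-rel θ 𝟎 𝟏 c ≈-refl)

      uniq-𝟏 : ∀ {I} (θ : Θ.Pt I) .(c : Q θ) → Rel A id (val uniq (θ , 𝟏) c) (val (gcomp P cA) θ c)
      uniq-𝟏 = contraction-𝟏 constC P uniqEnd uniqExt cA

      uniq-side : ∀ {I} (θ : Θ.Pt I) (r : DM I) .(c : Q θ) .(d : χ θ ≈ᶠ 1F) →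
                  Rel A id (val uniq (θ , r) c) (val side (θ , 𝟏) (c , d))
      uniq-side = contraction-side constC P uniqEnd uniqExt cA

module _ {ℓ} {Γ : CSet ℓ} {A : Ty Γ ℓ} {Θ : CSet ℓ} {Q : ∀ {I} → CSet.Pt Θ I → Set} (P : Prob A Θ Q)
         {Θ′ : CSet ℓ} (τ : Θ′ ⟶ Θ) {Δ : CSet ℓ} (σ : Δ ⟶ Γ) {Q′ : ∀ {I} → CSet.Pt Θ′ I → Set}
         (P′ : Prob (A [ σ ]) Θ′ Q′) (M : Match P τ σ P′) (cA : Comp A) where
  private
    module Θ′ = CSet Θ′
  open Match M

  fill-match : ∀ {I} (θ : Θ′.Pt I) (r : DM I) .(c : Q (map τ θ)) .(c′ : Q′ θ) →
               Rel A id (val (fill P cA) (map τ θ , r) c) (val (fill P′ (subComp A σ cA)) (θ , r) c′)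
  fill-match θ r c c′ =
    rel-sym (fill-rel P cA (map τ θ) r c)
    ⊙ contraction-match minC cA P τ σ P′ M (fillEnd P) (fillExt P) (fillEnd P′) (fillExt P′)
        (λ θ r s c c′ d → rel-sym (fillEnd-init P (map τ θ) r s c d) ⊙ init-match θ c c′ ⊙ rel-sub A σ (fillEnd-init P′ θ r s c′ d))
        θ r c c′
    ⊙ rel-sub A σ (fill-rel P′ (subComp A σ cA) θ r c′)

  uniq-match : (V : Filler P) (V′ : Filler P′) →
    (∀ {I} (θ : Θ′.Pt I) (s : DM I) .(c : Q (map τ θ)) .(c′ : Q′ θ) →
      Rel A id (val (Filler.filler V) (map τ θ , s) c) (val (Filler.filler V′) (θ , s) c′)) →
    ∀ {I} (θ : Θ′.Pt I) (r : DM I) .(c : Q (map τ θ)) .(c′ : Q′ θ) →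
    Rel A id (val (uniq P V cA) (map τ θ , r) c) (val (uniq P′ V′ (subComp A σ cA)) (θ , r) c′)
  uniq-match V V′ m =
    contraction-match constC cA P τ σ P′ M (uniqEnd P V) (uniqExt P V) (uniqEnd P′ V′) (uniqExt P′ V′)
      (λ θ r s c c′ d → rel-sym (uniqEnd-rel P V (map τ θ) r s c d) ⊙ m θ s c c′
                        ⊙ rel-sub A σ (uniqEnd-rel P′ V′ θ r s c′ d))

-- Paths

module _ {ℓ ℓ′} {Γ : CSet ℓ} {A : Ty Γ ℓ′} where
  private
    module Γ = CSet Γ
    module A = Ty A

  pathAt : ∀ {I} {ρ : Γ.Pt I} {x y : A.El ρ} → Path A ρ x y → DM I → A.El ρ
  pathAt {ρ = ρ} π r = A.res (ext id (dim π) r) (Γ.section ρ (deg-ext id (dim π) r)) (line π)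

  line-pathAt : ∀ {I} {ρ : Γ.Pt I} {x y : A.El ρ} (π : Path A ρ x y) (r : DM I) →
                Rel A (ext id (dim π) r) (line π) (pathAt π r)
  line-pathAt π r = res-rel

  -- By `lift-ext` both composites are restrictions of `line π` along one and the same map, which
  -- acts as `f` on old names and sends the name of `π` to `r′`.
  pathAt-res : ∀ {I J} {ρ : Γ.Pt I} {ρ′ : Γ.Pt J} {f : Hom J I} {p : ρ′ Γ.≈ ρ Γ.· f} {x y : A.El ρ} {x′ y′ : A.El ρ′}
               (π : Path A ρ x y) (π′ : Path A ρ′ x′ y′) → PathRes A f p π π′ → {r : DM I} {r′ : DM J} → r′ ≈ᵈ r ⟨ f ⟩ᵈ →
               Rel A f (pathAt π r) (pathAt π′ r′)
  pathAt-res {f = f} π π′ e {r} {r′} q =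
    rel-div
      (≈ʰ-trans (lift-ext f (dim π) (dim π′) id r′)
        (≈ʰ-trans (ext-cong (dim π) (≈ʰ-trans (∘-idʳ f) (≈ʰ-sym (∘-idˡ f))) q) (≈ʰ-sym (ext-∘ id (dim π) r f))))
      (line-pathAt π r)
      (rel-trans (≈ʰ-refl {f = lift f (dim π) (dim π′) ∘ ext id (dim π′) r′}) (rel _ e) (line-pathAt π′ r′))

  pathAt-𝟎 : ∀ {I} {ρ : Γ.Pt I} {x y : A.El ρ} (π : Path A ρ x y) → Rel A id (pathAt π 𝟎) x
  pathAt-𝟎 π = rel-div (≈ʰ-trans (face-ext (dim π) false) (≈ʰ-sym (∘-idʳ (ext id (dim π) 𝟎)))) (line-pathAt π 𝟎) (rel _ (at0 π))

  pathAt-𝟏 : ∀ {I} {ρ : Γ.Pt I} {x y : A.El ρ} (π : Path A ρ x y) → Rel A id (pathAt π 𝟏) y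
  pathAt-𝟏 π = rel-div (≈ʰ-trans (face-ext (dim π) true) (≈ʰ-sym (∘-idʳ (ext id (dim π) 𝟏)))) (line-pathAt π 𝟏) (rel _ (at1 π))

⟪⟫-rel : ∀ {ℓ ℓ′ ℓ″} {Δ : CSet ℓ} {T : Ty Δ ℓ′} {A : Ty Δ ℓ″} (w : Tm (T ⇒ A)) {I J} {ρ : CSet.Pt Δ I} {ρ′ : CSet.Pt Δ J}
         {f : Hom J I} {x : Ty.El T ρ} {y : Ty.El T ρ′} → Rel T f x y → Rel A f (w ⟪ ρ ⟫ x) (w ⟪ ρ′ ⟫ y)
⟪⟫-rel {A = A} w {ρ′ = ρ′} {f} {x} r =
  rel (over r) (Ty.Eq-trans A ρ′ (⟪⟫-nat w f (over r) x) (⟪⟫-cong w ρ′ (equal r)))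

-- Extension problems for w in context Θ restricted to Q

record EProb {ℓ} {Δ : CSet ℓ} {T A : Ty Δ ℓ} (w : Tm (T ⇒ A)) (Θ : CSet ℓ) (Q : ∀ {I} → CSet.Pt Θ I → Set) : Set ℓ where
  no-eta-equality
  private
    module Δ = CSet Δ
    module Θ = CSet Θ
  field
    cl     : ∀ {I J} (f : Hom J I) {θ : Θ.Pt I} {θ′ : Θ.Pt J} → θ′ Θ.≈ θ Θ.· f → Q θ → Q θ′
    pt     : ∀ {I} (θ : Θ.Pt I) → .(Q θ) → Δ.Pt I
    pt-res : ∀ {I J} (f : Hom J I) {θ : Θ.Pt I} {θ′ : Θ.Pt J} → θ′ Θ.≈ θ Θ.· f → .(c : Q θ) .(c′ : Q θ′) →
             pt θ′ c′ Δ.≈ pt θ c Δ.· f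
    χ      : ∀ {I} → Θ.Pt I → Face I
    χ-res  : ∀ {I J} (f : Hom J I) {θ : Θ.Pt I} {θ′ : Θ.Pt J} → θ′ Θ.≈ θ Θ.· f → χ θ′ ≈ᶠ χ θ ⟨ f ⟩ᶠ
    goal   : Sec Θ Q A pt
    part   : Sec Θ (λ θ → Q θ × χ θ ≈ᶠ 1F) T (λ θ c → pt θ (proj₁ c))
    path   : Sec (Θ ×𝕀) (λ x → Q (proj₁ x) × χ (proj₁ x) ≈ᶠ 1F) A (λ x c → pt (proj₁ x) (proj₁ c))
    path-𝟎 : ∀ {I} (θ : Θ.Pt I) .(c : Q θ) .(d : χ θ ≈ᶠ 1F) →
             Rel A id (val path (θ , 𝟎) (c , d)) (w ⟪ pt θ c ⟫ val part θ (c , d))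
    path-𝟏 : ∀ {I} (θ : Θ.Pt I) .(c : Q θ) .(d : χ θ ≈ᶠ 1F) →
             Rel A id (val path (θ , 𝟏) (c , d)) (val goal θ c)

  χ-one : ∀ {I J} (f : Hom J I) {θ : Θ.Pt I} {θ′ : Θ.Pt J} → θ′ Θ.≈ θ Θ.· f → χ θ ⟨ f ⟩ᶠ ≈ᶠ 1F → χ θ′ ≈ᶠ 1F
  χ-one f e p = ≈-trans (χ-res f e) p

module _ {ℓ} {Δ : CSet ℓ} {T A : Ty Δ ℓ} {w : Tm (T ⇒ A)} {Θ : CSet ℓ} {Q : ∀ {I} → CSet.Pt Θ I → Set} (P : EProb w Θ Q) where
  private
    module Δ = CSet Δ
    module Θ = CSet Θ
    module Θ𝕀 = CSet (Θ ×𝕀)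
    module T = Ty T
    module A = Ty A
  open EProb P

  private
    cl· : ∀ {I J} (f : Hom J I) (θ : Θ.Pt I) → Q θ → Q (θ Θ.· f)
    cl· f θ = cl f Θ.rfl

    χ· : ∀ {I J} (f : Hom J I) (θ : Θ.Pt I) → χ θ ⟨ f ⟩ᶠ ≈ᶠ 1F → χ (θ Θ.· f) ≈ᶠ 1F
    χ· f θ = χ-one f Θ.rfl

    χ·· : ∀ {I J K} (f : Hom J I) (g : Hom K J) (θ : Θ.Pt I) → χ (θ Θ.· f) ≈ᶠ 1F → χ (θ Θ.· (f ∘ g)) ≈ᶠ 1F
    χ·· f g θ p = χ-one g (Θ.symm (Θ.·-∘ θ f g)) (one-sub g p)

    lift-new : ∀ {I J} (f : Hom J I) (i : Fresh I) (j : Fresh J) → new j ≈ᵈ new i ⟨ lift f i j ⟩ᵈ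
    lift-new f i j = ≈-sym (coord-lift f i j)

  -- C is the problem that P determines at θ.
  record ERep {I} (θ : Θ.Pt I) .(c : Q θ) (ρ : Δ.Pt I) (C : Problem w ρ) : Set ℓ where
    field
      point≈ : ρ Δ.≈ pt θ c
      face≈  : Problem.ψ C ≈ᶠ χ θ
      goal≈  : Rel A id (b C) (val goal θ c)
      part≈  : ∀ {J} (f : Hom J I) {ρ′ : Δ.Pt J} (p : ρ′ Δ.≈ ρ Δ.· f) .(d : Problem.ψ C ⟨ f ⟩ᶠ ≈ᶠ 1F)
               .(e : χ (θ Θ.· f) ≈ᶠ 1F) → Rel T id (at (t C) f p d) (val part (θ Θ.· f) (cl· f θ c , e))
      path≈  : ∀ {J} (f : Hom J I) {ρ′ : Δ.Pt J} (p : ρ′ Δ.≈ ρ Δ.· f) .(d : Problem.ψ C ⟨ f ⟩ᶠ ≈ᶠ 1F)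
               .(e : χ (θ Θ.· f) ≈ᶠ 1F) →
               Rel A id (line (ω C f p d))
                 (val path (θ Θ.· (f ∘ deg (dim (ω C f p d))) , new (dim (ω C f p d)))
                   (cl· (f ∘ deg (dim (ω C f p d))) θ c , χ·· f (deg (dim (ω C f p d))) θ e))

  path-lift : ∀ {I J K} (f : Hom J I) (g : Hom K J) {h : Hom K I} (j : Fresh J) (k : Fresh K) (θ : Θ.Pt I) → h ≈ʰ f ∘ g →
              (θ Θ.· (h ∘ deg k) , new k) Θ𝕀.≈ (θ Θ.· (f ∘ deg j) , new j) Θ𝕀.· lift g j k
  path-lift f g {h} j k θ e =
    (Θ.·-cong Θ.rfl (≈ʰ-trans (∘-cong e (≈ʰ-refl {f = deg k}))
        (≈ʰ-trans (∘-assoc f g (deg k))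
          (≈ʰ-trans (∘-cong (≈ʰ-refl {f = f}) (≈ʰ-sym (deg-lift g j k))) (≈ʰ-sym (∘-assoc f (deg j) (lift g j k))))))
     Θ.⨾ Θ.symm (Θ.·-∘ θ (f ∘ deg j) (lift g j k)))
    , lift-new g j k

  erep-res : ∀ {I J} {f : Hom J I} {θ : Θ.Pt I} {θ′ : Θ.Pt J} → θ′ Θ.≈ θ Θ.· f → .(c : Q θ) .(c′ : Q θ′) →
             {ρ : Δ.Pt I} {ρ′ : Δ.Pt J} {C : Problem w ρ} {C′ : Problem w ρ′} →
             ERep θ c ρ C → ERep θ′ c′ ρ′ C′ → (p : ρ′ Δ.≈ ρ Δ.· f) → ProblemRes w f p C C′
  erep-res {f = f} {θ} {θ′} e c c′ {C = C} {C′} R R′ p = record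
    { ψ-res = ≈-trans (ERep.face≈ R′) (≈-trans (χ-res f e) (subᶠ-cong f (≈-sym (ERep.face≈ R))))
    ; b-res = rel-eq (ERep.goal≈ R ◅ nat goal f e c c′ ▻ rel-sym (ERep.goal≈ R′)) p
    ; t-res = λ g q r d d′ → rel-id-eq
        ( ERep.part≈ R (f ∘ g) r d (χR g d)
        ⊙ val-cong part (points g) (cl· (f ∘ g) θ c , χR g d) (cl· g θ′ c′ , χR′ g d′)
        ⊙ rel-sym (ERep.part≈ R′ g q d′ (χR′ g d′)))
    ; ω-res = λ g q r d d′ →
        let j = dim (ω C (f ∘ g) r d)
            k = dim (ω C′ g q d′)
        in rel-eq
        ( ERep.path≈ R (f ∘ g) r d (χR g d)
        ◅ nat path (lift id j k)
            ((Θ.after f (g ∘ deg k) e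
               Θ.⨾ Θ.·-cong Θ.rfl (≈ʰ-sym (∘-assoc f g (deg k)))
               Θ.⨾ proj₁ (path-lift (f ∘ g) id j k θ (≈ʰ-sym (∘-idʳ (f ∘ g)))))
             , lift-new id j k)
            (cl· ((f ∘ g) ∘ deg j) θ c , χ·· (f ∘ g) (deg j) θ (χR g d))
            (cl· (g ∘ deg k) θ′ c′ , χ·· g (deg k) θ′ (χR′ g d′))
        ▻ rel-sym (ERep.path≈ R′ g q d′ (χR′ g d′))) _
    }
    where
    χR : ∀ {K} (g : Hom K _) → Problem.ψ C ⟨ f ∘ g ⟩ᶠ ≈ᶠ 1F → χ (θ Θ.· (f ∘ g)) ≈ᶠ 1F
    χR g d = χ· (f ∘ g) θ (≈-trans (subᶠ-cong (f ∘ g) (≈-sym (ERep.face≈ R))) d)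
    χR′ : ∀ {K} (g : Hom K _) → Problem.ψ C′ ⟨ g ⟩ᶠ ≈ᶠ 1F → χ (θ′ Θ.· g) ≈ᶠ 1F
    χR′ g d = χ· g θ′ (≈-trans (subᶠ-cong g (≈-sym (ERep.face≈ R′))) d)
    points : ∀ {K} (g : Hom K _) → θ Θ.· (f ∘ g) Θ.≈ θ′ Θ.· g
    points g = Θ.symm (Θ.after f g e)

  opaque
    eproblem : ∀ {I} (θ : Θ.Pt I) .(c : Q θ) → Problem w (pt θ c)
    eproblem θ c = record
      { ψ     = χ θ
      ; b     = val goal θ c
      ; t     = record { at = t-at ; at-nat = λ f g h e p q r d d′ → rel-eq (rel-sym (t-rel f p d) ◅
                    nat part g (Θ.split θ e) (cl· f θ c , χ· f θ d) (cl· h θ c , χ· h θ d′) ▻ t-rel h r d′) q }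
      ; ω     = ω-at
      ; ω-nat = λ f g h e p q r d d′ → rel-eq
          ( rel-sym cast-rel
          ◅ nat path (lift g (freshFor _) (freshFor _)) (path-lift f g (freshFor _) (freshFor _) θ e)
              (cl· (f ∘ deg (freshFor _)) θ c , χ·· f (deg (freshFor _)) θ (χ· f θ d))
              (cl· (h ∘ deg (freshFor _)) θ c , χ·· h (deg (freshFor _)) θ (χ· h θ d′))
          ▻ cast-rel) _
      }
      where
      pt≈ : ∀ {J} (f : Hom J _) {ρ′ : Δ.Pt J} → ρ′ Δ.≈ pt θ c Δ.· f → ρ′ Δ.≈ pt (θ Θ.· f) (cl· f θ c)
      pt≈ f p = p Δ.⨾ Δ.symm (pt-res f Θ.rfl c (cl· f θ c))

      t-at : ∀ {J} (f : Hom J _) {ρ′ : Δ.Pt J} → ρ′ Δ.≈ pt θ c Δ.· f → .(χ θ ⟨ f ⟩ᶠ ≈ᶠ 1F) → T.El ρ′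
      t-at f p d = T.cast (pt≈ f p) (val part (θ Θ.· f) (cl· f θ c , χ· f θ d))

      t-rel : ∀ {J} (f : Hom J _) {ρ′ : Δ.Pt J} (p : ρ′ Δ.≈ pt θ c Δ.· f) .(d : χ θ ⟨ f ⟩ᶠ ≈ᶠ 1F) →
              Rel T id (val part (θ Θ.· f) (cl· f θ c , χ· f θ d)) (t-at f p d)
      t-rel f p d = cast-rel

      ω-at : ∀ {J} (f : Hom J _) {ρ′ : Δ.Pt J} (p : ρ′ Δ.≈ pt θ c Δ.· f) .(d : χ θ ⟨ f ⟩ᶠ ≈ᶠ 1F) →
             Path A ρ′ (w ⟪ ρ′ ⟫ t-at f p d) (A.res f p (val goal θ c))
      ω-at {J} f {ρ′} p d = record
        { dim  = k
        ; line = A.cast line≈ line₀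
        ; at0  = rel-eq
            ( rel-sym cast-rel
            ◅ nat path (face k false) (end false) (cd c d) (cl· f θ c , χ· f θ d)
            ▻ path-𝟎 (θ Θ.· f) (cl· f θ c) (χ· f θ d)
            ⊙ ⟪⟫-rel w (t-rel f p d)) _
        ; at1  = rel-eq
            ( rel-sym cast-rel
            ◅ nat path (face k true) (end true) (cd c d) (cl· f θ c , χ· f θ d)
            ▻ path-𝟏 (θ Θ.· f) (cl· f θ c) (χ· f θ d)
            ⊙ rel-div (≈ʰ-sym (∘-idʳ f)) (nat goal f Θ.rfl c (cl· f θ c)) res-rel) _
        }
        where
        k : Fresh J
        k = freshFor J
        cd : Q θ → χ θ ⟨ f ⟩ᶠ ≈ᶠ 1F → Q (θ Θ.· (f ∘ deg k)) × χ (θ Θ.· (f ∘ deg k)) ≈ᶠ 1F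
        cd c d = cl· (f ∘ deg k) θ c , χ·· f (deg k) θ (χ· f θ d)
        line₀ : A.El (pt (θ Θ.· (f ∘ deg k)) (cl· (f ∘ deg k) θ c))
        line₀ = val path (θ Θ.· (f ∘ deg k) , new k) (cd c d)
        line≈ : ρ′ Δ.· deg k Δ.≈ pt (θ Θ.· (f ∘ deg k)) (cl· (f ∘ deg k) θ c)
        line≈ = Δ.after f (deg k) p Δ.⨾ Δ.symm (pt-res (f ∘ deg k) Θ.rfl c (cl· (f ∘ deg k) θ c))
        end : ∀ b → (θ Θ.· f , endpoint b) Θ𝕀.≈ (θ Θ.· (f ∘ deg k) , new k) Θ𝕀.· face k b
        end b = (Θ.split θ (≈ʰ-sym (≈ʰ-trans (∘-assoc f (deg k) (face k b))
                  (≈ʰ-trans (∘-cong (≈ʰ-refl {f = f}) (deg-face k b)) (∘-idʳ f)))))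
                , ≈-sym (face-new k b (new∈ _ k))

    eproblem-rep : ∀ {I} (θ : Θ.Pt I) .(c : Q θ) → ERep θ c _ (eproblem θ c)
    eproblem-rep θ c = record
      { point≈ = Δ.rfl
      ; face≈  = ≈-refl
      ; goal≈  = eq-rel (A.Eq-refl _)
      ; part≈  = λ f p d e → rel-sym cast-rel
      ; path≈  = λ f p d e → rel-sym cast-rel
      }

  module _ (E : EquivStr w) where

    erep-point : ∀ {I J} {f : Hom J I} {θ : Θ.Pt I} {θ′ : Θ.Pt J} → θ′ Θ.≈ θ Θ.· f → .(c : Q θ) .(c′ : Q θ′) →
                 {ρ : Δ.Pt I} {ρ′ : Δ.Pt J} {C : Problem w ρ} {C′ : Problem w ρ′} →
                 ERep θ c ρ C → ERep θ′ c′ ρ′ C′ → ρ′ Δ.≈ ρ Δ.· f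
    erep-point {f = f} e c c′ R R′ =
      ERep.point≈ R′ Δ.⨾ pt-res f e c c′ Δ.⨾ Δ.·-cong (Δ.symm (ERep.point≈ R)) ≈ʰ-refl

    erep-e₀ : ∀ {I J} {f : Hom J I} {θ : Θ.Pt I} {θ′ : Θ.Pt J} → θ′ Θ.≈ θ Θ.· f → .(c : Q θ) .(c′ : Q θ′) →
              {ρ : Δ.Pt I} {ρ′ : Δ.Pt J} {C : Problem w ρ} {C′ : Problem w ρ′} →
              ERep θ c ρ C → ERep θ′ c′ ρ′ C′ → Rel T f (e₀ E C) (e₀ E C′)
    erep-e₀ {f = f} e c c′ {C = C} {C′} R R′ =
      rel p (nat₀ E f p C C′ (erep-res e c c′ R R′ p))
      where
      p = erep-point e c c′ R R′

    erep-e₁ : ∀ {I J} {f : Hom J I} {θ : Θ.Pt I} {θ′ : Θ.Pt J} → θ′ Θ.≈ θ Θ.· f → .(c : Q θ) .(c′ : Q θ′) →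
              {ρ : Δ.Pt I} {ρ′ : Δ.Pt J} {C : Problem w ρ} {C′ : Problem w ρ′} →
              ERep θ c ρ C → ERep θ′ c′ ρ′ C′ → {r : DM I} {r′ : DM J} → r′ ≈ᵈ r ⟨ f ⟩ᵈ →
              Rel A f (pathAt (e₁ E C) r) (pathAt (e₁ E C′) r′)
    erep-e₁ {f = f} e c c′ {C = C} {C′} R R′ =
      pathAt-res (e₁ E C) (e₁ E C′) (nat₁ E f p C C′ (erep-res e c c′ R R′ p))
      where
      p = erep-point e c c′ R R′

    opaque
      gequiv₀ : Sec Θ Q T pt
      gequiv₀ .val θ c = e₀ E (eproblem θ c)
      gequiv₀ .nat f {θ} {θ′} e c c′ = erep-e₀ e c c′ (eproblem-rep θ c) (eproblem-rep θ′ c′)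

      gequiv₀-rep : ∀ {I} {θ : Θ.Pt I} .(c : Q θ) {ρ : Δ.Pt I} {C : Problem w ρ} → ERep θ c ρ C →
                    Rel T id (e₀ E C) (val gequiv₀ θ c)
      gequiv₀-rep {θ = θ} c R = erep-e₀ (Θ.symm (Θ.·-id θ)) c c R (eproblem-rep θ c)

      gequiv₁ : Sec (Θ ×𝕀) (λ x → Q (proj₁ x)) A (λ x → pt (proj₁ x))
      gequiv₁ .val (θ , r) c = pathAt (e₁ E (eproblem θ c)) r
      gequiv₁ .nat f {θ , r} {θ′ , r′} (e , q) c c′ = erep-e₁ e c c′ (eproblem-rep θ c) (eproblem-rep θ′ c′) q

      gequiv₁-rep : ∀ {I} {θ : Θ.Pt I} (r : DM I) .(c : Q θ) {ρ : Δ.Pt I} {C : Problem w ρ} → ERep θ c ρ C →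
                    Rel A id (pathAt (e₁ E C) r) (val gequiv₁ (θ , r) c)
      gequiv₁-rep {θ = θ} r c R = erep-e₁ (Θ.symm (Θ.·-id θ)) c c R (eproblem-rep θ c) (≈-sym (sub-id r))

    gequiv₁-𝟎 : ∀ {I} (θ : Θ.Pt I) .(c : Q θ) → Rel A id (val gequiv₁ (θ , 𝟎) c) (w ⟪ pt θ c ⟫ val gequiv₀ θ c)
    gequiv₁-𝟎 θ c =
      rel-sym (gequiv₁-rep 𝟎 c (eproblem-rep θ c)) ⊙ pathAt-𝟎 (e₁ E (eproblem θ c)) ⊙ ⟪⟫-rel w (gequiv₀-rep c (eproblem-rep θ c))

    gequiv₁-𝟏 : ∀ {I} (θ : Θ.Pt I) .(c : Q θ) → Rel A id (val gequiv₁ (θ , 𝟏) c) (val goal θ c)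
    gequiv₁-𝟏 θ c =
      rel-sym (gequiv₁-rep 𝟏 c (eproblem-rep θ c)) ⊙ pathAt-𝟏 (e₁ E (eproblem θ c)) ⊙ ERep.goal≈ (eproblem-rep θ c)

    gequiv₀-part : ∀ {I} (θ : Θ.Pt I) .(c : Q θ) .(d : χ θ ≈ᶠ 1F) →
                   Rel T id (val gequiv₀ θ c) (val part θ (c , d))
    gequiv₀-part θ c d =
      rel-sym (gequiv₀-rep c R)
      ⊙ rel _ (agree₀ E (eproblem θ c) id (Δ.symm (Δ.·-id _)) (d′ d))
      ⊙ ERep.part≈ R id _ (d′ d) (χ· id θ (one-sub id d))
      ⊙ val-cong part (Θ.·-id θ) (cl· id θ c , χ· id θ (one-sub id d)) (c , d)
      where
      R : ERep θ c (pt θ c) (eproblem θ c)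
      R = eproblem-rep θ c
      d′ : χ θ ≈ᶠ 1F → Problem.ψ (eproblem θ c) ⟨ id ⟩ᶠ ≈ᶠ 1F
      d′ d = one-sub id (≈-trans (ERep.face≈ R) d)

    -- By `agree₁` the path of the equivalence is the prescribed one. The line of the latter is
    -- `path` at a universal coordinate, so its value at `r` is found by naturality along
    -- `ext id k r`.
    gequiv₁-path : ∀ {I} (θ : Θ.Pt I) (r : DM I) .(c : Q θ) .(d : χ θ ≈ᶠ 1F) →
                   Rel A id (val gequiv₁ (θ , r) c) (val path (θ , r) (c , d))
    gequiv₁-path {I} θ r c d =
      rel-sym (gequiv₁-rep r c R)
      ⊙ pathAt-res (e₁ E C) π (agree₁ E C id (Δ.symm (Δ.·-id _)) (d′ d)) (≈-sym (sub-id r))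
      ⊙ rel-div (≈ʰ-sym (∘-idʳ (ext id k r)))
          (rel-sym (ERep.path≈ R id (Δ.symm (Δ.·-id _)) (d′ d) (χ· id θ (one-sub id d))) ◅ line-pathAt π r)
          (nat path (ext id k r)
            ((Θ.section θ (≈ʰ-trans (∘-cong (∘-idˡ (deg k)) (≈ʰ-refl {f = ext id k r})) (deg-ext id k r)))
              , ≈-sym (coord-ext id k r))
            (cl· (id ∘ deg k) θ c , χ·· id (deg k) θ (χ· id θ (one-sub id d))) (c , d))
      where
      C : Problem w (pt θ c)
      C = eproblem θ c
      R : ERep θ c (pt θ c) C
      R = eproblem-rep θ c
      d′ : χ θ ≈ᶠ 1F → Problem.ψ C ⟨ id ⟩ᶠ ≈ᶠ 1F
      d′ d = one-sub id (≈-trans (ERep.face≈ R) d)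
      π : Path A (pt θ c) _ _
      π = ω C id (Δ.symm (Δ.·-id _)) (d′ d)
      k : Fresh I
      k = dim π

-- Change of context and base for equivalence structures.

module _ {ℓ} {Γ Δ : CSet ℓ} (T A : Ty Γ ℓ) (σ : Δ ⟶ Γ) (w : Tm (T ⇒ A)) where
  opaque
    subProblemᵒ : ∀ {I} {ρ : CSet.Pt Δ I} → Problem (subTm T A σ w) ρ → Problem w (map σ ρ)
    subProblemᵒ C = subProblem T A σ w C

  -- E′ is E pulled back along σ.
  record EquivOver (E : EquivStr w) (E′ : EquivStr (subTm T A σ w)) : Set ℓ where
    field
      e₀-over : ∀ {I} {ρ : CSet.Pt Δ I} (C : Problem (subTm T A σ w) ρ) →
                Rel T id (e₀ E (subProblemᵒ C)) (e₀ E′ C)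
      e₁-over : ∀ {I} {ρ : CSet.Pt Δ I} (C : Problem (subTm T A σ w) ρ) (r : DM I) →
                Rel A id (pathAt (e₁ E (subProblemᵒ C)) r) (pathAt (e₁ E′ C) r)

  opaque
    unfolding subProblemᵒ

    -- `subEquiv` solves the substituted problem with the original structure: the point is literally
    -- the same, and the path differs only by a cast of its line.
    subEquiv-over : (E : EquivStr w) → EquivOver E (subEquiv T A σ w E)
    subEquiv-over E = record
      { e₀-over = λ C → eq-rel (Ty.Eq-refl T _)
      ; e₁-over = λ C r →
          let π  = e₁ E (subProblem T A σ w C)
              π′ = e₁ (subEquiv T A σ w E) C
          in rel-div (≈ʰ-sym (∘-idʳ (ext id (dim π) r))) (line-pathAt π r) (cast-rel ◅ rel-sub A σ (line-pathAt π′ r))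
      }

module _ {ℓ} {Γ : CSet ℓ} {T A : Ty Γ ℓ} {w : Tm (T ⇒ A)} {Θ : CSet ℓ} {Q : ∀ {I} → CSet.Pt Θ I → Set} (P : EProb w Θ Q)
         {Θ′ : CSet ℓ} (τ : Θ′ ⟶ Θ) {Δ : CSet ℓ} (σ : Δ ⟶ Γ) {Q′ : ∀ {I} → CSet.Pt Θ′ I → Set}
         (P′ : EProb (subTm T A σ w) Θ′ Q′) where
  private
    module Γ = CSet Γ
    module Δ = CSet Δ
    module Θ = CSet Θ
    module Θ′ = CSet Θ′
    module P = EProb P
    module P′ = EProb P′

  -- P′ is the pullback of P along τ.
  record EMatch : Set ℓ where
    field
      pt-match   : ∀ {I} (θ : Θ′.Pt I) .(c : Q (map τ θ)) .(c′ : Q′ θ) → map σ (P′.pt θ c′) Γ.≈ P.pt (map τ θ) c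
      χ-match    : ∀ {I} (θ : Θ′.Pt I) → P′.χ θ ≈ᶠ P.χ (map τ θ)
      goal-match : ∀ {I} (θ : Θ′.Pt I) .(c : Q (map τ θ)) .(c′ : Q′ θ) →
                   Rel A id (val P.goal (map τ θ) c) (val P′.goal θ c′)
      part-match : ∀ {I} (θ : Θ′.Pt I) .(c : Q (map τ θ)) .(c′ : Q′ θ)
                   .(d : P.χ (map τ θ) ≈ᶠ 1F) .(d′ : P′.χ θ ≈ᶠ 1F) →
                   Rel T id (val P.part (map τ θ) (c , d)) (val P′.part θ (c′ , d′))
      path-match : ∀ {I} (θ : Θ′.Pt I) (r : DM I) .(c : Q (map τ θ)) .(c′ : Q′ θ)
                   .(d : P.χ (map τ θ) ≈ᶠ 1F) .(d′ : P′.χ θ ≈ᶠ 1F) →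
                   Rel A id (val P.path (map τ θ , r) (c , d)) (val P′.path (θ , r) (c′ , d′))

  module _ (M : EMatch) where
    open EMatch M

    opaque
      unfolding subProblemᵒ

      ematch-rep : ∀ {I} (θ : Θ′.Pt I) .(c : Q (map τ θ)) .(c′ : Q′ θ) →
                   {ρ : Δ.Pt I} (C : Problem (subTm T A σ w) ρ) → ERep P′ θ c′ ρ C →
                   ERep P (map τ θ) c (map σ ρ) (subProblemᵒ T A σ w C)
      ematch-rep {I} θ c c′ C R = record
        { point≈ = map-cong σ (ERep.point≈ R) Γ.⨾ pt-match θ c c′
        ; face≈  = ≈-trans (ERep.face≈ R) (χ-match θ)
        ; goal≈  = rel-sub A σ (ERep.goal≈ R) ⊙ rel-sym (goal-match θ c c′)
        ; part≈  = λ f p d e →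
            rel-sym cast-rel
            ⊙ rel-sub T σ (ERep.part≈ R f Δ.rfl d (d′ f d))
            ⊙ rel-sym (part-match (θ Θ′.· f) (cτ f c) (cl′ f c′) (e′ f d) (d′ f d))
            ⊙ val-cong P.part (map-nat τ θ f) (cτ f c , e′ f d) (P.cl f Θ.rfl c , e)
        ; path≈  = λ f p d e →
            let k  = dim (ω C f Δ.rfl d)
                fk = f ∘ deg k
            in rel-sym cast-rel
               ⊙ rel-sub A σ (ERep.path≈ R f Δ.rfl d (d′ f d))
               ⊙ rel-sym (path-match (θ Θ′.· fk) (new k) (cτ fk c) (cl′ fk c′) (e″ f (deg k) (d′ f d)) (d″ f (deg k) (d′ f d)))
               ⊙ val-cong P.path (map-nat τ θ fk , ≈-refl) (cτ fk c , e″ f (deg k) (d′ f d))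
                   (P.cl fk Θ.rfl c , P.χ-one (deg k) (Θ.symm (Θ.·-∘ _ f (deg k))) (one-sub (deg k) e))
        }
        where
        cτ : ∀ {J} (f : Hom J I) → Q (map τ θ) → Q (map τ (θ Θ′.· f))
        cτ f = P.cl f (map-nat τ θ f)
        cl′ : ∀ {J} (f : Hom J I) → Q′ θ → Q′ (θ Θ′.· f)
        cl′ f = P′.cl f Θ′.rfl
        d′ : ∀ {J} (f : Hom J I) → Problem.ψ C ⟨ f ⟩ᶠ ≈ᶠ 1F → P′.χ (θ Θ′.· f) ≈ᶠ 1F
        d′ f d = P′.χ-one f Θ′.rfl (≈-trans (subᶠ-cong f (≈-sym (ERep.face≈ R))) d)
        e′ : ∀ {J} (f : Hom J I) → Problem.ψ C ⟨ f ⟩ᶠ ≈ᶠ 1F → P.χ (map τ (θ Θ′.· f)) ≈ᶠ 1F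
        e′ f d = ≈-trans (≈-sym (χ-match (θ Θ′.· f))) (d′ f d)
        d″ : ∀ {J K} (f : Hom J I) (g : Hom K J) → P′.χ (θ Θ′.· f) ≈ᶠ 1F → P′.χ (θ Θ′.· (f ∘ g)) ≈ᶠ 1F
        d″ f g d = P′.χ-one g (Θ′.symm (Θ′.·-∘ θ f g)) (one-sub g d)
        e″ : ∀ {J K} (f : Hom J I) (g : Hom K J) → P′.χ (θ Θ′.· f) ≈ᶠ 1F → P.χ (map τ (θ Θ′.· (f ∘ g))) ≈ᶠ 1F
        e″ f g d = ≈-trans (≈-sym (χ-match (θ Θ′.· (f ∘ g)))) (d″ f g d)

    module _ {E : EquivStr w} {E′ : EquivStr (subTm T A σ w)} (O : EquivOver T A σ w E E′) where

      gequiv₀-match : ∀ {I} (θ : Θ′.Pt I) .(c : Q (map τ θ)) .(c′ : Q′ θ) →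
                      Rel T id (val (gequiv₀ P E) (map τ θ) c) (val (gequiv₀ P′ E′) θ c′)
      gequiv₀-match θ c c′ =
        rel-sym (gequiv₀-rep P E c {C = subProblemᵒ T A σ w (eproblem P′ θ c′)}
          (ematch-rep θ c c′ (eproblem P′ θ c′) (eproblem-rep P′ θ c′)))
        ⊙ EquivOver.e₀-over O (eproblem P′ θ c′)
        ⊙ rel-sub T σ (gequiv₀-rep P′ E′ c′ (eproblem-rep P′ θ c′))

      gequiv₁-match : ∀ {I} (θ : Θ′.Pt I) (r : DM I) .(c : Q (map τ θ)) .(c′ : Q′ θ) →
                      Rel A id (val (gequiv₁ P E) (map τ θ , r) c) (val (gequiv₁ P′ E′) (θ , r) c′)
      gequiv₁-match θ r c c′ =
        rel-sym (gequiv₁-rep P E r c {C = subProblemᵒ T A σ w (eproblem P′ θ c′)}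
          (ematch-rep θ c c′ (eproblem P′ θ c′) (eproblem-rep P′ θ c′)))
        ⊙ EquivOver.e₁-over O (eproblem P′ θ c′) r
        ⊙ rel-sub A σ (gequiv₁-rep P′ E′ r c′ (eproblem-rep P′ θ c′))

All : ∀ {ℓ} (Θ : CSet ℓ) {I} → CSet.Pt Θ I → Set
All Θ _ = ⊤

-- Restricting a problem to a smaller sieve

module _ {ℓ} {Γ Θ : CSet ℓ} {A : Ty Γ ℓ} {Q : ∀ {I} → CSet.Pt Θ I → Set} (P : Prob A Θ Q)
         (R : ∀ {I} → CSet.Pt Θ I → Set) (R→Q : ∀ {I} (θ : CSet.Pt Θ I) → R θ → Q θ)
         (cl : ∀ {I J} (f : Hom J I) {θ : CSet.Pt Θ I} {θ′ : CSet.Pt Θ J} → CSet._≈_ Θ θ′ (CSet._·_ Θ θ f) → R θ → R θ′) where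
  private
    module Γ = CSet Γ
    module P = Prob P

  opaque
    restrict-side : Sec (Θ ×𝕀) (λ x → R (proj₁ x) × P.χ (proj₁ x) ≈ᶠ 1F) A (λ x c → P.ln x (R→Q (proj₁ x) (proj₁ c)))
    restrict-side = pull P.side (λ x → x) (λ f p → p) (λ x c → R→Q (proj₁ x) (proj₁ c) , proj₂ c) (λ x c → Γ.rfl)

    restrict-side-rel : ∀ {I} (x : CSet.Pt (Θ ×𝕀) I) .(c : R (proj₁ x)) .(d : P.χ (proj₁ x) ≈ᶠ 1F) →
                        Rel A id (val P.side x (R→Q (proj₁ x) c , d)) (val restrict-side x (c , d))
    restrict-side-rel x c d = pull-rel _ _ _ _ _ x (c , d)

    restrict-init : Sec Θ R A (λ θ c → P.ln (θ , 𝟎) (R→Q θ c))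
    restrict-init = pull P.init (λ x → x) (λ f p → p) R→Q (λ x c → Γ.rfl)

    restrict-init-rel : ∀ {I} (θ : CSet.Pt Θ I) .(c : R θ) → Rel A id (val P.init θ (R→Q θ c)) (val restrict-init θ c)
    restrict-init-rel θ c = pull-rel _ _ _ _ _ θ c

  restrictProb : Prob A Θ R
  restrictProb .Prob.cl = cl
  restrictProb .Prob.ln x c = P.ln x (R→Q (proj₁ x) c)
  restrictProb .Prob.ln-res f {x} {x′} p c c′ = P.ln-res f p (R→Q (proj₁ x) c) (R→Q (proj₁ x′) c′)
  restrictProb .Prob.χ = P.χ
  restrictProb .Prob.χ-res = P.χ-res
  restrictProb .Prob.side = restrict-side
  restrictProb .Prob.init = restrict-init
  restrictProb .Prob.agr θ c d =
    rel-sym (restrict-init-rel θ c) ⊙ P.agr θ (R→Q θ c) d ⊙ restrict-side-rel (θ , 𝟎) c d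

  -- The restricted problem is the pullback of `P` along the identity of the context; `Match` lets
  -- the two sieves differ.
  gcomp-restrict : (cA : Comp A) → ∀ {I} (θ : CSet.Pt Θ I) .(c : R θ) →
                   Rel A id (val (gcomp P cA) θ (R→Q θ c)) (val (gcomp restrictProb cA) θ c)
  gcomp-restrict cA θ c = gcomp-sub cA P idᶜ restrictProb M θ (R→Q θ c) c
    where
    M : Match P idᶜ idᶜ (prob-idᶜ restrictProb)
    M = record
      { ln-match   = λ θ r c c′ → Γ.rfl
      ; χ-match    = λ θ → ≈-refl
      ; side-match = λ θ r c c′ d d′ → restrict-side-rel (θ , r) c′ d′
      ; init-match = λ θ c c′ → restrict-init-rel θ c′
      }

-- Composition problems for Glue

record GProb {ℓ} {Γ : CSet ℓ} (D : GlueData Γ) (Θ : CSet ℓ) : Set ℓ where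
  no-eta-equality
  open GlueData D
  private
    module Γ = CSet Γ
    module Θ = CSet Θ
    module Θ𝕀 = CSet (Θ ×𝕀)
  field
    probA : Prob A Θ (All Θ)
  open Prob probA using (χ; χ-res) public

  lnᵍ : ∀ {I} → Θ𝕀.Pt I → Γ.Pt I
  lnᵍ x = Prob.ln probA x tt

  φᵍ : ∀ {I} → Θ𝕀.Pt I → Face I
  φᵍ x = map φ (lnᵍ x)

  field
    sideT : Sec (Θ ×𝕀) (λ x → χ (proj₁ x) ≈ᶠ 1F × φᵍ x ≈ᶠ 1F) T (λ x c → lnᵍ x ,, proj₂ c)
    sideW : ∀ {I} (x : Θ𝕀.Pt I) .(d : χ (proj₁ x) ≈ᶠ 1F) .(c : φᵍ x ≈ᶠ 1F) →
            Rel A id (w ⟪ lnᵍ x ,, c ⟫ val sideT x (d , c)) (val (Prob.side probA) x (tt , d))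
    initT : Sec Θ (λ θ → φᵍ (θ , 𝟎) ≈ᶠ 1F) T (λ θ c → lnᵍ (θ , 𝟎) ,, c)
    initW : ∀ {I} (θ : Θ.Pt I) .(c : φᵍ (θ , 𝟎) ≈ᶠ 1F) →
            Rel A id (w ⟪ lnᵍ (θ , 𝟎) ,, c ⟫ val initT θ c) (val (Prob.init probA) θ tt)
    agrT  : ∀ {I} (θ : Θ.Pt I) .(d : χ θ ≈ᶠ 1F) .(c : φᵍ (θ , 𝟎) ≈ᶠ 1F) →
            Rel T id (val initT θ c) (val sideT (θ , 𝟎) (d , c))

module _ {ℓ} {Γ : CSet ℓ} {φ : Γ ⟶ 𝔽} {A : Ty Γ ℓ} where

  toᴿ : ∀ {I J} {ρ : CSet.Pt Γ I} {ρ′ : CSet.Pt Γ J} .{c : map φ ρ ≈ᶠ 1F} .{c′ : map φ ρ′ ≈ᶠ 1F} {f : Hom J I}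
        {x : Ty.El A ρ} {y : Ty.El A ρ′} → Rel A f x y → Rel (restrictTo φ A) {ρ = ρ ,, c} {ρ′ ,, c′} f x y
  toᴿ r = rel (over r) (equal r)

  fromᴿ : ∀ {I J} {ρ : (Γ ∣ φ Pt) I} {ρ′ : (Γ ∣ φ Pt) J} {f : Hom J I}
        {x : Ty.El A (point ρ)} {y : Ty.El A (point ρ′)} → Rel (restrictTo φ A) {ρ = ρ} {ρ′} f x y → Rel A f x y
  fromᴿ r = rel (over r) (equal r)

w-rel : ∀ {ℓ} {Γ : CSet ℓ} (D : GlueData Γ) {I J} {ρ : (Γ ∣ GlueData.φ D Pt) I} {ρ′ : (Γ ∣ GlueData.φ D Pt) J} {f : Hom J I}
        {x : Ty.El (GlueData.T D) ρ} {y : Ty.El (GlueData.T D) ρ′} → Rel (GlueData.T D) f x y →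
        Rel (GlueData.A D) f (GlueData.w D ⟪ ρ ⟫ x) (GlueData.w D ⟪ ρ′ ⟫ y)
w-rel D r = fromᴿ (⟪⟫-rel (GlueData.w D) r)

-- The composition in `Glue` over an arbitrary context.

module Core {ℓ} {Γ : CSet ℓ} (D : GlueData Γ) (cA : Comp (GlueData.A D)) (cT : Comp (GlueData.T D))
            (E : EquivStr (GlueData.w D)) {Θ : CSet ℓ} (G : GProb D Θ) where
  open GlueData D
  open GProb G
  private
    module Γ = CSet Γ
    module Θ = CSet Θ
    module Θ𝕀 = CSet (Θ ×𝕀)
    module P = Prob probA

  φᵍ-res : ∀ {I J} (f : Hom J I) {x : Θ𝕀.Pt I} {x′ : Θ𝕀.Pt J} → x′ Θ𝕀.≈ x Θ𝕀.· f → φᵍ x′ ≈ᶠ φᵍ x ⟨ f ⟩ᶠ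
  φᵍ-res f p = map-res φ (P.ln-res f p tt tt)

  -- δ = ∀i.φ
  δ : ∀ {I} → Θ.Pt I → Face I
  δ {I} θ = ∀ᶠ (freshFor I) (φᵍ (generic probA (freshFor I) θ))

  δ-res : ∀ {I J} (f : Hom J I) {θ : Θ.Pt I} {θ′ : Θ.Pt J} → θ′ Θ.≈ θ Θ.· f → δ θ′ ≈ᶠ δ θ ⟨ f ⟩ᶠ
  δ-res {I} {J} f {θ} {θ′} e = ≈-trans
    (∀ᶠ-cong j (φᵍ-res (lift f i j) {generic probA i θ} {generic probA j θ′}
      (Θ.square e (≈ʰ-sym (deg-lift f i j)) , ≈-sym (coord-lift f i j))))
    (∀ᶠ-lift f i j (φᵍ (generic probA i θ)))
    where
    i = freshFor I
    j = freshFor J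

  δ-cl : ∀ {I J} (f : Hom J I) {θ : Θ.Pt I} {θ′ : Θ.Pt J} → θ′ Θ.≈ θ Θ.· f → δ θ ≈ᶠ 1F → δ θ′ ≈ᶠ 1F
  δ-cl f e p = ≈-trans (δ-res f e) (one-sub f p)

  -- `∀ᶠ-one⁻` gives φ = 1 at the universal coordinate, and every `(θ , r)` is a restriction of that
  -- point.
  δ-elim : ∀ {I} (θ : Θ.Pt I) (r : DM I) → δ θ ≈ᶠ 1F → φᵍ (θ , r) ≈ᶠ 1F
  δ-elim {I} θ r p =
    ≈-trans (φᵍ-res (ext id i r) {generic probA i θ} {θ , r} (Θ.section θ (deg-ext id i r) , ≈-sym (coord-ext id i r)))
      (one-sub (ext id i r) (∀ᶠ-one⁻ i (φᵍ (generic probA i θ)) p))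
    where
    i = freshFor I

  δ-one : (∀ {I} (x : Θ𝕀.Pt I) → φᵍ x ≈ᶠ 1F) → ∀ {I} (θ : Θ.Pt I) → δ θ ≈ᶠ 1F
  δ-one h {I} θ = ∀ᶠ-cong (freshFor I) (h _)

  φ₁ : ∀ {I} → Θ.Pt I → Face I
  φ₁ θ = φᵍ (θ , 𝟏)

  φ₁-res : ∀ {I J} (f : Hom J I) {θ : Θ.Pt I} {θ′ : Θ.Pt J} → θ′ Θ.≈ θ Θ.· f → φ₁ θ′ ≈ᶠ φ₁ θ ⟨ f ⟩ᶠ
  φ₁-res f e = φᵍ-res f (e , ≈-refl)

  -- The composition in T over δ

  Isδ : ∀ {I} → Θ.Pt I → Set
  Isδ θ = δ θ ≈ᶠ 1F

  lnT : ∀ {I} (x : Θ𝕀.Pt I) → .(Isδ (proj₁ x)) → (Γ ∣ φ Pt) I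
  lnT x c = lnᵍ x ,, δ-elim (proj₁ x) (proj₂ x) c

  opaque
    sideδ : Sec (Θ ×𝕀) (λ x → Isδ (proj₁ x) × χ (proj₁ x) ≈ᶠ 1F) T (λ x c → lnT x (proj₁ c))
    sideδ = pull sideT (λ x → x) (λ f p → p) (λ (θ , r) c → proj₂ c , δ-elim θ r (proj₁ c)) (λ x c → Γ.rfl)

    sideδ-rel : ∀ {I} (θ : Θ.Pt I) (r : DM I) .(c : Isδ θ) .(d : χ θ ≈ᶠ 1F) →
                Rel T id (val sideT (θ , r) (d , δ-elim θ r c)) (val sideδ (θ , r) (c , d))
    sideδ-rel θ r c d = pull-rel _ _ _ _ _ (θ , r) (c , d)

    initδ : Sec Θ Isδ T (λ θ → lnT (θ , 𝟎))
    initδ = pull initT (λ x → x) (λ f p → p) (λ θ c → δ-elim θ 𝟎 c) (λ x c → Γ.rfl)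

    initδ-rel : ∀ {I} (θ : Θ.Pt I) .(c : Isδ θ) → Rel T id (val initT θ (δ-elim θ 𝟎 c)) (val initδ θ c)
    initδ-rel θ c = pull-rel _ _ _ _ _ θ c

  probT : Prob T Θ Isδ
  probT .Prob.cl = δ-cl
  probT .Prob.ln = lnT
  probT .Prob.ln-res f p c c′ = P.ln-res f p tt tt
  probT .Prob.χ = χ
  probT .Prob.χ-res = χ-res
  probT .Prob.side = sideδ
  probT .Prob.init = initδ
  probT .Prob.agr θ c d = rel-sym (initδ-rel θ c) ⊙ agrT θ d (δ-elim θ 𝟎 c) ⊙ sideδ-rel θ 𝟎 c d

  fillT : Sec (Θ ×𝕀) (λ x → Isδ (proj₁ x)) T lnT
  fillT = fill probT cT

  -- Comparison of the compositions in A and in T over δ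

  a₁′ : Sec Θ (All Θ) A (λ θ _ → lnᵍ (θ , 𝟏))
  a₁′ = gcomp probA cA

  probδ : Prob A Θ Isδ
  probδ = restrictProb probA Isδ (λ _ _ → tt) δ-cl

  opaque
    wfill : Sec (Θ ×𝕀) (λ x → Isδ (proj₁ x)) A (λ x _ → lnᵍ x)
    wfill .val x c = w ⟪ lnT x c ⟫ val fillT x c
    wfill .nat f p c c′ = w-rel D (nat fillT f p c c′)

    wfill-rel : ∀ {I} (x : Θ𝕀.Pt I) .(c : Isδ (proj₁ x)) → Rel A id (w ⟪ lnT x c ⟫ val fillT x c) (val wfill x c)
    wfill-rel x c = eq-rel (Ty.Eq-refl A _)

  -- `w` carries the T-components of a glue problem to its A-components, hence a filler in `T` to a
  -- filler of the problem in `A`. It need not be the filler that `A` itself would produce, whence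
  -- the comparison path.
  fillerδ : Filler probδ
  fillerδ .Filler.filler = wfill
  fillerδ .Filler.at-𝟎 θ c =
    rel-sym (restrict-init-rel probA Isδ (λ _ _ → tt) δ-cl θ c)
    ⊙ rel-sym (initW θ (δ-elim θ 𝟎 c))
    ⊙ w-rel D (initδ-rel θ c ⊙ fill-𝟎 probT cT θ c)
    ⊙ wfill-rel (θ , 𝟎) c
  fillerδ .Filler.at-side θ r c d =
    rel-sym (restrict-side-rel probA Isδ (λ _ _ → tt) δ-cl (θ , r) c d)
    ⊙ rel-sym (sideW (θ , r) d (δ-elim θ r c))
    ⊙ w-rel D (sideδ-rel θ r c d ⊙ fill-side probT cT θ r c d)
    ⊙ wfill-rel (θ , r) c

  compare : Sec (Θ ×𝕀) (λ x → Isδ (proj₁ x)) A (λ x _ → lnᵍ (proj₁ x , 𝟏))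
  compare = uniq probδ fillerδ cA

  compare-𝟎 : ∀ {I} (θ : Θ.Pt I) .(c : Isδ θ) → Rel A id (val compare (θ , 𝟎) c) (w ⟪ lnT (θ , 𝟏) c ⟫ val fillT (θ , 𝟏) c)
  compare-𝟎 θ c = uniq-𝟎 probδ fillerδ cA θ c ⊙ rel-sym (wfill-rel (θ , 𝟏) c)

  compare-𝟏 : ∀ {I} (θ : Θ.Pt I) .(c : Isδ θ) → Rel A id (val compare (θ , 𝟏) c) (val a₁′ θ tt)
  compare-𝟏 θ c = uniq-𝟏 probδ fillerδ cA θ c ⊙ rel-sym (gcomp-restrict probA Isδ (λ _ _ → tt) δ-cl cA θ c)

  -- The line is not moved by `constC`, so on ψ the path stays at the prescribed value for every
  -- `r`. This makes it compatible with the constant paths prescribed on ψ.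
  compare-side : ∀ {I} (θ : Θ.Pt I) (r : DM I) .(c : Isδ θ) .(d : χ θ ≈ᶠ 1F) →
                 Rel A id (val compare (θ , r) c) (val P.side (θ , 𝟏) (tt , d))
  compare-side θ r c d = uniq-side probδ fillerδ cA θ r c d
    ⊙ rel-sym (restrict-side-rel probA Isδ (λ _ _ → tt) δ-cl (θ , 𝟏) c d)

  -- The extension problem over φ(i1)

  Isφ₁ : ∀ {I} → Θ.Pt I → Set
  Isφ₁ θ = φ₁ θ ≈ᶠ 1F

  at-one : ∀ {I J} (f : Hom J I) {θ : Θ.Pt I} {θ′ : Θ.Pt J} → θ′ Θ.≈ θ Θ.· f → (θ′ , 𝟏) Θ𝕀.≈ (θ , 𝟏) Θ𝕀.· f
  at-one f e = e , ≈-refl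

  private
    Aᴿ = restrictTo φ A

  opaque
    goalᴱ : Sec Θ Isφ₁ Aᴿ (λ θ c → lnᵍ (θ , 𝟏) ,, c)
    goalᴱ .val θ c = val a₁′ θ tt
    goalᴱ .nat f p c c′ = toᴿ (nat a₁′ f p tt tt)

    goalᴱ-rel : ∀ {I} (θ : Θ.Pt I) .(c : Isφ₁ θ) → Rel A id (val a₁′ θ tt) (val goalᴱ θ c)
    goalᴱ-rel θ c = eq-rel (Ty.Eq-refl A _)

    partδ : Sec Θ (λ θ → Isφ₁ θ × δ θ ≈ᶠ 1F) T (λ θ c → lnᵍ (θ , 𝟏) ,, proj₁ c)
    partδ = pull fillT (λ θ → θ , 𝟏) at-one (λ θ c → proj₂ c) (λ x c → Γ.rfl)

    partδ-rel : ∀ {I} (θ : Θ.Pt I) .(c : Isφ₁ θ) .(d : δ θ ≈ᶠ 1F) →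
                Rel T id (val fillT (θ , 𝟏) d) (val partδ θ (c , d))
    partδ-rel θ c d = pull-rel _ _ _ _ _ θ (c , d)

    partχ : Sec Θ (λ θ → Isφ₁ θ × χ θ ≈ᶠ 1F) T (λ θ c → lnᵍ (θ , 𝟏) ,, proj₁ c)
    partχ = pull sideT (λ θ → θ , 𝟏) at-one (λ θ c → proj₂ c , proj₁ c) (λ x c → Γ.rfl)

    partχ-rel : ∀ {I} (θ : Θ.Pt I) .(c : Isφ₁ θ) .(d : χ θ ≈ᶠ 1F) →
                Rel T id (val sideT (θ , 𝟏) (d , c)) (val partχ θ (c , d))
    partχ-rel θ c d = pull-rel _ _ _ _ _ θ (c , d)

    partᴱ : Sec Θ (λ θ → Isφ₁ θ × δ θ ⊔ᶠ χ θ ≈ᶠ 1F) T (λ θ c → lnᵍ (θ , 𝟏) ,, proj₁ c)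
    partᴱ = join δ χ partδ partχ
      -- On the overlap of δ and ψ, the filler in `T` extends the prescribed side; the two are
      -- compared at its endpoint 1.
      (λ θ c p q → rel-sym (partδ-rel θ c p) ⊙ rel-sym (fill-side probT cT θ 𝟏 p q) ⊙ rel-sym (sideδ-rel θ 𝟏 p q) ⊙ partχ-rel θ c q)
      δ-res χ-res

    partᴱ-δ : ∀ {I} (θ : Θ.Pt I) .(c : Isφ₁ θ) .(e : δ θ ⊔ᶠ χ θ ≈ᶠ 1F) .(d : δ θ ≈ᶠ 1F) →
              Rel T id (val partᴱ θ (c , e)) (val fillT (θ , 𝟏) d)
    partᴱ-δ θ c e d = join-l δ χ partδ partχ _ δ-res χ-res θ (c , e) (c , d) ⊙ rel-sym (partδ-rel θ c d)

    partᴱ-χ : ∀ {I} (θ : Θ.Pt I) .(c : Isφ₁ θ) .(e : δ θ ⊔ᶠ χ θ ≈ᶠ 1F) .(d : χ θ ≈ᶠ 1F) →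
              Rel T id (val partᴱ θ (c , e)) (val sideT (θ , 𝟏) (d , c))
    partᴱ-χ θ c e d = join-r δ χ partδ partχ _ δ-res χ-res θ (c , e) (c , d) ⊙ rel-sym (partχ-rel θ c d)

    pathδ : Sec (Θ ×𝕀) (λ x → Isφ₁ (proj₁ x) × δ (proj₁ x) ≈ᶠ 1F) A (λ x _ → lnᵍ (proj₁ x , 𝟏))
    pathδ = pull compare (λ x → x) (λ f p → p) (λ x c → proj₂ c) (λ x c → Γ.rfl)

    pathδ-rel : ∀ {I} (x : Θ𝕀.Pt I) .(c : Isφ₁ (proj₁ x)) .(d : δ (proj₁ x) ≈ᶠ 1F) →
                Rel A id (val compare x d) (val pathδ x (c , d))
    pathδ-rel x c d = pull-rel _ _ _ _ _ x (c , d)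

    -- Used twice, as a path over φ(i1) in the extension problem and without restriction in the
    -- final composition; hence the parameter `Q`.
    constχ : {Q : ∀ {I} → Θ𝕀.Pt I → Set} →
             Sec (Θ ×𝕀) (λ x → Q x × χ (proj₁ x) ≈ᶠ 1F) A (λ x _ → lnᵍ (proj₁ x , 𝟏))
    constχ = pull P.side (λ x → proj₁ x , 𝟏) (λ f p → at-one f (proj₁ p)) (λ x c → tt , proj₂ c) (λ x c → Γ.rfl)

    constχ-rel : {Q : ∀ {I} → Θ𝕀.Pt I → Set} → ∀ {I} (x : Θ𝕀.Pt I) .(c : Q x) .(d : χ (proj₁ x) ≈ᶠ 1F) →
                 Rel A id (val P.side (proj₁ x , 𝟏) (tt , d)) (val (constχ {Q}) x (c , d))
    constχ-rel x c d = pull-rel _ _ _ _ _ x (c , d)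

    pathᴬ : Sec (Θ ×𝕀) (λ x → Isφ₁ (proj₁ x) × δ (proj₁ x) ⊔ᶠ χ (proj₁ x) ≈ᶠ 1F) A (λ x _ → lnᵍ (proj₁ x , 𝟏))
    pathᴬ = join (λ x → δ (proj₁ x)) (λ x → χ (proj₁ x)) pathδ (constχ {λ x → Isφ₁ (proj₁ x)})
      (λ x c p q → rel-sym (pathδ-rel x c p) ⊙ compare-side (proj₁ x) (proj₂ x) p q ⊙ constχ-rel {λ x → Isφ₁ (proj₁ x)} x c q)
      (λ f p → δ-res f (proj₁ p)) (λ f p → χ-res f (proj₁ p))

    pathᴱ : Sec (Θ ×𝕀) (λ x → Isφ₁ (proj₁ x) × δ (proj₁ x) ⊔ᶠ χ (proj₁ x) ≈ᶠ 1F) Aᴿ (λ x c → lnᵍ (proj₁ x , 𝟏) ,, proj₁ c)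
    pathᴱ .val = val pathᴬ
    pathᴱ .nat f p c c′ = toᴿ (nat pathᴬ f p c c′)

    pathᴱ-δ : ∀ {I} (x : Θ𝕀.Pt I) .(c : Isφ₁ (proj₁ x)) .(e : δ (proj₁ x) ⊔ᶠ χ (proj₁ x) ≈ᶠ 1F) .(d : δ (proj₁ x) ≈ᶠ 1F) →
              Rel A id (val pathᴱ x (c , e)) (val compare x d)
    pathᴱ-δ x c e d =
      join-l (λ x → δ (proj₁ x)) (λ x → χ (proj₁ x)) pathδ constχ _ (λ f p → δ-res f (proj₁ p)) (λ f p → χ-res f (proj₁ p)) x (c , e) (c , d)
      ⊙ rel-sym (pathδ-rel x c d)

    pathᴱ-χ : ∀ {I} (x : Θ𝕀.Pt I) .(c : Isφ₁ (proj₁ x)) .(e : δ (proj₁ x) ⊔ᶠ χ (proj₁ x) ≈ᶠ 1F) .(d : χ (proj₁ x) ≈ᶠ 1F) →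
              Rel A id (val pathᴱ x (c , e)) (val P.side (proj₁ x , 𝟏) (tt , d))
    pathᴱ-χ x c e d =
      join-r (λ x → δ (proj₁ x)) (λ x → χ (proj₁ x)) pathδ constχ _ (λ f p → δ-res f (proj₁ p)) (λ f p → χ-res f (proj₁ p)) x (c , e) (c , d)
      ⊙ rel-sym (constχ-rel {λ x → Isφ₁ (proj₁ x)} x c d)

  eprob : EProb w Θ Isφ₁
  eprob .EProb.cl f e p = ≈-trans (φ₁-res f e) (one-sub f p)
  eprob .EProb.pt θ c = lnᵍ (θ , 𝟏) ,, c
  eprob .EProb.pt-res f e c c′ = P.ln-res f (at-one f e) tt tt
  eprob .EProb.χ θ = δ θ ⊔ᶠ χ θ
  eprob .EProb.χ-res f e = ⊔-cong (δ-res f e) (χ-res f e)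
  eprob .EProb.goal = goalᴱ
  eprob .EProb.part = partᴱ
  eprob .EProb.path = pathᴱ
  eprob .EProb.path-𝟎 θ c e = toᴿ (⊔-elim (δ θ) (χ θ) e
    (λ d → pathᴱ-δ (θ , 𝟎) c e d ⊙ compare-𝟎 θ d ⊙ w-rel D (rel-sym (partᴱ-δ θ c e d)))
    (λ d → pathᴱ-χ (θ , 𝟎) c e d ⊙ rel-sym (sideW (θ , 𝟏) d c) ⊙ w-rel D (rel-sym (partᴱ-χ θ c e d))))
  eprob .EProb.path-𝟏 θ c e = toᴿ (⊔-elim (δ θ) (χ θ) e
    (λ d → pathᴱ-δ (θ , 𝟏) c e d ⊙ compare-𝟏 θ d ⊙ goalᴱ-rel θ c)
    (λ d → pathᴱ-χ (θ , 𝟏) c e d ⊙ rel-sym (gcomp-side probA cA θ tt d) ⊙ goalᴱ-rel θ c))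

  outT : Sec Θ Isφ₁ T (λ θ c → lnᵍ (θ , 𝟏) ,, c)
  outT = gequiv₀ eprob E

  -- The final composition in A, along the constant line

  constline-cong : ∀ {I J} (f : Hom J I) {x : Θ𝕀.Pt I} {x′ : Θ𝕀.Pt J} → x′ Θ𝕀.≈ x Θ𝕀.· f →
                   (proj₁ x′ , ∼ proj₂ x′) Θ𝕀.≈ (proj₁ x , ∼ proj₂ x) Θ𝕀.· f
  constline-cong f p = proj₁ p , ∼-cong (proj₂ p)

  opaque
    -- The path of the equivalence ends in a₁′, where the composition starts;
    -- hence the reversal.
    sideφ : Sec (Θ ×𝕀) (λ x → ⊤ × φ₁ (proj₁ x) ≈ᶠ 1F) A (λ x _ → lnᵍ (proj₁ x , 𝟏))
    sideφ .val x c = val (gequiv₁ eprob E) (proj₁ x , ∼ proj₂ x) (proj₂ c)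
    sideφ .nat f {x} {x′} p c c′ = fromᴿ (nat (gequiv₁ eprob E) f {proj₁ x , ∼ proj₂ x} {proj₁ x′ , ∼ proj₂ x′} (constline-cong f {x} {x′} p) (proj₂ c) (proj₂ c′))

    sideφ-rel : ∀ {I} (x : Θ𝕀.Pt I) .(c : φ₁ (proj₁ x) ≈ᶠ 1F) →
                Rel A id (val (gequiv₁ eprob E) (proj₁ x , ∼ proj₂ x) c) (val sideφ x (tt , c))
    sideφ-rel x c = eq-rel (Ty.Eq-refl A _)

    -- On ψ the equivalence structure returns the path it was given, which is constant there; the
    -- reversal has no effect on it.
    sideφ-χ : ∀ {I} (x : Θ𝕀.Pt I) .(c : φ₁ (proj₁ x) ≈ᶠ 1F) .(d : χ (proj₁ x) ≈ᶠ 1F) →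
              Rel A id (val sideφ x (tt , c)) (val P.side (proj₁ x , 𝟏) (tt , d))
    sideφ-χ x c d =
      rel-sym (sideφ-rel x c)
      ⊙ fromᴿ (gequiv₁-path eprob E (proj₁ x) (∼ proj₂ x) c (⊔-oneʳ d))
      ⊙ pathᴱ-χ (proj₁ x , ∼ proj₂ x) c (⊔-oneʳ d) d

    side₁ : Sec (Θ ×𝕀) (λ x → ⊤ × φ₁ (proj₁ x) ⊔ᶠ χ (proj₁ x) ≈ᶠ 1F) A (λ x _ → lnᵍ (proj₁ x , 𝟏))
    side₁ = join (λ x → φ₁ (proj₁ x)) (λ x → χ (proj₁ x)) sideφ (constχ {λ _ → ⊤})
      (λ x _ p q → sideφ-χ x p q ⊙ constχ-rel {λ _ → ⊤} x tt q)
      (λ f p → φ₁-res f (proj₁ p)) (λ f p → χ-res f (proj₁ p))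

    side₁-φ : ∀ {I} (x : Θ𝕀.Pt I) .(e : φ₁ (proj₁ x) ⊔ᶠ χ (proj₁ x) ≈ᶠ 1F) .(c : φ₁ (proj₁ x) ≈ᶠ 1F) →
              Rel A id (val side₁ x (tt , e)) (val (gequiv₁ eprob E) (proj₁ x , ∼ proj₂ x) c)
    side₁-φ x e c =
      join-l (λ x → φ₁ (proj₁ x)) (λ x → χ (proj₁ x)) sideφ constχ _ (λ f p → φ₁-res f (proj₁ p)) (λ f p → χ-res f (proj₁ p)) x (tt , e) (tt , c)
      ⊙ rel-sym (sideφ-rel x c)

    side₁-χ : ∀ {I} (x : Θ𝕀.Pt I) .(e : φ₁ (proj₁ x) ⊔ᶠ χ (proj₁ x) ≈ᶠ 1F) .(d : χ (proj₁ x) ≈ᶠ 1F) →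
              Rel A id (val side₁ x (tt , e)) (val P.side (proj₁ x , 𝟏) (tt , d))
    side₁-χ x e d =
      join-r (λ x → φ₁ (proj₁ x)) (λ x → χ (proj₁ x)) sideφ constχ _ (λ f p → φ₁-res f (proj₁ p)) (λ f p → χ-res f (proj₁ p)) x (tt , e) (tt , d)
      ⊙ rel-sym (constχ-rel {λ _ → ⊤} x tt d)

  -- A composition inside the fibre over 1, the line in `Γ` being constant: a₁′ is moved along the
  -- reversed path over φ(i1). The constant side on ψ is what keeps the prescribed value there, also
  -- outside φ(i1).
  prob₁ : Prob A Θ (All Θ)
  prob₁ .Prob.cl _ _ _ = tt
  prob₁ .Prob.ln x _ = lnᵍ (proj₁ x , 𝟏)
  prob₁ .Prob.ln-res f {x} {x′} p _ _ = P.ln-res f {proj₁ x , 𝟏} {proj₁ x′ , 𝟏} (at-one f (proj₁ p)) tt tt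
  prob₁ .Prob.χ θ = φ₁ θ ⊔ᶠ χ θ
  prob₁ .Prob.χ-res f e = ⊔-cong (φ₁-res f e) (χ-res f e)
  prob₁ .Prob.side = side₁
  prob₁ .Prob.init = a₁′
  prob₁ .Prob.agr θ _ e = ⊔-elim (φ₁ θ) (χ θ) e
    (λ c → goalᴱ-rel θ c ⊙ rel-sym (fromᴿ (gequiv₁-𝟏 eprob E θ c))
           ⊙ fromᴿ (val-cong (gequiv₁ eprob E) (Θ.rfl , ≈-sym ∼𝟎) c c)
           ⊙ rel-sym (side₁-φ (θ , 𝟎) e c))
    (λ d → gcomp-side probA cA θ tt d ⊙ rel-sym (side₁-χ (θ , 𝟎) e d))

  outA : Sec Θ (All Θ) A (λ θ _ → lnᵍ (θ , 𝟏))
  outA = gcomp prob₁ cA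

  -- The side over φ(i1) ends at parameter 1, where the reversed path is at ∼1 = 0, its beginning w
  -- t₁.
  outW : ∀ {I} (θ : Θ.Pt I) .(c : Isφ₁ θ) → Rel A id (w ⟪ lnᵍ (θ , 𝟏) ,, c ⟫ val outT θ c) (val outA θ tt)
  outW θ c =
    rel-sym (fromᴿ (gequiv₁-𝟎 eprob E θ c))
    ⊙ fromᴿ (val-cong (gequiv₁ eprob E) (Θ.rfl , ≈-sym ∼𝟏) c c)
    ⊙ rel-sym (side₁-φ (θ , 𝟏) (⊔-oneˡ c) c)
    ⊙ rel-sym (gcomp-side prob₁ cA θ tt (⊔-oneˡ c))

  outA-side : ∀ {I} (θ : Θ.Pt I) .(d : χ θ ≈ᶠ 1F) → Rel A id (val outA θ tt) (val P.side (θ , 𝟏) (tt , d))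
  outA-side θ d = gcomp-side prob₁ cA θ tt (⊔-oneʳ d) ⊙ side₁-χ (θ , 𝟏) (⊔-oneʳ d) d

  outT-side : ∀ {I} (θ : Θ.Pt I) .(c : Isφ₁ θ) .(d : χ θ ≈ᶠ 1F) → Rel T id (val outT θ c) (val sideT (θ , 𝟏) (d , c))
  outT-side θ c d = gequiv₀-part eprob E θ c (⊔-oneʳ d) ⊙ partᴱ-χ θ c (⊔-oneʳ d) d

  -- The extension keeps what is prescribed on δ, namely the endpoint of the filler in `T`, which is
  -- the composite. When φ is constantly 1 this describes the whole result.
  outT-δ : ∀ {I} (θ : Θ.Pt I) .(c : Isφ₁ θ) .(d : Isδ θ) → Rel T id (val outT θ c) (val (gcomp probT cT) θ d)
  outT-δ θ c d = gequiv₀-part eprob E θ c (⊔-oneˡ d) ⊙ partᴱ-δ θ c (⊔-oneˡ d) d ⊙ fill-𝟏 probT cT θ d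

-- Naturality of the construction under change of context and base.

module _ {ℓ} {Γ Δ : CSet ℓ} (D : GlueData Γ) (σ : Δ ⟶ Γ) {Θ Θ′ : CSet ℓ} (G : GProb D Θ) (τ : Θ′ ⟶ Θ)
         (G′ : GProb (subGlueData σ D) Θ′) where
  open GlueData D
  private
    module Θ′ = CSet Θ′
    module G = GProb G
    module G′ = GProb G′

  -- G′ is the pullback of G along τ.
  record GMatch : Set ℓ where
    field
      probA-match : Match G.probA τ σ G′.probA
      sideT-match : ∀ {I} (θ : Θ′.Pt I) (r : DM I) .(d : G.χ (map τ θ) ≈ᶠ 1F) .(d′ : G′.χ θ ≈ᶠ 1F)
                    .(c : G.φᵍ (map τ θ , r) ≈ᶠ 1F) .(c′ : G′.φᵍ (θ , r) ≈ᶠ 1F) →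
                    Rel T id (val G.sideT (map τ θ , r) (d , c)) (val G′.sideT (θ , r) (d′ , c′))
      initT-match : ∀ {I} (θ : Θ′.Pt I) .(c : G.φᵍ (map τ θ , 𝟎) ≈ᶠ 1F) .(c′ : G′.φᵍ (θ , 𝟎) ≈ᶠ 1F) →
                    Rel T id (val G.initT (map τ θ) c) (val G′.initT θ c′)
    open Match probA-match public

module CoreMatch {ℓ} {Γ Δ : CSet ℓ} (D : GlueData Γ) (cA : Comp (GlueData.A D)) (cT : Comp (GlueData.T D))
                 (E : EquivStr (GlueData.w D)) (σ : Δ ⟶ Γ)
                 (E′ : EquivStr (subTm (GlueData.T D) (restrictTo (GlueData.φ D) (GlueData.A D)) (σ ▸▸ GlueData.φ D) (GlueData.w D)))
                 (O : EquivOver (GlueData.T D) (restrictTo (GlueData.φ D) (GlueData.A D)) (σ ▸▸ GlueData.φ D) (GlueData.w D) E E′)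
                 {Θ Θ′ : CSet ℓ} (G : GProb D Θ) (τ : Θ′ ⟶ Θ) (G′ : GProb (subGlueData σ D) Θ′) (M : GMatch D σ G τ G′) where
  open GlueData D
  open GMatch M
  private
    module Θ = CSet Θ
    module Θ′ = CSet Θ′
    module G = GProb G
    module G′ = GProb G′
    module C = Core D cA cT E G
    module C′ = Core (subGlueData σ D) (subComp A σ cA) (subComp T (σ ▸▸ φ) cT) E′ G′
    Aᴿ = restrictTo φ A

  ⟪⟫-match : ∀ {I} {ρ : (Γ ∣ φ Pt) I} {ρ′ : (Δ ∣ φ ∘ᶜ σ Pt) I} {x : Ty.El T ρ} {y : Ty.El T (map (σ ▸▸ φ) ρ′)} →
             Rel T id x y → Rel A id (w ⟪ ρ ⟫ x) (GlueData.w (subGlueData σ D) ⟪ ρ′ ⟫ y)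
  ⟪⟫-match {ρ′ = ρ′} {y = y} r =
    w-rel D r ⊙ eq-rel (Ty.Eq-sym A _ (subTm-⟪⟫ T Aᴿ (σ ▸▸ φ) w ρ′ y))

  φᵍ-match : ∀ {I} (θ : Θ′.Pt I) (r : DM I) → G′.φᵍ (θ , r) ≈ᶠ G.φᵍ (map τ θ , r)
  φᵍ-match θ r = map-cong φ (ln-match θ r tt tt)

  -- The maps `τ` and `σ` leave the stage `I` fixed, so both sides quantify over the same fresh name
  -- and the comparison takes place under `∀ᶠ`.
  δ-match : ∀ {I} (θ : Θ′.Pt I) → C′.δ θ ≈ᶠ C.δ (map τ θ)
  δ-match {I} θ = ∀ᶠ-cong i (≈-trans (φᵍ-match (θ Θ′.· deg i) (new i))
      (map-cong φ (ln-cong G.probA {x = map τ (θ Θ′.· deg i) , new i} {map τ θ Θ.· deg i , new i} (map-nat τ θ (deg i) , ≈-refl) tt tt)))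
    where
    i = freshFor I

  a₁′-match : ∀ {I} (θ : Θ′.Pt I) → Rel A id (val C.a₁′ (map τ θ) tt) (val C′.a₁′ θ tt)
  a₁′-match θ = gcomp-match G.probA τ σ G′.probA probA-match cA θ tt tt

  probT-match : Match C.probT τ (σ ▸▸ φ) C′.probT
  probT-match = record
    { ln-match   = λ θ r c c′ → ln-match θ r tt tt
    ; χ-match    = χ-match
    ; side-match = λ θ r c c′ d d′ →
        rel-sym (C.sideδ-rel (map τ θ) r c d)
        ⊙ sideT-match θ r d d′ (C.δ-elim (map τ θ) r c) (C′.δ-elim θ r c′)
        ⊙ rel-sub T (σ ▸▸ φ) (C′.sideδ-rel θ r c′ d′)
    ; init-match = λ θ c c′ →
        rel-sym (C.initδ-rel (map τ θ) c)
        ⊙ initT-match θ (C.δ-elim (map τ θ) 𝟎 c) (C′.δ-elim θ 𝟎 c′)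
        ⊙ rel-sub T (σ ▸▸ φ) (C′.initδ-rel θ c′)
    }

  fillT-match : ∀ {I} (θ : Θ′.Pt I) (r : DM I) .(c : C.Isδ (map τ θ)) .(c′ : C′.Isδ θ) →
                Rel T id (val C.fillT (map τ θ , r) c) (val C′.fillT (θ , r) c′)
  fillT-match = fill-match C.probT τ (σ ▸▸ φ) C′.probT probT-match cT

  probδ-match : Match C.probδ τ σ C′.probδ
  probδ-match = record
    { ln-match   = λ θ r c c′ → ln-match θ r tt tt
    ; χ-match    = χ-match
    ; side-match = λ θ r c c′ d d′ →
        rel-sym (restrict-side-rel G.probA C.Isδ (λ _ _ → tt) C.δ-cl (map τ θ , r) c d)
        ⊙ side-match θ r tt tt d d′
        ⊙ rel-sub A σ (restrict-side-rel G′.probA C′.Isδ (λ _ _ → tt) C′.δ-cl (θ , r) c′ d′)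
    ; init-match = λ θ c c′ →
        rel-sym (restrict-init-rel G.probA C.Isδ (λ _ _ → tt) C.δ-cl (map τ θ) c)
        ⊙ init-match θ tt tt
        ⊙ rel-sub A σ (restrict-init-rel G′.probA C′.Isδ (λ _ _ → tt) C′.δ-cl θ c′)
    }

  compare-match : ∀ {I} (θ : Θ′.Pt I) (r : DM I) .(c : C.Isδ (map τ θ)) .(c′ : C′.Isδ θ) →
                  Rel A id (val C.compare (map τ θ , r) c) (val C′.compare (θ , r) c′)
  compare-match = uniq-match C.probδ τ σ C′.probδ probδ-match cA C.fillerδ C′.fillerδ λ θ s c c′ →
    rel-sym (C.wfill-rel (map τ θ , s) c)
    ⊙ ⟪⟫-match (fillT-match θ s c c′)
    ⊙ rel-sub A σ (C′.wfill-rel (θ , s) c′)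

  eprob-match : EMatch C.eprob τ (σ ▸▸ φ) C′.eprob
  eprob-match = record
    { pt-match   = λ θ c c′ → ln-match θ 𝟏 tt tt
    ; χ-match    = λ θ → ⊔-cong (δ-match θ) (χ-match θ)
    ; goal-match = λ θ c c′ → toᴿ
        (rel-sym (C.goalᴱ-rel (map τ θ) c) ⊙ a₁′-match θ ⊙ rel-sub A σ (C′.goalᴱ-rel θ c′))
    ; part-match = λ θ c c′ e e′ → ⊔-elim (C′.δ θ) (G′.χ θ) e′
        (λ d′ → C.partᴱ-δ (map τ θ) c e (≈-trans (≈-sym (δ-match θ)) d′)
                ⊙ fillT-match θ 𝟏 (≈-trans (≈-sym (δ-match θ)) d′) d′
                ⊙ rel-sub T (σ ▸▸ φ) (rel-sym (C′.partᴱ-δ θ c′ e′ d′)))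
        (λ d′ → C.partᴱ-χ (map τ θ) c e (≈-trans (≈-sym (χ-match θ)) d′)
                ⊙ sideT-match θ 𝟏 (≈-trans (≈-sym (χ-match θ)) d′) d′ c c′
                ⊙ rel-sub T (σ ▸▸ φ) (rel-sym (C′.partᴱ-χ θ c′ e′ d′)))
    ; path-match = λ θ r c c′ e e′ → toᴿ (⊔-elim (C′.δ θ) (G′.χ θ) e′
        (λ d′ → C.pathᴱ-δ (map τ θ , r) c e (≈-trans (≈-sym (δ-match θ)) d′)
                ⊙ compare-match θ r (≈-trans (≈-sym (δ-match θ)) d′) d′
                ⊙ rel-sub A σ (rel-sym (C′.pathᴱ-δ (θ , r) c′ e′ d′)))
        (λ d′ → C.pathᴱ-χ (map τ θ , r) c e (≈-trans (≈-sym (χ-match θ)) d′)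
                ⊙ side-match θ 𝟏 tt tt (≈-trans (≈-sym (χ-match θ)) d′) d′
                ⊙ rel-sub A σ (rel-sym (C′.pathᴱ-χ (θ , r) c′ e′ d′))))
    }

  outT-match : ∀ {I} (θ : Θ′.Pt I) .(c : C.Isφ₁ (map τ θ)) .(c′ : C′.Isφ₁ θ) →
               Rel T id (val C.outT (map τ θ) c) (val C′.outT θ c′)
  outT-match = gequiv₀-match C.eprob τ (σ ▸▸ φ) C′.eprob eprob-match O

  lineT-match : ∀ {I} (θ : Θ′.Pt I) (r : DM I) .(c : C.Isφ₁ (map τ θ)) .(c′ : C′.Isφ₁ θ) →
                Rel A id (val (gequiv₁ C.eprob E) (map τ θ , r) c) (val (gequiv₁ C′.eprob E′) (θ , r) c′)
  lineT-match θ r c c′ = fromᴿ (gequiv₁-match C.eprob τ (σ ▸▸ φ) C′.eprob eprob-match O θ r c c′)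

  prob₁-match : Match C.prob₁ τ σ C′.prob₁
  prob₁-match = record
    { ln-match   = λ θ r _ _ → ln-match θ 𝟏 tt tt
    ; χ-match    = λ θ → ⊔-cong (φᵍ-match θ 𝟏) (χ-match θ)
    ; side-match = λ θ r _ _ e e′ → ⊔-elim (C′.φ₁ θ) (G′.χ θ) e′
        (λ c′ → C.side₁-φ (map τ θ , r) e (≈-trans (≈-sym (φᵍ-match θ 𝟏)) c′)
                ⊙ lineT-match θ (∼ r) (≈-trans (≈-sym (φᵍ-match θ 𝟏)) c′) c′
                ⊙ rel-sub A σ (rel-sym (C′.side₁-φ (θ , r) e′ c′)))
        (λ d′ → C.side₁-χ (map τ θ , r) e (≈-trans (≈-sym (χ-match θ)) d′)
                ⊙ side-match θ 𝟏 tt tt (≈-trans (≈-sym (χ-match θ)) d′) d′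
                ⊙ rel-sub A σ (rel-sym (C′.side₁-χ (θ , r) e′ d′)))
    ; init-match = λ θ _ _ → a₁′-match θ
    }

  outA-match : ∀ {I} (θ : Θ′.Pt I) → Rel A id (val C.outA (map τ θ) tt) (val C′.outA θ tt)
  outA-match θ = gcomp-match C.prob₁ τ σ C′.prob₁ prob₁-match cA θ tt tt

-- Boxes as composition problems in a representable context

Yo : ∀ ℓ → FinSet → CSet ℓ
Yo ℓ I = record
  { pt = λ J → record
      { Carrier = Lift ℓ (Hom J I)
      ; _≈_ = λ f g → Lift ℓ (down f ≈ʰ down g)
      ; isEquivalence = record
          { refl  = up ≈ʰ-refl
          ; sym   = λ p → up (≈ʰ-sym (down p))
          ; trans = λ p q → up (≈ʰ-trans (down p) (down q))
          }
      }
  ; _·_    = λ f g → up (down f ∘ g)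
  ; ·-cong = λ p q → up (∘-cong (down p) q)
  ; ·-id   = λ f → up (∘-idʳ (down f))
  ; ·-∘    = λ f g h → up (∘-assoc (down f) g h)
  }

yoneda : ∀ {ℓ} {I J} → Hom J I → Yo ℓ J ⟶ Yo ℓ I
yoneda f = record
  { map      = λ g → up (f ∘ down g)
  ; map-cong = λ p → up (∘-cong (≈ʰ-refl {f = f}) (down p))
  ; map-nat  = λ g h → up (≈ʰ-sym (∘-assoc f (down g) h))
  }

module _ {ℓ} {Γ : CSet ℓ} {A : Ty Γ ℓ} where
  private
    module Γ = CSet Γ
    module A = Ty A

  module _ {I} {i : Fresh I} {ρ : Γ.Pt (I ▹ i)} (B : Box A i ρ) where
    private
      Θ = Yo ℓ I
      module Θ𝕀 = CSet (Θ ×𝕀)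
      ψ = Box.ψ B

    at-rel : ∀ {J K} (f : Hom J (I ▹ i)) (g : Hom K J) {h : Hom K (I ▹ i)} → h ≈ʰ f ∘ g →
             {ρ′ : Γ.Pt J} {ρ″ : Γ.Pt K} (p : ρ′ Γ.≈ ρ Γ.· f) (r : ρ″ Γ.≈ ρ Γ.· h)
             .(c : ψ ⟨ deg i ⟩ᶠ ⟨ f ⟩ᶠ ≈ᶠ 1F) .(d : ψ ⟨ deg i ⟩ᶠ ⟨ h ⟩ᶠ ≈ᶠ 1F) →
             Rel A g (at (u B) f p c) (at (u B) h r d)
    at-rel f g {h} e p r c d = rel q (at-nat (u B) f g h e p q r c d)
      where
      q = r Γ.⨾ Γ.split ρ e Γ.⨾ Γ.·-cong (Γ.symm p) ≈ʰ-refl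

    -- The isomorphism of y(I) × 𝕀 with y(I , i). Through it a box over `I ▹ i` becomes a problem in
    -- the representable context y(I).
    extAt : ∀ {J} → Θ𝕀.Pt J → Hom J (I ▹ i)
    extAt (f , r) = ext (down f) i r

    extAt-res : ∀ {J K} (g : Hom K J) {x : Θ𝕀.Pt J} {y : Θ𝕀.Pt K} → y Θ𝕀.≈ x Θ𝕀.· g → extAt y ≈ʰ extAt x ∘ g
    extAt-res g {f , r} (p , q) = ≈ʰ-trans (ext-cong i (down p) q) (≈ʰ-sym (ext-∘ (down f) i r g))

    ψ-ext : ∀ {J} (x : Θ𝕀.Pt J) → ψ ⟨ down (proj₁ x) ⟩ᶠ ≈ᶠ 1F → ψ ⟨ deg i ⟩ᶠ ⟨ extAt x ⟩ᶠ ≈ᶠ 1F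
    ψ-ext (f , r) p = ≈-trans (subᶠ-∘ ψ (deg i) (ext (down f) i r)) (≈-trans (subᶠ-hom ψ (deg-ext (down f) i r)) p)

    opaque
      boxSide : Sec (Θ ×𝕀) (λ x → ⊤ × ψ ⟨ down (proj₁ x) ⟩ᶠ ≈ᶠ 1F) A (λ x _ → ρ Γ.· extAt x)
      boxSide .val x c = at (u B) (extAt x) Γ.rfl (ψ-ext x (proj₂ c))
      boxSide .nat g {x} {y} p c d =
        at-rel (extAt x) g (extAt-res g {x} {y} p) Γ.rfl Γ.rfl (ψ-ext x (proj₂ c)) (ψ-ext y (proj₂ d))

      boxSide-rel : ∀ {J} (x : Θ𝕀.Pt J) (g : Hom J (I ▹ i)) → g ≈ʰ extAt x → {ρ′ : Γ.Pt J} (p : ρ′ Γ.≈ ρ Γ.· g)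
                    .(c : ψ ⟨ down (proj₁ x) ⟩ᶠ ≈ᶠ 1F) .(d : ψ ⟨ deg i ⟩ᶠ ⟨ g ⟩ᶠ ≈ᶠ 1F) →
                    Rel A id (val boxSide x (tt , c)) (at (u B) g p d)
      boxSide-rel x g e p c d = at-rel (extAt x) id (≈ʰ-trans e (≈ʰ-sym (∘-idʳ (extAt x)))) Γ.rfl p (ψ-ext x c) d

      boxInit : Sec Θ (All Θ) A (λ θ _ → ρ Γ.· extAt (θ , 𝟎))
      boxInit .val f _ = A.res (down f) (Γ.split ρ (≈ʰ-sym (face-∘ i false (down f)))) (a₀ B)
      boxInit .nat g {x} {y} p _ _ = rel-div (down p) res-rel res-rel

      boxInit-rel : ∀ {J} (f : Hom J I) → Rel A f (a₀ B) (val boxInit (up f) tt)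
      boxInit-rel f = res-rel

    boxProb : Prob A Θ (All Θ)
    boxProb .Prob.cl _ _ _ = tt
    boxProb .Prob.ln x _ = ρ Γ.· extAt x
    boxProb .Prob.ln-res g {x} {y} p _ _ = Γ.split ρ (extAt-res g {x} {y} p)
    boxProb .Prob.χ θ = ψ ⟨ down θ ⟩ᶠ
    boxProb .Prob.χ-res g {θ} {θ′} p = ≈-trans (subᶠ-hom ψ (down p)) (≈-sym (subᶠ-∘ ψ (down θ) g))
    boxProb .Prob.side = boxSide
    boxProb .Prob.init = boxInit
    boxProb .Prob.agr θ _ d =
      rel-div (≈ʰ-sym (∘-idʳ f)) (boxInit-rel f) (rel _ (a₀-agree B f (Γ.split ρ ≈ʰ-refl) Γ.rfl d))
      ⊙ rel-sym (boxSide-rel (θ , 𝟎) (face i false ∘ f) (face-∘ i false f) Γ.rfl d (one-deg ψ i false f d))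
      where
      f = down θ

  module _ {I J} {i : Fresh I} {j : Fresh J} {ρ : Γ.Pt (I ▹ i)} {ρ′ : Γ.Pt (J ▹ j)} {f : Hom J I}
           (p : ρ′ Γ.≈ ρ Γ.· lift f i j) (B : Box A i ρ) (B′ : Box A j ρ′) (R : BoxRes A f p B B′) where

    -- Under `extAt` the map `lift f i j` is `yoneda f` times the identity of the interval; this is
    -- `lift-ext`. Restriction of boxes is therefore pullback of problems.
    boxProb-match : Match (boxProb B) (yoneda f) idᶜ (prob-idᶜ (boxProb B′))
    boxProb-match = record
      { ln-match   = λ g r _ _ → Γ.after (lift f i j) (ext (down g) j r) p Γ.⨾ Γ.·-cong Γ.rfl (lift-ext f i j (down g) r)
      ; χ-match    = λ g → ≈-trans (subᶠ-cong (down g) (BoxRes.ψ-res R)) (subᶠ-∘ (Box.ψ B) f (down g))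
      ; side-match = λ g r _ _ d d′ →
          let x  = up (f ∘ down g) , r
              y  = g , r
              l  = lift f i j ∘ extAt B′ y
              d″ : Box.ψ B ⟨ f ∘ down g ⟩ᶠ ≈ᶠ 1F → Box.ψ B ⟨ deg i ⟩ᶠ ⟨ l ⟩ᶠ ≈ᶠ 1F
              d″ d = ≈-trans (subᶠ-hom (Box.ψ B ⟨ deg i ⟩ᶠ) (lift-ext f i j (down g) r)) (ψ-ext B x d)
          in boxSide-rel B x l (lift-ext f i j (down g) r) (Γ.after (lift f i j) (extAt B′ y) p) d (d″ d)
             ⊙ eq-rel (u-res R (extAt B′ y) Γ.rfl (Γ.after (lift f i j) (extAt B′ y) p) (d″ d) (ψ-ext B′ y d′))
             ⊙ rel-sym (boxSide-rel B′ y (extAt B′ y) ≈ʰ-refl Γ.rfl d′ (ψ-ext B′ y d′))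
      ; init-match = λ g _ _ →
          rel-div (≈ʰ-sym (∘-idʳ (f ∘ down g))) (boxInit-rel B (f ∘ down g))
            (rel-trans (≈ʰ-refl {f = f ∘ down g}) (rel _ (a₀-res R)) (boxInit-rel B′ (down g)))
      }

-- Elements of Glue

module GlueElements {ℓ} {Γ : CSet ℓ} (D : GlueData Γ) where
  open GlueData D
  private
    module Γ = CSet Γ
    module T = Ty T
    module A = Ty A

    El : ∀ {I} (ρ : Γ.Pt I) → Dec (map φ ρ ≈ᶠ 1F) → Set ℓ
    El ρ d = Setoid.Carrier (glueEl D ρ d)

    Eq : ∀ {I} (ρ : Γ.Pt I) (d : Dec (map φ ρ ≈ᶠ 1F)) → El ρ d → El ρ d → Set ℓ
    Eq ρ d = Setoid._≈_ (glueEl D ρ d)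

  -- The functions marked ᵈ take the decision of φρ = 1 as an argument, so that they and their laws
  -- can be given by cases on it; it is instantiated with `isOne?` in the opaque versions below.
  unglueᵈ : ∀ {I} (ρ : Γ.Pt I) (d : Dec (map φ ρ ≈ᶠ 1F)) → El ρ d → A.El ρ
  unglueᵈ ρ (yes c) x = w ⟪ ρ ,, c ⟫ x
  unglueᵈ ρ (no _)  x = base x

  sysᵈ : ∀ {I J} (ρ : Γ.Pt I) (d : Dec (map φ ρ ≈ᶠ 1F)) → El ρ d → (f : Hom J I) {ρ′ : Γ.Pt J} →
         ρ′ Γ.≈ ρ Γ.· f → .(c : map φ ρ′ ≈ᶠ 1F) → T.El (ρ′ ,, c)
  sysᵈ ρ (yes _) x f p c = T.res f p x
  sysᵈ ρ (no _)  x f p c = sys x f p c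

  unglueᵈ-cong : ∀ {I} (ρ : Γ.Pt I) (d : Dec (map φ ρ ≈ᶠ 1F)) {x y : El ρ d} → Eq ρ d x y →
                 A.Eq ρ (unglueᵈ ρ d x) (unglueᵈ ρ d y)
  unglueᵈ-cong ρ (yes c) e = ⟪⟫-cong w (ρ ,, c) e
  unglueᵈ-cong ρ (no _)  e = proj₂ e

  sysᵈ-cong : ∀ {I J} (ρ : Γ.Pt I) (d : Dec (map φ ρ ≈ᶠ 1F)) {x y : El ρ d} → Eq ρ d x y →
              (f : Hom J I) {ρ′ : Γ.Pt J} (p : ρ′ Γ.≈ ρ Γ.· f) .(c : map φ ρ′ ≈ᶠ 1F) →
              T.Eq (ρ′ ,, c) (sysᵈ ρ d x f p c) (sysᵈ ρ d y f p c)
  sysᵈ-cong ρ (yes _) e f p c = T.res-cong ≈ʰ-refl e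
  sysᵈ-cong ρ (no _)  e f p c = proj₁ e f p c

  -- When φρ = 1 the T-component along `id` is the element itself, so the T-components alone
  -- determine it. Otherwise the two hypotheses are the definition of equality of triples.
  glue-ext : ∀ {I} (ρ : Γ.Pt I) (d : Dec (map φ ρ ≈ᶠ 1F)) {x y : El ρ d} →
             A.Eq ρ (unglueᵈ ρ d x) (unglueᵈ ρ d y) →
             (∀ {J} (f : Hom J I) {ρ′ : Γ.Pt J} (p : ρ′ Γ.≈ ρ Γ.· f) .(c : map φ ρ′ ≈ᶠ 1F) →
               T.Eq (ρ′ ,, c) (sysᵈ ρ d x f p c) (sysᵈ ρ d y f p c)) → Eq ρ d x y
  glue-ext ρ (yes c) {x} {y} _ s =
    T.Eq-trans (ρ ,, c) (T.Eq-sym (ρ ,, c) (T.res-id x))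
      (T.Eq-trans (ρ ,, c) (s id (Γ.symm (Γ.·-id ρ)) c) (T.res-id y))
  glue-ext ρ (no _) e s = s , e

  unglueᵈ-res : ∀ {I J} {ρ : Γ.Pt I} {ρ′ : Γ.Pt J} (d : Dec (map φ ρ ≈ᶠ 1F)) (d′ : Dec (map φ ρ′ ≈ᶠ 1F))
                (f : Hom J I) (p : ρ′ Γ.≈ ρ Γ.· f) (x : El ρ d) →
                Rel A f (unglueᵈ ρ d x) (unglueᵈ ρ′ d′ (glueRes D d d′ f p x))
  unglueᵈ-res (yes _) (yes _)  f p x = w-rel D res-rel
  unglueᵈ-res (yes c) (no ¬c′) f p x = ⊥-elim (¬c′ (one-res D f p c))
  unglueᵈ-res {ρ′ = ρ′} (no _) (yes c′) f p x = rel p (A.Eq-sym ρ′ (agree x f p c′))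
  unglueᵈ-res (no _)  (no _)   f p x = res-rel

  sysᵈ-nat : ∀ {I J K} {ρ : Γ.Pt I} (d : Dec (map φ ρ ≈ᶠ 1F)) (x : El ρ d) (f : Hom J I) (g : Hom K J) {h : Hom K I} →
             h ≈ʰ f ∘ g → {ρ′ : Γ.Pt J} {ρ″ : Γ.Pt K} (p : ρ′ Γ.≈ ρ Γ.· f) (r : ρ″ Γ.≈ ρ Γ.· h)
             .(c : map φ ρ′ ≈ᶠ 1F) .(c′ : map φ ρ″ ≈ᶠ 1F) → Rel T g (sysᵈ ρ d x f p c) (sysᵈ ρ d x h r c′)
  sysᵈ-nat (yes _) x f g e p r c c′ = rel-div e res-rel res-rel
  sysᵈ-nat {ρ = ρ} (no _) x f g e p r c c′ = rel q (sys-nat x f g _ e p q r c c′)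
    where
    q = r Γ.⨾ Γ.split ρ e Γ.⨾ Γ.·-cong (Γ.symm p) ≈ʰ-refl

  sysᵈ-res : ∀ {I J K} {ρ : Γ.Pt I} {ρ′ : Γ.Pt J} (d : Dec (map φ ρ ≈ᶠ 1F)) (d′ : Dec (map φ ρ′ ≈ᶠ 1F))
             (f : Hom J I) (p : ρ′ Γ.≈ ρ Γ.· f) (x : El ρ d) (g : Hom K J) {ρ″ : Γ.Pt K} (q : ρ″ Γ.≈ ρ′ Γ.· g)
             (r : ρ″ Γ.≈ ρ Γ.· (f ∘ g)) .(c : map φ ρ″ ≈ᶠ 1F) →
             T.Eq (ρ″ ,, c) (sysᵈ ρ′ d′ (glueRes D d d′ f p x) g q c) (sysᵈ ρ d x (f ∘ g) r c)
  sysᵈ-res (yes _) (yes _)  f p x g q r c = T.res-∘ f g x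
  sysᵈ-res (yes c) (no ¬c′) f p x g q r _ = ⊥-elim (¬c′ (one-res D f p c))
  sysᵈ-res (no _)  (yes c′) f p x g q r c = sys-nat x f g (f ∘ g) ≈ʰ-refl p q r c′ c
  sysᵈ-res (no _)  (no _)   f p x g q r c = sys-hom x (≈ʰ-refl {f = f ∘ g}) (q Γ.⨾ Γ.after f g p) r c

  sysᵈ-w : ∀ {I J} {ρ : Γ.Pt I} (d : Dec (map φ ρ ≈ᶠ 1F)) (x : El ρ d) (f : Hom J I) {ρ′ : Γ.Pt J} (p : ρ′ Γ.≈ ρ Γ.· f)
           .(c : map φ ρ′ ≈ᶠ 1F) → Rel A f (unglueᵈ ρ d x) (w ⟪ ρ′ ,, c ⟫ sysᵈ ρ d x f p c)
  sysᵈ-w (yes _) x f p c = w-rel D res-rel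
  sysᵈ-w (no _)  x f {ρ′} p c = rel p (A.Eq-sym ρ′ (agree x f p c))

  mkᵈ : ∀ {I} (ρ : Γ.Pt I) (d : Dec (map φ ρ ≈ᶠ 1F)) → Triple D ρ → El ρ d
  mkᵈ ρ (yes c) t = sys t id (Γ.symm (Γ.·-id ρ)) c
  mkᵈ ρ (no _)  t = t

  unglueᵈ-mk : ∀ {I} (ρ : Γ.Pt I) (d : Dec (map φ ρ ≈ᶠ 1F)) (t : Triple D ρ) → A.Eq ρ (unglueᵈ ρ d (mkᵈ ρ d t)) (base t)
  unglueᵈ-mk ρ (yes c) t = A.Eq-trans ρ (agree t id (Γ.symm (Γ.·-id ρ)) c) (A.res-id (base t))
  unglueᵈ-mk ρ (no _)  t = A.Eq-refl ρ

  sysᵈ-mk : ∀ {I J} (ρ : Γ.Pt I) (d : Dec (map φ ρ ≈ᶠ 1F)) (t : Triple D ρ) (f : Hom J I) {ρ′ : Γ.Pt J}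
            (p : ρ′ Γ.≈ ρ Γ.· f) .(c : map φ ρ′ ≈ᶠ 1F) → T.Eq (ρ′ ,, c) (sysᵈ ρ d (mkᵈ ρ d t) f p c) (sys t f p c)
  sysᵈ-mk ρ (yes c′) t f p c = sys-nat t id f f (≈ʰ-sym (∘-idˡ f)) (Γ.symm (Γ.·-id ρ)) p p c′ c
  sysᵈ-mk ρ (no _) t f {ρ′} p c = T.Eq-refl (ρ′ ,, c)

  module G = Ty (Glue D)

  opaque
    unglue : ∀ {I} (ρ : Γ.Pt I) → G.El ρ → A.El ρ
    unglue ρ = unglueᵈ ρ (isOne? (map φ ρ))

    sysᴳ : ∀ {I J} (ρ : Γ.Pt I) → G.El ρ → (f : Hom J I) {ρ′ : Γ.Pt J} → ρ′ Γ.≈ ρ Γ.· f → .(c : map φ ρ′ ≈ᶠ 1F) → T.El (ρ′ ,, c)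
    sysᴳ ρ = sysᵈ ρ (isOne? (map φ ρ))

    mkᴳ : ∀ {I} (ρ : Γ.Pt I) → Triple D ρ → G.El ρ
    mkᴳ ρ = mkᵈ ρ (isOne? (map φ ρ))

    unglue-mk : ∀ {I} (ρ : Γ.Pt I) (t : Triple D ρ) → A.Eq ρ (unglue ρ (mkᴳ ρ t)) (base t)
    unglue-mk ρ = unglueᵈ-mk ρ (isOne? (map φ ρ))

    sys-mk : ∀ {I J} (ρ : Γ.Pt I) (t : Triple D ρ) (f : Hom J I) {ρ′ : Γ.Pt J}
             (p : ρ′ Γ.≈ ρ Γ.· f) .(c : map φ ρ′ ≈ᶠ 1F) → T.Eq (ρ′ ,, c) (sysᴳ ρ (mkᴳ ρ t) f p c) (sys t f p c)
    sys-mk ρ = sysᵈ-mk ρ (isOne? (map φ ρ))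

    unglue-rel : ∀ {I J} {ρ : Γ.Pt I} {ρ′ : Γ.Pt J} {f : Hom J I} {x : G.El ρ} {y : G.El ρ′} →
                 Rel (Glue D) {ρ = ρ} {ρ′} f x y → Rel A f (unglue ρ x) (unglue ρ′ y)
    unglue-rel {ρ = ρ} {ρ′} {f} {x} r =
      unglueᵈ-res (isOne? (map φ ρ)) (isOne? (map φ ρ′)) f (over r) x
      ▻ eq-rel (unglueᵈ-cong ρ′ (isOne? (map φ ρ′)) (equal r))

    sys-rel : ∀ {I J K} {ρ : Γ.Pt I} {ρ′ : Γ.Pt J} {f : Hom J I} {x : G.El ρ} {y : G.El ρ′} →
              Rel (Glue D) {ρ = ρ} {ρ′} f x y → (g : Hom K J) {h : Hom K I} → h ≈ʰ f ∘ g → {ρ″ : Γ.Pt K} (q : ρ″ Γ.≈ ρ′ Γ.· g)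
              (r : ρ″ Γ.≈ ρ Γ.· h) .(c : map φ ρ″ ≈ᶠ 1F) → Rel T id (sysᴳ ρ x h r c) (sysᴳ ρ′ y g q c)
    sys-rel {ρ = ρ} {ρ′} {f} {x} e g {h} eq q r c =
      sysᵈ-nat (isOne? (map φ ρ)) x h id (≈ʰ-trans (≈ʰ-sym eq) (≈ʰ-sym (∘-idʳ h))) r (q Γ.⨾ Γ.after f g (over e)) c c
      ⊙ rel-sym (eq-rel (sysᵈ-res (isOne? (map φ ρ)) (isOne? (map φ ρ′)) f (over e) x g q (q Γ.⨾ Γ.after f g (over e)) c))
      ⊙ eq-rel (sysᵈ-cong ρ′ (isOne? (map φ ρ′)) (equal e) g q c)

    sysᴳ-nat : ∀ {I J K} {ρ : Γ.Pt I} (x : G.El ρ) (f : Hom J I) (g : Hom K J) {h : Hom K I} →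
             h ≈ʰ f ∘ g → {ρ′ : Γ.Pt J} {ρ″ : Γ.Pt K} (p : ρ′ Γ.≈ ρ Γ.· f) (r : ρ″ Γ.≈ ρ Γ.· h)
             .(c : map φ ρ′ ≈ᶠ 1F) .(c′ : map φ ρ″ ≈ᶠ 1F) → Rel T g (sysᴳ ρ x f p c) (sysᴳ ρ x h r c′)
    sysᴳ-nat {ρ = ρ} = sysᵈ-nat (isOne? (map φ ρ))

    sysᴳ-w : ∀ {I J} {ρ : Γ.Pt I} (x : G.El ρ) (f : Hom J I) {ρ′ : Γ.Pt J} (p : ρ′ Γ.≈ ρ Γ.· f)
           .(c : map φ ρ′ ≈ᶠ 1F) → Rel A f (unglue ρ x) (w ⟪ ρ′ ,, c ⟫ sysᴳ ρ x f p c)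
    sysᴳ-w {ρ = ρ} = sysᵈ-w (isOne? (map φ ρ))

    -- Extensionality across a restriction. It reduces the boundary, naturality and substitution
    -- laws of the composition to separate statements about the sections `outA` and `outT`.
    glue-rel : ∀ {I J} {ρ : Γ.Pt I} {ρ′ : Γ.Pt J} {f : Hom J I} {x : G.El ρ} {y : G.El ρ′} → ρ′ Γ.≈ ρ Γ.· f →
               Rel A f (unglue ρ x) (unglue ρ′ y) →
               (∀ {K} (g : Hom K J) {ρ″ : Γ.Pt K} (q : ρ″ Γ.≈ ρ′ Γ.· g) (r : ρ″ Γ.≈ ρ Γ.· (f ∘ g)) .(c : map φ ρ″ ≈ᶠ 1F) →
                 Rel T id (sysᴳ ρ x (f ∘ g) r c) (sysᴳ ρ′ y g q c)) →
               Rel (Glue D) {ρ = ρ} {ρ′} f x y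
    glue-rel {ρ = ρ} {ρ′} {f} {x} {y} p a s = rel p (glue-ext ρ′ (isOne? (map φ ρ′))
      (rel-id-eq (rel-div (≈ʰ-sym (∘-idʳ f)) (unglueᵈ-res (isOne? (map φ ρ)) (isOne? (map φ ρ′)) f p x) a))
      λ g q c → rel-id-eq
        (eq-rel (sysᵈ-res (isOne? (map φ ρ)) (isOne? (map φ ρ′)) f p x g q (q Γ.⨾ Γ.after f g p) c)
         ⊙ s g q (q Γ.⨾ Γ.after f g p) c))

  toT : ∀ {I} (ρ : Γ.Pt I) → G.El ρ → .(c : map φ ρ ≈ᶠ 1F) → T.El (ρ ,, c)
  toT ρ x c = sysᴳ ρ x id (Γ.symm (Γ.·-id ρ)) c

  sys-toT : ∀ {I J} {ρ : Γ.Pt I} {ρ′ : Γ.Pt J} {f : Hom J I} {x : G.El ρ} {y : G.El ρ′} →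
            Rel (Glue D) {ρ = ρ} {ρ′} f x y → {ρ″ : Γ.Pt J} (p : ρ″ Γ.≈ ρ Γ.· f) .(c : map φ ρ″ ≈ᶠ 1F) .(c′ : map φ ρ′ ≈ᶠ 1F) →
            Rel T id (sysᴳ ρ x f p c) (toT ρ′ y c′)
  sys-toT {ρ′ = ρ′} {f} {x} r p c c′ =
    sysᴳ-nat x f id (≈ʰ-sym (∘-idʳ f)) p (over r) c c′
    ⊙ sys-rel r id (≈ʰ-sym (∘-idʳ f)) (Γ.symm (Γ.·-id ρ′)) (over r) c′

  toT-rel : ∀ {I J} {ρ : Γ.Pt I} {ρ′ : Γ.Pt J} {f : Hom J I} {x : G.El ρ} {y : G.El ρ′} →
            Rel (Glue D) {ρ = ρ} {ρ′} f x y → .(c : map φ ρ ≈ᶠ 1F) .(c′ : map φ ρ′ ≈ᶠ 1F) →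
            Rel T f (toT ρ x c) (toT ρ′ y c′)
  toT-rel {ρ = ρ} {f = f} {x} r c c′ =
    sysᴳ-nat x id f (≈ʰ-sym (∘-idˡ f)) (Γ.symm (Γ.·-id ρ)) (over r) c c′ ▻ sys-toT r (over r) c′ c′

  toT-w : ∀ {I} {ρ : Γ.Pt I} (x : G.El ρ) .(c : map φ ρ ≈ᶠ 1F) → Rel A id (unglue ρ x) (w ⟪ ρ ,, c ⟫ toT ρ x c)
  toT-w {ρ = ρ} x c = sysᴳ-w x id (Γ.symm (Γ.·-id ρ)) c

-- Splitting a problem in `Glue` into its components in A and T.

module _ {ℓ} {Γ : CSet ℓ} (D : GlueData Γ) {Θ : CSet ℓ} (P : Prob (Glue D) Θ (All Θ)) where
  open GlueData D
  open GlueElements D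
  private
    module Γ = CSet Γ
    module Θ = CSet Θ
    module Θ𝕀 = CSet (Θ ×𝕀)
    module P = Prob P

    lnᴾ : ∀ {I} → Θ𝕀.Pt I → Γ.Pt I
    lnᴾ x = P.ln x tt

  opaque
    unglueSide : Sec (Θ ×𝕀) (λ x → ⊤ × P.χ (proj₁ x) ≈ᶠ 1F) A (λ x _ → lnᴾ x)
    unglueSide .val x c = unglue (lnᴾ x) (val P.side x c)
    unglueSide .nat f p c c′ = unglue-rel (nat P.side f p c c′)

    unglueSide-rel : ∀ {I} (x : Θ𝕀.Pt I) .(d : P.χ (proj₁ x) ≈ᶠ 1F) →
                     Rel A id (unglue (lnᴾ x) (val P.side x (tt , d))) (val unglueSide x (tt , d))
    unglueSide-rel x d = eq-rel (Ty.Eq-refl A _)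

    unglueInit : Sec Θ (All Θ) A (λ θ _ → lnᴾ (θ , 𝟎))
    unglueInit .val θ c = unglue (lnᴾ (θ , 𝟎)) (val P.init θ tt)
    unglueInit .nat f p c c′ = unglue-rel (nat P.init f p tt tt)

    unglueInit-rel : ∀ {I} (θ : Θ.Pt I) → Rel A id (unglue (lnᴾ (θ , 𝟎)) (val P.init θ tt)) (val unglueInit θ tt)
    unglueInit-rel θ = eq-rel (Ty.Eq-refl A _)

    toTSide : Sec (Θ ×𝕀) (λ x → P.χ (proj₁ x) ≈ᶠ 1F × map φ (lnᴾ x) ≈ᶠ 1F) T (λ x c → lnᴾ x ,, proj₂ c)
    toTSide .val x c = toT (lnᴾ x) (val P.side x (tt , proj₁ c)) (proj₂ c)
    toTSide .nat f p c c′ = toT-rel (nat P.side f p (tt , proj₁ c) (tt , proj₁ c′)) (proj₂ c) (proj₂ c′)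

    toTSide-rel : ∀ {I} (x : Θ𝕀.Pt I) .(d : P.χ (proj₁ x) ≈ᶠ 1F) .(c : map φ (lnᴾ x) ≈ᶠ 1F) →
                  Rel T id (toT (lnᴾ x) (val P.side x (tt , d)) c) (val toTSide x (d , c))
    toTSide-rel x d c = eq-rel (Ty.Eq-refl T _)

    toTInit : Sec Θ (λ θ → map φ (lnᴾ (θ , 𝟎)) ≈ᶠ 1F) T (λ θ c → lnᴾ (θ , 𝟎) ,, c)
    toTInit .val θ c = toT (lnᴾ (θ , 𝟎)) (val P.init θ tt) c
    toTInit .nat f p c c′ = toT-rel (nat P.init f p tt tt) c c′

    toTInit-rel : ∀ {I} (θ : Θ.Pt I) .(c : map φ (lnᴾ (θ , 𝟎)) ≈ᶠ 1F) →
                  Rel T id (toT (lnᴾ (θ , 𝟎)) (val P.init θ tt) c) (val toTInit θ c)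
    toTInit-rel θ c = eq-rel (Ty.Eq-refl T _)

  unglueProb : Prob A Θ (All Θ)
  unglueProb .Prob.cl = P.cl
  unglueProb .Prob.ln = P.ln
  unglueProb .Prob.ln-res = P.ln-res
  unglueProb .Prob.χ = P.χ
  unglueProb .Prob.χ-res = P.χ-res
  unglueProb .Prob.side = unglueSide
  unglueProb .Prob.init = unglueInit
  unglueProb .Prob.agr θ _ d =
    rel-sym (unglueInit-rel θ) ⊙ unglue-rel (P.agr θ tt d) ⊙ unglueSide-rel (θ , 𝟎) d

  gprob : GProb D Θ
  gprob .GProb.probA = unglueProb
  gprob .GProb.sideT = toTSide
  gprob .GProb.sideW x d c =
    w-rel D (rel-sym (toTSide-rel x d c)) ⊙ rel-sym (toT-w (val P.side x (tt , d)) c) ⊙ unglueSide-rel x d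
  gprob .GProb.initT = toTInit
  gprob .GProb.initW θ c =
    w-rel D (rel-sym (toTInit-rel θ c)) ⊙ rel-sym (toT-w (val P.init θ tt) c) ⊙ unglueInit-rel θ
  gprob .GProb.agrT θ d c =
    rel-sym (toTInit-rel θ c) ⊙ toT-rel (P.agr θ tt d) c c ⊙ toTSide-rel (θ , 𝟎) d c

-- Change of context over a fixed base.

module _ {ℓ} {Γ : CSet ℓ} (D : GlueData Γ) where
  open GlueData D
  private
    module Γ = CSet Γ
    Did = subGlueData idᶜ D

  rel-▸-idᶜ : ∀ {I J} {ρ : Γ.Pt I} {ρ′ : Γ.Pt J} .{c : map φ ρ ≈ᶠ 1F} .{c′ : map φ ρ′ ≈ᶠ 1F} {f : Hom J I}
              {x : Ty.El T (ρ ,, c)} {y : Ty.El T (ρ′ ,, c′)} → Rel T f x y →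
              Rel (T [ idᶜ ▸▸ φ ]) {ρ = ρ ,, c} {ρ′ ,, c′} f x y
  rel-▸-idᶜ r = rel (over r) (rel-eq r _)

  module _ {Θ : CSet ℓ} (G : GProb D Θ) where
    private
      module G = GProb G

    opaque
      sideT-idᶜ : Sec (Θ ×𝕀) (λ x → G.χ (proj₁ x) ≈ᶠ 1F × G.φᵍ x ≈ᶠ 1F) (T [ idᶜ ▸▸ φ ]) (λ x c → G.lnᵍ x ,, proj₂ c)
      sideT-idᶜ .val = val G.sideT
      sideT-idᶜ .nat f p c c′ = rel-▸-idᶜ (nat G.sideT f p c c′)

      sideT-idᶜ-rel : ∀ {I} (x : CSet.Pt (Θ ×𝕀) I) .(d : G.χ (proj₁ x) ≈ᶠ 1F) .(c : G.φᵍ x ≈ᶠ 1F) →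
                      Rel T id (val G.sideT x (d , c)) (val sideT-idᶜ x (d , c))
      sideT-idᶜ-rel x d c = eq-rel (Ty.Eq-refl T _)

      initT-idᶜ : Sec Θ (λ θ → G.φᵍ (θ , 𝟎) ≈ᶠ 1F) (T [ idᶜ ▸▸ φ ]) (λ θ c → G.lnᵍ (θ , 𝟎) ,, c)
      initT-idᶜ .val = val G.initT
      initT-idᶜ .nat f p c c′ = rel-▸-idᶜ (nat G.initT f p c c′)

      initT-idᶜ-rel : ∀ {I} (θ : CSet.Pt Θ I) .(c : G.φᵍ (θ , 𝟎) ≈ᶠ 1F) → Rel T id (val G.initT θ c) (val initT-idᶜ θ c)
      initT-idᶜ-rel θ c = eq-rel (Ty.Eq-refl T _)

    ⟪⟫-idᶜ : ∀ {I} {ρ : Γ.Pt I} .{c : map φ ρ ≈ᶠ 1F} {x y : Ty.El T (ρ ,, c)} → Rel T id x y →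
             Rel A id (GlueData.w Did ⟪ ρ ,, c ⟫ y) (w ⟪ ρ ,, c ⟫ x)
    ⟪⟫-idᶜ {ρ = ρ} {c} {x} {y} r = eq-rel (subTm-⟪⟫ T (restrictTo φ A) (idᶜ ▸▸ φ) w (ρ ,, c) y) ⊙ w-rel D (rel-sym r)

    gprob-idᶜ : GProb Did Θ
    gprob-idᶜ .GProb.probA = prob-idᶜ G.probA
    gprob-idᶜ .GProb.sideT = sideT-idᶜ
    gprob-idᶜ .GProb.sideW x d c = rel-sub-idᶜ (⟪⟫-idᶜ (sideT-idᶜ-rel x d c) ⊙ G.sideW x d c)
    gprob-idᶜ .GProb.initT = initT-idᶜ
    gprob-idᶜ .GProb.initW θ c = rel-sub-idᶜ (⟪⟫-idᶜ (initT-idᶜ-rel θ c) ⊙ G.initW θ c)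
    gprob-idᶜ .GProb.agrT θ d c =
      rel-▸-idᶜ (rel-sym (initT-idᶜ-rel θ c) ⊙ G.agrT θ d c ⊙ sideT-idᶜ-rel (θ , 𝟎) d c)

    gmatch-idᶜ : GMatch D idᶜ G idᶜ gprob-idᶜ
    gmatch-idᶜ = record
      { probA-match = match-idᶜ G.probA
      ; sideT-match = λ θ r d d′ c c′ → sideT-idᶜ-rel (θ , r) d c
      ; initT-match = λ θ c c′ → initT-idᶜ-rel θ c
      }

  module OutSub (cA : Comp A) (cT : Comp T) (E : EquivStr w) {Θ Θ′ : CSet ℓ} (G : GProb D Θ) (τ : Θ′ ⟶ Θ)
                (G′ : GProb D Θ′) (M : GMatch D idᶜ G τ (gprob-idᶜ G′)) where
    private
      module C = Core D cA cT E G
      module C′ = Core D cA cT E G′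
      E′ = subEquiv T (restrictTo φ A) (idᶜ ▸▸ φ) w E
      O = subEquiv-over T (restrictTo φ A) (idᶜ ▸▸ φ) w E
      module M = CoreMatch D cA cT E idᶜ E′ O G τ (gprob-idᶜ G′) M
      module M′ = CoreMatch D cA cT E idᶜ E′ O G′ idᶜ (gprob-idᶜ G′) (gmatch-idᶜ G′)

    -- The data substituted along the identity are not definitionally those of `D`. Both outputs are
    -- therefore compared with the output for one and the same substituted problem.
    outA-sub : ∀ {I} (θ : CSet.Pt Θ′ I) → Rel A id (val C.outA (map τ θ) tt) (val C′.outA θ tt)
    outA-sub θ = M.outA-match θ ⊙ rel-sym (M′.outA-match θ)

    outT-sub : ∀ {I} (θ : CSet.Pt Θ′ I) .(c : C.Isφ₁ (map τ θ)) .(c′ : C′.Isφ₁ θ) →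
               Rel T id (val C.outT (map τ θ) c) (val C′.outT θ c′)
    outT-sub θ c c′ = M.outT-match θ c c′ ⊙ rel-sym (M′.outT-match θ c′ c′)

  module _ {Θ Θ′ : CSet ℓ} (P : Prob (Glue D) Θ (All Θ)) (τ : Θ′ ⟶ Θ) (P′ : Prob (Glue D) Θ′ (All Θ′))
           (M : Match P τ idᶜ (prob-idᶜ P′)) where
    open GlueElements D
    open Match M

    gprob-match : GMatch D idᶜ (gprob D P) τ (gprob-idᶜ (gprob D P′))
    gprob-match = record
      { probA-match = record
        { ln-match   = ln-match
        ; χ-match    = χ-match
        ; side-match = λ θ r _ _ d d′ →
            rel-sym (unglueSide-rel D P (map τ θ , r) d) ⊙ unglue-rel (side-match θ r tt tt d d′)
            ⊙ unglueSide-rel D P′ (θ , r) d′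
        ; init-match = λ θ _ _ →
            rel-sym (unglueInit-rel D P (map τ θ)) ⊙ unglue-rel (init-match θ tt tt) ⊙ unglueInit-rel D P′ θ
        }
      ; sideT-match = λ θ r d d′ c c′ →
          rel-sym (toTSide-rel D P (map τ θ , r) d c)
          ⊙ toT-rel (side-match θ r tt tt d d′) c c′
          ⊙ toTSide-rel D P′ (θ , r) d′ c′
          ⊙ sideT-idᶜ-rel (gprob D P′) (θ , r) d′ c′
      ; initT-match = λ θ c c′ →
          rel-sym (toTInit-rel D P (map τ θ) c)
          ⊙ toT-rel (init-match θ tt tt) c c′
          ⊙ toTInit-rel D P′ θ c′
          ⊙ initT-idᶜ-rel (gprob D P′) θ c′
      }

-- The composition structure on `Glue`.

module GlueComposition {ℓ} {Γ : CSet ℓ} (D : GlueData Γ) (S : FibrantGlueData D) where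
  open GlueData D
  open FibrantGlueData S renaming (compA to cA; compT to cT; equivw to E)
  open GlueElements D
  private
    module Γ = CSet Γ
    module T = Ty T
    module A = Ty A

  boxGProb : ∀ {I} {i : Fresh I} {ρ : Γ.Pt (I ▹ i)} → Box (Glue D) i ρ → GProb D (Yo ℓ I)
  boxGProb B = gprob D (boxProb B)

  module _ {I} {i : Fresh I} {ρ : Γ.Pt (I ▹ i)} (B : Box (Glue D) i ρ) where
    module C = Core D cA cT E (boxGProb B)
    private
      ρ₁ = ρ Γ.· face i true

    end≈ : ∀ {J} (f : Hom J I) → ρ₁ Γ.· f Γ.≈ ρ Γ.· ext f i 𝟏
    end≈ f = Γ.·-∘ ρ (face i true) f Γ.⨾ Γ.·-cong Γ.rfl (face-∘ i true f)

    φ-end : ∀ {J} (f : Hom J I) {ρ′ : Γ.Pt J} → ρ′ Γ.≈ ρ₁ Γ.· f → map φ ρ′ ≈ᶠ 1F → map φ (ρ Γ.· ext f i 𝟏) ≈ᶠ 1F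
    φ-end f p c = ≈-trans (map-cong φ (Γ.symm (p Γ.⨾ end≈ f))) c

    opaque
      result : Triple D ρ₁
      result = record
        { sys     = λ f p c → T.cast (p Γ.⨾ end≈ f) (val C.outT (up f) (φ-end f p c))
        ; sys-nat = λ f g h e p q r c d →
            rel-eq (rel-sym cast-rel ◅ nat C.outT g (up e) (φ-end f p c) (φ-end h r d) ▻ cast-rel) q
        ; base    = A.cast (Γ.symm (Γ.·-id ρ₁) Γ.⨾ end≈ id) (val C.outA (up id) tt)
        ; agree   = λ f p c → rel-id-eq
            ( w-rel D (rel-sym cast-rel) ⊙ C.outW (up f) (φ-end f p c)
            ⊙ rel-div (≈ʰ-sym (∘-idʳ f)) (nat C.outA f (up (≈ʰ-sym (∘-idˡ f))) tt tt) (cast-rel ◅ res-rel))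
        }

      result-A : Rel A id (val C.outA (up id) tt) (base result)
      result-A = cast-rel

      result-T : ∀ {J} (f : Hom J I) {ρ′ : Γ.Pt J} (p : ρ′ Γ.≈ ρ₁ Γ.· f) .(c : map φ ρ′ ≈ᶠ 1F) →
                 Rel T id (val C.outT (up f) (φ-end f p c)) (sys result f p c)
      result-T f p c = cast-rel

    glueResult : G.El ρ₁
    glueResult = mkᴳ ρ₁ result

    glueResult-A : Rel A id (val C.outA (up id) tt) (unglue ρ₁ glueResult)
    glueResult-A = result-A ⊙ rel-sym (eq-rel (unglue-mk ρ₁ result))

    glueResult-T : ∀ {J} (f : Hom J I) {ρ′ : Γ.Pt J} (p : ρ′ Γ.≈ ρ₁ Γ.· f) .(c : map φ ρ′ ≈ᶠ 1F) →
                   Rel T id (val C.outT (up f) (φ-end f p c)) (sysᴳ ρ₁ glueResult f p c)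
    glueResult-T f p c = result-T f p c ⊙ rel-sym (eq-rel (sys-mk ρ₁ result f p c))

    glueResult-one : .(c : Box.ψ B ≈ᶠ 1F) → Rel (Glue D) {ρ = ρ₁} {ρ₁} id glueResult
                       (at (u B) (face i true) Γ.rfl (one-sub (face i true) (one-sub (deg i) c)))
    glueResult-one c = glue-rel (Γ.symm (Γ.·-id ρ₁))
      (rel-sym glueResult-A
       ⊙ C.outA-side (up id) (one-sub id c)
       ⊙ rel-sym (unglueSide-rel D (boxProb B) (up id , 𝟏) (one-sub id c))
       ⊙ unglue-rel (boxSide-rel B (up id , 𝟏) (face i true) (face-ext i true)
           Γ.rfl (one-sub id c) (one-sub (face i true) (one-sub (deg i) c))))
      λ g q r c₁ →
        rel-sym (glueResult-T (id ∘ g) r c₁)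
        ⊙ C.outT-side (up (id ∘ g)) (φ-end (id ∘ g) r c₁) (one-sub (id ∘ g) c)
        ⊙ rel-sym (toTSide-rel D (boxProb B) (up (id ∘ g) , 𝟏) (one-sub (id ∘ g) c) (φ-end (id ∘ g) r c₁))
        ⊙ rel-sym (sys-toT
            (at-rel B (face i true) g
               (≈ʰ-trans (ext-cong i (∘-idˡ g) ≈-refl) (≈ʰ-sym (face-∘ i true g))) Γ.rfl Γ.rfl
               (one-sub (face i true) (one-sub (deg i) c)) (ψ-ext B (up (id ∘ g) , 𝟏) (one-sub (id ∘ g) c))
             ▻ rel-sym (boxSide-rel B (up (id ∘ g) , 𝟏) (ext (id ∘ g) i 𝟏) ≈ʰ-refl Γ.rfl (one-sub (id ∘ g) c)
                 (ψ-ext B (up (id ∘ g) , 𝟏) (one-sub (id ∘ g) c))))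
            q c₁ (φ-end (id ∘ g) r c₁))

  module _ {I J} {i : Fresh I} {j : Fresh J} {ρ : Γ.Pt (I ▹ i)} {ρ′ : Γ.Pt (J ▹ j)} (f : Hom J I)
           (p : ρ′ Γ.≈ ρ Γ.· lift f i j) (B : Box (Glue D) i ρ) (B′ : Box (Glue D) j ρ′) (R : BoxRes (Glue D) f p B B′) where
    private
      module O = OutSub D cA cT E (boxGProb B) (yoneda f) (boxGProb B′)
                   (gprob-match D (boxProb B) (yoneda f) (boxProb B′) (boxProb-match p B B′ R))

    -- For the A-component, naturality inside the context y(I) leads from `id` to `f`. As `f` is the
    -- image of `id` under `yoneda f`, `outA-sub` then passes to the context y(J). The T-components
    -- are values at maps `f ∘ g`, so only the second step occurs there.
    glueResult-nat : Rel (Glue D) {ρ = ρ Γ.· face i true} {ρ′ Γ.· face j true} f (glueResult B) (glueResult B′)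
    glueResult-nat = glue-rel (Γ.square p (lift-face f i j true))
      (rel-sym (glueResult-A B)
       ◅ nat (C.outA B) f {up id} {up (f ∘ id)} (up (≈ʰ-trans (∘-idʳ f) (≈ʰ-sym (∘-idˡ f)))) tt tt
       ▻ O.outA-sub (up id) ⊙ glueResult-A B′)
      λ g q r c → rel-sym (glueResult-T B (f ∘ g) r c)
        ⊙ O.outT-sub (up g) (φ-end B (f ∘ g) r c) (φ-end B′ g q c)
        ⊙ glueResult-T B′ g q c

  glueComp : Comp (Glue D)
  glueComp = record
    { comp     = λ i ρ B → glueResult B
    ; comp-nat = λ {_} {_} {i} {j} f p B B′ R → rel-eq (glueResult-nat f p B B′ R) (Γ.square p (lift-face f i j true))
    ; comp-one = λ i ρ B c → rel-id-eq (glueResult-one B c)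
    }

-- The case φ = 1

module _ {ℓ} {Γ : CSet ℓ} (D : GlueData Γ) (S : FibrantGlueData D)
         (h : ∀ {I} (ρ : CSet.Pt Γ I) → map (GlueData.φ D) ρ ≈ᶠ 1F) where
  open GlueData D
  open FibrantGlueData S renaming (compA to cA; compT to cT; equivw to E)
  open GlueElements D
  open GlueComposition D S
  private
    module Γ = CSet Γ
    module T = Ty T
    ≅T = Glue≅T D h

  opaque
    unfolding sysᴳ

    to-toT : ∀ {I} (ρ : Γ.Pt I) (x : G.El ρ) → Rel T id (toT ρ x (h ρ)) (_≅_.to ≅T {ρ = ρ} x)
    to-toT ρ x with isOne? (map φ ρ)
    ... | yes c = rel-sym res-rel
    ... | no ¬c = ⊥-elim (¬c (h ρ))

  module _ {I} {i : Fresh I} {ρ : Γ.Pt (I ▹ i)} (B : Box (Glue D) i ρ) where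
    private
      module P = Core D cA cT E (boxGProb B)
      B′ = subBox T (total φ h) (toBox ≅T B)

      δ₁ : P.Isδ (up id)
      δ₁ = P.δ-one (λ x → h _) (up id)

    -- `B`, read in `T` and keeping its own name `i`, represents the problem composed over δ. By
    -- `gcomp-rep` that composite is therefore the one that the given structure of `T` assigns to
    -- this very box.
    total-rep : Rep P.probT (up id) δ₁ i (ρ ,, h ρ) B′
    total-rep = record
      { point≈ = Γ.symm (Γ.·-id ρ) Γ.⨾ Γ.·-cong Γ.rfl (≈ʰ-trans (ext-coord i id)
                   (ext-cong i (≈ʰ-trans (∘-idʳ (deg i)) (≈ʰ-sym (∘-idˡ (deg i)))) ≈-refl))
      ; face≈  = ≈-sym (subᶠ-id (Box.ψ B))
      ; side≈  = λ g q d e →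
          let x : CSet.Pt (Yo ℓ I ×𝕀) _
              x = up (id ∘ (deg i ∘ g)) , coord i g
          in rel-sym cast-rel
             ⊙ rel-sym (to-toT (ρ Γ.· g) (at (u B) g Γ.rfl d))
             ⊙ toT-rel (rel-sym (boxSide-rel B x g (≈ʰ-trans (ext-coord i g) (ext-cong i (≈ʰ-sym (∘-idˡ (deg i ∘ g))) ≈-refl)) Γ.rfl e d))
                 (h _) (h _)
             ⊙ toTSide-rel D (boxProb B) x e (h _)
             ⊙ P.sideδ-rel (up (id ∘ (deg i ∘ g))) (coord i g) (P.δ-one (λ x → h _) (up (id ∘ (deg i ∘ g)))) e
      ; init≈  =
          rel-sym cast-rel
          ⊙ rel-sym (to-toT (ρ Γ.· face i false) (a₀ B))
          ⊙ toT-rel (boxInit-rel B id) (h _) (h _)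
          ⊙ toTInit-rel D (boxProb B) (up id) (h _)
          ⊙ P.initδ-rel (up id) δ₁
      }

    glueComp-total : T.Eq ((ρ Γ.· face i true) ,, h _) (_≅_.to ≅T {ρ = ρ Γ.· face i true} (comp glueComp i ρ B))
                       (comp (subComp T (total φ h) cT) i ρ (toBox ≅T B))
    glueComp-total = rel-id-eq
      ( rel-sym (to-toT (ρ Γ.· face i true) (glueResult B))
      ⊙ rel-sym (glueResult-T B id (Γ.symm (Γ.·-id _)) (h _))
      ⊙ P.outT-δ (up id) (h _) δ₁
      ⊙ rel-sym (gcomp-rep P.probT cT δ₁ {C = B′} total-rep)
      ⊙ subComp-rel T (total φ h) cT (toBox ≅T B))

-- Substitution

module _ {ℓ} {Γ Δ : CSet ℓ} (σ : Δ ⟶ Γ) (D : GlueData Γ) (S : FibrantGlueData D) where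
  open GlueData D
  open FibrantGlueData S renaming (compA to cA; compT to cT; equivw to E)
  private
    module Γ = CSet Γ
    module Δ = CSet Δ
    module T = Ty T
    module A = Ty A
    Dσ = subGlueData σ D
    Sσ = subFibrantGlueData σ {D = D} S
    module D = GlueElements D
    module Dσ = GlueElements Dσ
    module K = GlueComposition D S
    module Kσ = GlueComposition Dσ Sσ
    E≅ = GlueSub σ D

  opaque
    unfolding GlueElements.sysᴳ GlueElements.unglue

    unglue-sub : ∀ {I} (ρ : Δ.Pt I) (x : D.G.El (map σ ρ)) →
                 Rel A id (D.unglue (map σ ρ) x) (Dσ.unglue ρ (_≅_.to E≅ {ρ = ρ} x))
    unglue-sub ρ x with isOne? (map φ (map σ ρ))
    ... | yes c = eq-rel (A.Eq-sym _ (subTm-⟪⟫ T (restrictTo φ A) (σ ▸▸ φ) w (ρ ,, c) x))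
    ... | no _  = eq-rel (A.Eq-refl _)

    sys-sub : ∀ {I J} (ρ : Δ.Pt I) (x : D.G.El (map σ ρ)) (f : Hom J I) {ρ′ : Δ.Pt J} (p : ρ′ Δ.≈ ρ Δ.· f)
              .(c : map φ (map σ ρ′) ≈ᶠ 1F) →
              Rel T id (D.sysᴳ (map σ ρ) x f (map-res σ p) c) (Dσ.sysᴳ ρ (_≅_.to E≅ {ρ = ρ} x) f p c)
    sys-sub ρ x f p c with isOne? (map φ (map σ ρ))
    ... | yes _ = eq-rel (T.Eq-refl _)
    ... | no _  = eq-rel (T.Eq-refl _)

  toT-sub : ∀ {I} (ρ : Δ.Pt I) (x : D.G.El (map σ ρ)) .(c : map φ (map σ ρ) ≈ᶠ 1F) →
            Rel T id (D.toT (map σ ρ) x c) (Dσ.toT ρ (_≅_.to E≅ {ρ = ρ} x) c)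
  toT-sub ρ x c =
    D.sysᴳ-nat x id id (≈ʰ-sym (∘-idˡ id)) (Γ.symm (Γ.·-id (map σ ρ))) (map-res σ (Δ.symm (Δ.·-id ρ))) c c
    ⊙ sys-sub ρ x id (Δ.symm (Δ.·-id ρ)) c

  module _ {I} {i : Fresh I} {ρ : Δ.Pt (I ▹ i)} (B : Box (Glue D [ σ ]) i ρ) where
    private
      Bσ = subBox (Glue D) σ B
      B′ = toBox E≅ B
      P  = boxProb Bσ
      P′ = boxProb B′

    side-rel : ∀ {J} (x : CSet.Pt (Yo ℓ I ×𝕀) J) .(d : Box.ψ B ⟨ down (proj₁ x) ⟩ᶠ ≈ᶠ 1F) →
               Rel (Glue D) {ρ = map σ ρ Γ.· extAt Bσ x} {map σ (ρ Δ.· extAt B′ x)} id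
                 (val (boxSide Bσ) x (tt , d)) (at (u B) (extAt B′ x) Δ.rfl (ψ-ext B′ x d))
    side-rel x d =
      boxSide-rel Bσ x (extAt Bσ x) ≈ʰ-refl Γ.rfl d (ψ-ext Bσ x d)
      ⊙ rel-sym (cast-rel {A = Glue D} {k = Γ.rfl Γ.⨾ Γ.symm (map-nat σ ρ (extAt Bσ x))})

    side-rel′ : ∀ {J} (x : CSet.Pt (Yo ℓ I ×𝕀) J) .(d : Box.ψ B ⟨ down (proj₁ x) ⟩ᶠ ≈ᶠ 1F) →
                Rel (Glue Dσ) {ρ = ρ Δ.· extAt B′ x} {ρ Δ.· extAt B′ x} id
                  (_≅_.to E≅ {ρ = ρ Δ.· extAt B′ x} (at (u B) (extAt B′ x) Δ.rfl (ψ-ext B′ x d)))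
                  (val (boxSide B′) x (tt , d))
    side-rel′ x d = rel-sym (boxSide-rel B′ x (extAt B′ x) ≈ʰ-refl Δ.rfl d (ψ-ext B′ x d))

    init-rel : Rel (Glue D) {ρ = map σ ρ Γ.· face i false} {map σ (ρ Δ.· face i false)} id (a₀ Bσ) (a₀ B)
    init-rel = rel-sym (cast-rel {A = Glue D} {k = Γ.symm (map-nat σ ρ (face i false))})

    -- The context stays fixed and only the base changes: `Bσ` is read in `Glue D` over `map σ ρ`,
    -- and `B′` in the `Glue` of the substituted data over `ρ`. The map `GlueSub` preserves the
    -- components in A and T, by `unglue-sub` and `sys-sub`, so the split problems match.
    gprob-sub : GMatch D σ (gprob D P) idᶜ (gprob Dσ P′)
    gprob-sub = record
      { probA-match = record
        { ln-match   = λ f r _ _ → map-nat σ ρ (ext (down f) i r)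
        ; χ-match    = λ f → ≈-refl
        ; side-match = λ f r _ _ d d′ →
            rel-sym (unglueSide-rel D P (f , r) d)
            ⊙ D.unglue-rel (side-rel (f , r) d)
            ⊙ unglue-sub (ρ Δ.· ext (down f) i r) (at (u B) (ext (down f) i r) Δ.rfl (ψ-ext B′ (f , r) d))
            ⊙ rel-sub A σ (Dσ.unglue-rel (side-rel′ (f , r) d′))
            ⊙ rel-sub A σ (unglueSide-rel Dσ P′ (f , r) d′)
        ; init-match = λ f _ _ →
            rel-sym (unglueInit-rel D P f)
            ⊙ rel-div (≈ʰ-sym (∘-idʳ (down f)))
                (D.unglue-rel (boxInit-rel Bσ (down f)))
                ((D.unglue-rel init-rel ⊙ unglue-sub (ρ Δ.· face i false) (a₀ B))
                 ◅ rel-sub A σ (Dσ.unglue-rel (boxInit-rel B′ (down f))))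
            ⊙ rel-sub A σ (unglueInit-rel Dσ P′ f)
        }
      ; sideT-match = λ f r d d′ c c′ →
          rel-sym (toTSide-rel D P (f , r) d c)
          ⊙ D.toT-rel (side-rel (f , r) d) c c′
          ⊙ toT-sub (ρ Δ.· ext (down f) i r) (at (u B) (ext (down f) i r) Δ.rfl (ψ-ext B′ (f , r) d)) c′
          ⊙ rel-sub T (σ ▸▸ φ) (Dσ.toT-rel (side-rel′ (f , r) d′) c′ c′)
          ⊙ rel-sub T (σ ▸▸ φ) (toTSide-rel Dσ P′ (f , r) d′ c′)
      ; initT-match = λ f c c′ →
          let p : ρ Δ.· ext (down f) i 𝟎 Δ.≈ ρ Δ.· face i false Δ.· down f
              p = Δ.split ρ (≈ʰ-sym (face-∘ i false (down f)))
              q = map-nat σ ρ (ext (down f) i 𝟎) Γ.⨾ Γ.split (map σ ρ) (≈ʰ-sym (face-∘ i false (down f)))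
          in rel-sym (toTInit-rel D P f c)
             ⊙ rel-sym (D.sys-toT (boxInit-rel Bσ (down f)) q c′ c)
             ⊙ D.sys-rel init-rel (down f) (≈ʰ-sym (∘-idˡ (down f))) (map-res σ p) q c′
             ⊙ sys-sub (ρ Δ.· face i false) (a₀ B) (down f) p c′
             ⊙ rel-sub T (σ ▸▸ φ) (Dσ.sys-toT (boxInit-rel B′ (down f)) p c′ c′)
             ⊙ rel-sub T (σ ▸▸ φ) (toTInit-rel Dσ P′ f c′)
      }

    private
      module M = CoreMatch D cA cT E σ (FibrantGlueData.equivw Sσ) (subEquiv-over T (restrictTo φ A) (σ ▸▸ φ) w E)
                   (gprob D P) idᶜ (gprob Dσ P′) gprob-sub

    glueResult-sub : Rel (Glue D) {ρ = map σ ρ Γ.· face i true} {map σ (ρ Δ.· face i true)} id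
                       (K.glueResult Bσ) (comp (subComp (Glue D) σ K.glueComp) i ρ B)
    glueResult-sub = cast-rel {A = Glue D} {k = map-nat σ ρ (face i true)}

    glueComp-sub : Dσ.G.Eq (ρ Δ.· face i true)
                     (_≅_.to E≅ {ρ = ρ Δ.· face i true} (comp (subComp (Glue D) σ K.glueComp) i ρ B))
                     (comp Kσ.glueComp i ρ B′)
    glueComp-sub = rel-id-eq (Dσ.glue-rel (Δ.symm (Δ.·-id ρ₁))
      (rel-unsub A σ (Δ.symm (Δ.·-id ρ₁))
        (rel-sym (unglue-sub ρ₁ X)
        ⊙ rel-sym (D.unglue-rel glueResult-sub)
        ⊙ rel-sym (K.glueResult-A Bσ)
        ⊙ M.outA-match (up id)
        ⊙ rel-sub A σ (Kσ.glueResult-A B′)))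
      λ g {ρ″} q r c → rel-unsub T (σ ▸▸ φ) {ρ = ρ″ ,, c} {ρ″ ,, c} (Δ.symm (Δ.·-id ρ″))
        (let p = map-res σ r Γ.⨾ Γ.after id (id ∘ g) (over glueResult-sub) Γ.⨾ Γ.·-cong Γ.rfl (≈ʰ-refl {f = g})
         in rel-sym (sys-sub ρ₁ X (id ∘ g) r c)
            ⊙ rel-sym (D.sys-rel glueResult-sub (id ∘ g) {h = g} ≈ʰ-refl (map-res σ r) p c)
            ⊙ rel-sym (K.glueResult-T Bσ g p c)
            ⊙ M.outT-match (up g) (K.φ-end Bσ g p c) (Kσ.φ-end B′ g q c)
            ⊙ rel-sub T (σ ▸▸ φ) (Kσ.glueResult-T B′ g q c)))
      where
      ρ₁ = ρ Δ.· face i true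
      X = comp (subComp (Glue D) σ K.glueComp) i ρ B

theorem8p2 : ∀ {ℓ} →
    Σ[ glueComp ∈ (∀ {Γ : CSet ℓ} (D : GlueData Γ) → FibrantGlueData D → Comp (Glue D)) ]
    ((∀ {Γ : CSet ℓ} (D : GlueData Γ) (S : FibrantGlueData D)
    (h : ∀ {I} (ρ : CSet.Pt Γ I) → map (GlueData.φ D) ρ ≈ᶠ 1F) →
    SameComp (Glue≅T D h) (glueComp D S)
    (subComp (GlueData.T D) (total (GlueData.φ D) h) (FibrantGlueData.compT S)))
    × (∀ {Γ Δ : CSet ℓ} (σ : Δ ⟶ Γ) (D : GlueData Γ) (S : FibrantGlueData D) →
    SameComp (GlueSub σ D) (subComp (Glue D) σ (glueComp D S))
    (glueComp (subGlueData σ D) (subFibrantGlueData σ S))))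
theorem8p2 = GlueComposition.glueComp
           , (λ D S h i ρ B → glueComp-total D S h B)
           , (λ σ D S i ρ B → glueComp-sub σ D S B)
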